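{- Let $b>1$ be an integer and let $A\subset\{0,1,\dots,b-1\}$ contain at least one non-zero element; let $N=\#A$, $f=\max A$ and $\lambda=f/(b-1)$. Let $\alpha(s)$ be the entire function $\alpha(s)=\prod_{n=0}^\infty(1-b^{ -s-n}N)$, and let $(u_m(s))_{m\ge0}$ be the sequence of meromorphic functions on $\mathbb{C}$ defined in the context. Then, uniformly on every compact subset of the complex plane, $$\alpha(s)\,\frac{(s)_m}{m!}\,u_m(s) = O\bigl(\lambda^m m^{ -1}\bigr)\qquad (m\to\infty).$$ That is, for every compact $Q\subset\mathbb{C}$ there are a constant $M$ and an integer $m_0\ge 1$ such that $\bigl|\alpha(s)\frac{(s)_m}{m!}u_m(s)\bigr|\le M\lambda^m m^{ -1}$ for all $s\in Q$ and all $m\ge m_0$.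
   Context: $(s)_m=s(s+1)\cdots(s+m-1)$ is the Pochhammer symbol, with $(s)_0=1$. Put $\gamma_j=\sum_{a\in A}a^j$. The meromorphic functions $u_m(s)$ on $\mathbb{C}$ are defined by $u_0(s)=\dfrac{b^s}{b^s-N}$ and, for $m\ge1$, by the recurrence $$(b^{s+m}-N)\,u_m(s)=\sum_{j=1}^m\binom{m}{j}\gamma_j\,u_{m-j}(s).$$ (For $\Re s>\log_b N$ one has $u_m(s)=0^m+\sum_{l\ge1}\sum_{(a_1,\dots,a_l)\in A^l}(a_1b^{ -1}+\dots+a_lb^{ -l})^m b^{ -ls}$, with $0^0=1$.) The function $u_m$ has at most simple poles, located at zeros of $b^{s+j}-N$, $0\le j\le m$, so the products $\alpha(s)u_m(s)$ are entire functions; at poles of $u_m$ the product is understood as the value of this entire function. -}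

module Defs where

open import Algebra.Apartness.Bundles using (HeytingCommutativeRing; HeytingField)
open import Algebra.Bundles using (CommutativeRing; Semiring)
open import Algebra.Bundles.Raw using (RawRing)
import Algebra.Definitions.RawSemiring as RawSemiringOps
open import Data.Fin.Base using (Fin; toℕ)
open import Data.Fin.Subset using (Subset; ∣_∣)
open import Data.Fin.Subset.Properties using (_∈?_)
open import Data.List.Base using (List; map; filter; allFin)
import Data.List.Extrema.Nat as Extrema
open import Data.Nat.Base as ℕ using (ℕ; zero; suc; NonZero; NonTrivial; _!)
import Data.Nat.ListAction as ListAction
open import Data.Nat.Combinatorics using (_C_)
import Data.Nat.Properties as ℕ
open import Data.Product.Base using (∃; ∃-syntax; _×_; proj₁)
open import Data.Sum.Base using (_⊎_)
open import Data.Vec.Base using (Vec; []; _∷_; head; lookup)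
open import Level using (_⊔_) renaming (suc to lsuc)
open import Relation.Binary.Core using (Rel)
open import Relation.Binary.Structures using (IsStrictPartialOrder)
open import Relation.Nullary.Negation using (¬_)
open import Relation.Unary using (Pred)

-- The real numbers, axiomatically: a Cauchy-complete Archimedean ordered field.
-- Classically this determines ℝ up to unique isomorphism.  The axioms are the
-- constructive ones (no decidability of _<_), so the Cauchy reals are a model
-- as well.
record CompleteOrderedField c ℓ₁ ℓ₂ : Set (lsuc (c ⊔ ℓ₁ ⊔ ℓ₂)) where
  field
    heytingField : HeytingField c ℓ₁ ℓ₂

  open HeytingField heytingField public

  commutativeRing : CommutativeRing c ℓ₁
  commutativeRing = HeytingCommutativeRing.commutativeRing heytingCommutativeRing

  open RawSemiringOps (Semiring.rawSemiring (CommutativeRing.semiring commutativeRing)) public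
    using (_^_) renaming (_×_ to _×ⁿ_)

  fromℕ : ℕ → Carrier
  fromℕ n = n ×ⁿ 1#

  infix 4 _<_ _≤_

  field
    _<_                  : Rel Carrier ℓ₂
    isStrictPartialOrder : IsStrictPartialOrder _≈_ _<_
    #⇒<⊎>                : ∀ {x y} → x # y → x < y ⊎ y < x
    <⇒#                  : ∀ {x y} → x < y → x # y
    +-monoˡ-<            : ∀ z {x y} → x < y → x + z < y + z
    *-pos                : ∀ {x y} → 0# < x → 0# < y → 0# < x * y
    0<1                  : 0# < 1#
    archimedean          : ∀ x → ∃[ n ] x < fromℕ n

  _≤_ : Rel Carrier ℓ₂
  x ≤ y = ¬ (y < x)

  -- |x - y| < ε
  Within : Carrier → Carrier → Carrier → Set ℓ₂
  Within ε x y = x < y + ε × y < x + ε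

  IsCauchy : (ℕ → Carrier) → Set (c ⊔ ℓ₂)
  IsCauchy x = ∀ ε → 0# < ε →
    ∃[ n₀ ] ∀ m n → n₀ ℕ.≤ m → n₀ ℕ.≤ n → Within ε (x m) (x n)

  _ConvergesTo_ : (ℕ → Carrier) → Carrier → Set (c ⊔ ℓ₂)
  x ConvergesTo l = ∀ ε → 0# < ε →
    ∃[ n₀ ] ∀ n → n₀ ℕ.≤ n → Within ε (x n) l

  field
    complete : ∀ x → IsCauchy x → ∃[ l ] x ConvergesTo l

  private
    module <-Order = IsStrictPartialOrder isStrictPartialOrder

  0<fromℕ-suc : ∀ n → 0# < fromℕ (suc n)
  0<fromℕ-suc zero = <-Order.<-respʳ-≈ (sym (+-identityʳ 1#)) 0<1
  0<fromℕ-suc (suc n) = <-Order.trans (0<fromℕ-suc n)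
    (<-Order.<-respˡ-≈ (+-identityˡ (fromℕ (suc n)))
      (+-monoˡ-< (fromℕ (suc n)) 0<1))

  reciprocal : ∀ x → 0# < x → Carrier
  reciprocal x 0<x = proj₁ (#⇒invertible (#-sym (<⇒# 0<x)))

  1/ : (n : ℕ) .{{_ : NonZero n}} → Carrier
  1/ (suc n) = reciprocal (fromℕ (suc n)) (0<fromℕ-suc n)

module Analysis {c ℓ₁ ℓ₂} (ℛ : CompleteOrderedField c ℓ₁ ℓ₂) where

  module ℝ = CompleteOrderedField ℛ
  open ℝ using () renaming (Carrier to ℝ) public

  infix 6 _+i_

  record ℂ : Set c where
    constructor _+i_
    field
      re im : ℝ

  open ℂ public

  ℂ-rawRing : RawRing c ℓ₁
  ℂ-rawRing = record
    { Carrier = ℂ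
    ; _≈_ = λ z w → re z ℝ.≈ re w × im z ℝ.≈ im w
    ; _+_ = λ z w → (re z ℝ.+ re w) +i (im z ℝ.+ im w)
    ; _*_ = λ z w → (re z ℝ.* re w ℝ.- im z ℝ.* im w) +i (re z ℝ.* im w ℝ.+ im z ℝ.* re w)
    ; -_ = λ z → (ℝ.- re z) +i (ℝ.- im z)
    ; 0# = ℝ.0# +i ℝ.0#
    ; 1# = ℝ.1# +i ℝ.0#
    }

  open RawRing ℂ-rawRing public hiding (Carrier)
  open RawSemiringOps (RawRing.rawSemiring ℂ-rawRing) public
    using (_^_; sum; product)

  infixl 6 _-_

  _-_ : ℂ → ℂ → ℂ
  z - w = z + - w

  real : ℝ → ℂ
  real x = x +i ℝ.0#

  nat : ℕ → ℂ
  nat n = real (ℝ.fromℕ n)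

  Σ[k<_] : ℕ → (ℕ → ℂ) → ℂ
  Σ[k< n ] f = sum {n} (λ k → f (toℕ k))

  Π[k<_] : ℕ → (ℕ → ℂ) → ℂ
  Π[k< n ] f = product {n} (λ k → f (toℕ k))

  normSq : ℂ → ℝ
  normSq z = re z ℝ.* re z ℝ.+ im z ℝ.* im z

  -- The modulus is the square root of normSq; comparisons of moduli are
  -- written out after squaring.
  ∣_∣<_ ∣_∣≤_ : ℂ → ℝ → Set ℓ₂
  ∣ z ∣< r = ℝ.0# ℝ.< r × normSq z ℝ.< r ℝ.* r
  ∣ z ∣≤ r = ℝ.0# ℝ.≤ r × normSq z ℝ.≤ r ℝ.* r

  Nonzero : ℂ → Set ℓ₂
  Nonzero z = ℝ.0# ℝ.< normSq z

  inverse : ∀ z → Nonzero z → ℂ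
  inverse z z≠0 = (re z ℝ.* r) +i (ℝ.- im z ℝ.* r)
    where r = ℝ.reciprocal (normSq z) z≠0

  _⟶_ : (ℕ → ℂ) → ℂ → Set (c ⊔ ℓ₂)
  x ⟶ l = ∀ ε → ℝ.0# ℝ.< ε → ∃[ n₀ ] ∀ n → n₀ ℕ.≤ n → ∣ x n - l ∣< ε

  -- d is the complex derivative of g at s:  for w near s,
  -- |g(w) - g(s) - d (w - s)| ≤ ε |w - s|.
  HasDerivative : (ℂ → ℂ) → ℂ → ℂ → Set (c ⊔ ℓ₂)
  HasDerivative g s d = ∀ ε → ℝ.0# ℝ.< ε → ∃[ δ ] ℝ.0# ℝ.< δ ×
    (∀ w → ∣ w - s ∣< δ →
      normSq (g w - g s - d * (w - s)) ℝ.≤ ε ℝ.* ε ℝ.* normSq (w - s))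

  Entire : (ℂ → ℂ) → Set (c ⊔ ℓ₂)
  Entire g = ∀ s → ∃[ d ] HasDerivative g s d

  -- Compactness of a subset of ℂ in the form that is standard constructively:
  -- closed (equivalently complete) and totally bounded.
  record IsCompact {p} (Q : Pred ℂ p) : Set (c ⊔ ℓ₂ ⊔ p) where
    field
      closed         : ∀ x l → (∀ n → Q (x n)) → x ⟶ l → Q l
      totallyBounded : ∀ ε → ℝ.0# ℝ.< ε →
        ∃[ n ] ∃ λ (x : Fin n → ℂ) →
          (∀ i → Q (x i)) × (∀ z → Q z → ∃[ i ] ∣ z - x i ∣< ε)

  IsExp : (ℂ → ℂ) → Set (c ⊔ ℓ₂)
  IsExp exp = ∀ z →
    (λ n → Σ[k< n ] λ k → z ^ k * real (ℝ.1/ (k !) {{ℕ._!≢0 k}})) ⟶ exp z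

  pochhammer : ℂ → ℕ → ℂ
  pochhammer s m = Π[k< m ] λ k → s + nat k

module Digits {b : ℕ} (A : Subset b) where

  elements : List ℕ
  elements = map toℕ (filter (_∈? A) (allFin b))

  N : ℕ
  N = ∣ A ∣

  f : ℕ
  f = Extrema.max 0 elements

  γ : ℕ → ℕ
  γ j = ListAction.sum (map (ℕ._^ j) elements)

-- `bpow s` stands for b^s = exp (s log b).
module Moments {c ℓ₁ ℓ₂} (ℛ : CompleteOrderedField c ℓ₁ ℓ₂)
               (bpow : Analysis.ℂ ℛ → Analysis.ℂ ℛ)
               {b : ℕ} (A : Subset b) where

  open Analysis ℛ
  open Digits A

  IsAlpha : (ℂ → ℂ) → Set (c ⊔ ℓ₂)
  IsAlpha α = ∀ s →
    (λ n → Π[k< n ] λ k → 1# - bpow (- s - nat k) * nat N) ⟶ α s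

  -- s is not a zero of b^(s+j) - N for any 0 ≤ j ≤ m; for such s the
  -- recurrence determines u₀(s), …, uₘ(s).
  Regular : ℕ → ℂ → Set ℓ₂
  Regular m s = ∀ j → j ℕ.≤ m → Nonzero (bpow (s + nat j) - nat N)

  -- The values uₘ(s) ∷ uₘ₋₁(s) ∷ … ∷ u₀(s) ∷ [], so that position i of the
  -- table for m is the term j = i + 1 of the sum defining uₘ₊₁(s).
  uTable : ∀ m s → Regular m s → Vec ℂ (suc m)
  uTable zero s reg =
    bpow s * inverse (bpow (s + nat 0) - nat N) (reg 0 ℕ.≤-refl) ∷ []
  uTable (suc m) s reg =
    sum (λ i → nat (suc m C suc (toℕ i)) * nat (γ (suc (toℕ i))) * lookup previous i)
      * inverse (bpow (s + nat (suc m)) - nat N) (reg (suc m) ℕ.≤-refl)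
    ∷ previous
    where
    previous : Vec ℂ (suc m)
    previous = uTable m s (λ j j≤m → reg j (ℕ.m≤n⇒m≤1+n j≤m))

  u : ∀ m s → Regular m s → ℂ
  u m s reg = head (uTable m s reg)

  -- f / (b - 1)
  Λ : .{{_ : NonTrivial b}} → ℝ
  Λ = ℝ.fromℕ f ℝ.* ℝ.1/ (b ℕ.∸ 1) {{ℕ.>-nonZero (ℕ.m<n⇒0<n∸m (ℕ.nonTrivial⇒n>1 b))}}

{-# OPTIONS --safe #-}
module Submission where

-- Normalised by factorials, α u_m and γ_j become sequences â_m and γ̂_j for which
-- the recurrence is a convolution: (b^(s+m) - N) â_m = Σ_{j ≥ 1} γ̂_j â_{m-j}.
-- Up to errors of relative size θ^m with θ < 1, the coefficients γ̂_j may be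
-- replaced by f^j / j!, and then y = Re s + K and
--   x_{K+i} = Λ^(K+i) / ((y + 1) ⋯ (y + i))
-- give a supersolution of the resulting inequality between moduli: the
-- convolution of (b - 1)^j / j! with 1 / (y + 1)_i is b^i / (y + 1)_i times a
-- partial sum of the binomial series of (1 - (1 - 1/b))^(-y) = b^y, and these
-- partial sums are at most b^y = |b^(s+K)|.  By induction α u_m / m! is at most a
-- constant times x_m, and |(s)_m| x_m = O(Λ^m / m) follows by comparing |s + K + l|
-- with y + l.  The initial values are bounded because the zeros of α cancel the
-- poles of u_m; s with b^(s+j) = N is reached as a limit of s + h, h > 0.

-- The supersolution has the order of Λ^m / Γ(Re s + m + 1): its denominator is a ratio of Gamma
-- values, written as a finite product so that only multiplication enters. An induction that loses a
-- fixed factor per step would destroy the rate Λ^m, so the step to index j may cost only a factor 1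
-- + κ θ^j; the product of all these factors is at most exp (κ / (1 - θ)). Three errors must fit
-- into θ^j: the digits other than f, the term -N beside b^(s+m), and the indices below K, where
-- b^(s+k) - N may vanish. The first and the last are dominated by s^m / m! with s = b - 1/2, and θ
-- = 1 - 1/(4b) satisfies s ≤ b θ². One factor θ^m remains as decay; the other pays for replacing 1
-- / i! by 1 / ((y + 1) ⋯ (y + i)). The order of the reals is not decidable, but every weak
-- inequality is a negation, so case distinctions are available inside its proof, and even the
-- points near a pole are required only up to double negation. Moduli are compared through their
-- squares, and b^y is reached from rational exponents.

open import Defs
open import Algebra.Bundles using (CommutativeRing; Semiring)
open import Algebra.Bundles.Raw using (RawRing)
import Algebra.Definitions.RawSemiring as RawSemiringOps
import Algebra.Properties.CommutativeSemiring.Exp as CommutativeSemiringExp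
import Algebra.Properties.Ring as RingProperties
import Algebra.Properties.Semiring.Exp as SemiringExp
import Algebra.Properties.Semiring.Mult as SemiringMult
import Algebra.Properties.Semiring.Mult.TCOptimised as Multiples
import Algebra.Solver.Ring as RingSolver
open import Algebra.Solver.Ring.AlmostCommutativeRing using (fromCommutativeRing; _-Raw-AlmostCommutative⟶_)
open import Data.Empty using (⊥-elim)
open import Data.Fin.Base as Fin using (Fin; toℕ)
import Data.Fin.Properties as Fin
open import Data.Fin.Subset using (Subset; _∈_)
open import Data.Fin.Subset.Properties using (_∈?_)
open import Data.Integer.Base as ℤ using (ℤ)
import Data.Integer.Properties as ℤ
open import Data.List.Base using (List; []; _∷_; map; filter; allFin; length)
import Data.List.Extrema.Nat as Extrema
import Data.List.Membership.Propositional.Properties as Membership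
import Data.List.Properties as List
open import Data.List.Relation.Unary.All as All using (All; []; _∷_)
import Data.List.Relation.Unary.All.Properties as All
open import Data.List.Relation.Unary.AllPairs using (_∷_)
open import Data.List.Relation.Unary.Unique.Propositional using (Unique)
import Data.List.Relation.Unary.Unique.Propositional.Properties as Unique
open import Data.Maybe.Base using (Maybe; just; nothing)
open import Data.Nat.Base as ℕ using (ℕ; zero; suc; NonZero; _!; NonTrivial)
open import Data.Nat.Combinatorics using (nCk≡n!/k![n-k]!; k![n∸k]!∣n!) renaming (_C_ to _choose_)
open import Data.Nat.DivMod using (m/n*n≡m)
import Data.Nat.ListAction as ListAction
import Data.Nat.Properties as ℕ
open import Data.Nat.Properties using (_!≢0)
open import Data.Product.Base using (∃-syntax; _×_; _,_; proj₁; proj₂)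
open import Data.Sum.Base using (_⊎_; inj₁; inj₂; [_,_]′)
open import Data.Vec.Base using (Vec; []; _∷_; head; lookup)
open import Function.Base using (_∘_; _$_)
open import Relation.Binary.PropositionalEquality.Core as ≡ using (_≡_; _≢_)
import Relation.Binary.Reasoning.Base.Triple as TripleReasoning
import Relation.Binary.Reasoning.Setoid as SetoidReasoning
open import Relation.Binary.Structures using (IsPreorder; IsStrictPartialOrder)
open import Relation.Nullary.Decidable.Core using (yes; no)
open import Relation.Nullary.Negation using (¬_)
open import Relation.Unary using (Pred)

-- The solver needs integer rather than natural coefficients to cancel x - x.
module IntegerSolver {c ℓ} (R : CommutativeRing c ℓ) where

  open CommutativeRing R
  open RingProperties ring
    using (-0#≈0#; -‿distribˡ-*; -‿distribʳ-*; -‿+-comm; -‿involutive)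
  open Multiples semiring using (×1-homo-*) renaming (_×_ to _×′_; ×-homo-+ to ×′-homo-+; 1+× to 1+×′)
  open SetoidReasoning setoid

  private
    ⟦_⟧ : ℤ → Carrier
    ⟦ ℤ.+ n ⟧     = n ×′ 1#
    ⟦ ℤ.-[1+ n ] ⟧ = - (suc n ×′ 1#)

    -‿homo : ∀ i → ⟦ ℤ.- i ⟧ ≈ - ⟦ i ⟧
    -‿homo (ℤ.+ zero)  = sym -0#≈0#
    -‿homo (ℤ.+ suc n) = refl
    -‿homo ℤ.-[1+ n ]  = sym (-‿involutive _)

    cancel : ∀ a b → a - b ≈ (1# + a) - (1# + b)
    cancel a b = begin
      a - b  ≈⟨ +-identityˡ _ ⟨
      0# + (a - b)  ≈⟨ +-congʳ (-‿inverseʳ 1#) ⟨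
      (1# - 1#) + (a - b)  ≈⟨ +-assoc _ _ _ ⟩
      1# + (- 1# + (a - b))  ≈⟨ +-congˡ (+-comm _ _) ⟩
      1# + (a - b + - 1#)  ≈⟨ +-congˡ (+-assoc _ _ _) ⟩
      1# + (a + (- b + - 1#))  ≈⟨ +-assoc _ _ _ ⟨
      (1# + a) + (- b + - 1#)  ≈⟨ +-congˡ (+-comm _ _) ⟩
      (1# + a) + (- 1# + - b)  ≈⟨ +-congˡ (-‿+-comm _ _) ⟩
      (1# + a) - (1# + b)  ∎

    ⊖-homo : ∀ m n → ⟦ m ℤ.⊖ n ⟧ ≈ m ×′ 1# - n ×′ 1#
    ⊖-homo m zero          = sym (trans (+-congˡ -0#≈0#) (+-identityʳ _))
    ⊖-homo zero (suc n)    = sym (+-identityˡ _)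
    ⊖-homo (suc m) (suc n) = begin
      ⟦ suc m ℤ.⊖ suc n ⟧  ≡⟨ ≡.cong ⟦_⟧ (ℤ.[1+m]⊖[1+n]≡m⊖n m n) ⟩
      ⟦ m ℤ.⊖ n ⟧  ≈⟨ ⊖-homo m n ⟩
      m ×′ 1# - n ×′ 1#  ≈⟨ cancel _ _ ⟩
      (1# + m ×′ 1#) - (1# + n ×′ 1#)  ≈⟨ +-cong (1+×′ m 1#) (-‿cong (1+×′ n 1#)) ⟨
      suc m ×′ 1# - suc n ×′ 1#  ∎

    +-homo : ∀ i j → ⟦ i ℤ.+ j ⟧ ≈ ⟦ i ⟧ + ⟦ j ⟧
    +-homo (ℤ.+ m) (ℤ.+ n)         = ×′-homo-+ 1# m n
    +-homo (ℤ.+ m) ℤ.-[1+ n ]      = ⊖-homo m (suc n)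
    +-homo ℤ.-[1+ m ] (ℤ.+ n)      = trans (⊖-homo n (suc m)) (+-comm _ _)
    +-homo ℤ.-[1+ m ] ℤ.-[1+ n ]   = begin
      - (suc (suc (m ℕ.+ n)) ×′ 1#)  ≈⟨ -‿cong (1+×′ (suc (m ℕ.+ n)) 1#) ⟩
      - (1# + (suc m ℕ.+ n) ×′ 1#)  ≈⟨ -‿cong (+-congˡ (×′-homo-+ 1# (suc m) n)) ⟩
      - (1# + (suc m ×′ 1# + n ×′ 1#))  ≈⟨ -‿cong (+-congˡ (+-comm _ _)) ⟩
      - (1# + (n ×′ 1# + suc m ×′ 1#))  ≈⟨ -‿cong (+-assoc _ _ _) ⟨
      - (1# + n ×′ 1# + suc m ×′ 1#)  ≈⟨ -‿cong (+-congʳ (1+×′ n 1#)) ⟨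
      - (suc n ×′ 1# + suc m ×′ 1#)  ≈⟨ -‿cong (+-comm _ _) ⟩
      - (suc m ×′ 1# + suc n ×′ 1#)  ≈⟨ -‿+-comm _ _ ⟨
      - (suc m ×′ 1#) + - (suc n ×′ 1#)  ∎

    *-homo : ∀ i j → ⟦ i ℤ.* j ⟧ ≈ ⟦ i ⟧ * ⟦ j ⟧
    *-homo (ℤ.+ m) (ℤ.+ n) = begin
      ⟦ ℤ.+ m ℤ.* ℤ.+ n ⟧  ≡⟨ ≡.cong ⟦_⟧ (ℤ.+◃n≡+n (m ℕ.* n)) ⟩
      (m ℕ.* n) ×′ 1#  ≈⟨ ×1-homo-* m n ⟩
      m ×′ 1# * n ×′ 1#  ∎
    *-homo (ℤ.+ m) ℤ.-[1+ n ] = begin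
      ⟦ ℤ.+ m ℤ.* ℤ.-[1+ n ] ⟧  ≡⟨ ≡.cong ⟦_⟧ (ℤ.-◃n≡-n (m ℕ.* suc n)) ⟩
      ⟦ ℤ.- (ℤ.+ (m ℕ.* suc n)) ⟧  ≈⟨ -‿homo (ℤ.+ (m ℕ.* suc n)) ⟩
      - ((m ℕ.* suc n) ×′ 1#)  ≈⟨ -‿cong (×1-homo-* m (suc n)) ⟩
      - (m ×′ 1# * suc n ×′ 1#)  ≈⟨ -‿distribʳ-* _ _ ⟩
      m ×′ 1# * - (suc n ×′ 1#)  ∎
    *-homo ℤ.-[1+ m ] (ℤ.+ n) = begin
      ⟦ ℤ.-[1+ m ] ℤ.* ℤ.+ n ⟧  ≡⟨ ≡.cong ⟦_⟧ (ℤ.-◃n≡-n (suc m ℕ.* n)) ⟩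
      ⟦ ℤ.- (ℤ.+ (suc m ℕ.* n)) ⟧  ≈⟨ -‿homo (ℤ.+ (suc m ℕ.* n)) ⟩
      - ((suc m ℕ.* n) ×′ 1#)  ≈⟨ -‿cong (×1-homo-* (suc m) n) ⟩
      - (suc m ×′ 1# * n ×′ 1#)  ≈⟨ -‿distribˡ-* _ _ ⟩
      - (suc m ×′ 1#) * n ×′ 1#  ∎
    *-homo ℤ.-[1+ m ] ℤ.-[1+ n ] = begin
      (suc m ℕ.* suc n) ×′ 1#  ≈⟨ ×1-homo-* (suc m) (suc n) ⟩
      suc m ×′ 1# * suc n ×′ 1#  ≈⟨ -‿involutive _ ⟨
      - (- (suc m ×′ 1# * suc n ×′ 1#))  ≈⟨ -‿cong (-‿distribˡ-* _ _) ⟩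
      - (- (suc m ×′ 1#) * suc n ×′ 1#)  ≈⟨ -‿distribʳ-* _ _ ⟩
      - (suc m ×′ 1#) * - (suc n ×′ 1#)  ∎

    ℤ-rawRing : RawRing _ _
    ℤ-rawRing = ℤ.+-*-rawRing

    morphism : ℤ-rawRing -Raw-AlmostCommutative⟶ fromCommutativeRing R
    morphism = record
      { ⟦_⟧ = ⟦_⟧ ; +-homo = +-homo ; *-homo = *-homo ; -‿homo = -‿homo
      ; 0-homo = refl ; 1-homo = refl }

    _≟_ : ∀ i j → Maybe (⟦ i ⟧ ≈ ⟦ j ⟧)
    i ≟ j with i ℤ.≟ j
    ... | yes ≡.refl = just refl
    ... | no _       = nothing

  open RingSolver ℤ-rawRing (fromCommutativeRing R) morphism _≟_ public
    using (Polynomial; solve; _:=_; _:+_; _:*_; _:-_; :-_; con)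

  :0 :1 : ∀ {n} → Polynomial n
  :0 = con (ℤ.+ 0)
  :1 = con (ℤ.+ 1)

-- Order and inequalities in a constructive ordered field.

module OrderedField {c ℓ₁ ℓ₂} (ℛ : CompleteOrderedField c ℓ₁ ℓ₂) where

  open CompleteOrderedField ℛ public
    using (commutativeRing; fromℕ; _<_; _≤_; *-pos; 0<1; archimedean; +-monoˡ-<; reciprocal; 1/; 0<fromℕ-suc; _^_)
  open CompleteOrderedField ℛ
    using (isStrictPartialOrder; _#_; #-cotrans; #⇒<⊎>; <⇒#; #⇒invertible; tight; #-sym)
  open CommutativeRing commutativeRing public hiding (zero)
  open IntegerSolver commutativeRing public
  open IsStrictPartialOrder isStrictPartialOrder public
    using (<-resp-≈; <-respˡ-≈; <-respʳ-≈)
    renaming (trans to <-trans; irrefl to <-irrefl; asym to <-asym)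
  open SemiringMult semiring public using (×1-homo-*; ×-homo-+)
  open SemiringExp semiring public using (^-homo-*; ^-congˡ)
  open CommutativeSemiringExp commutativeSemiring public using (^-distrib-*)

  2# : Carrier
  2# = 1# + 1#

  -- The substitute for trichotomy. Apartness is cotransitive and splits into two strict
  -- inequalities; the unwanted one combines with `x < y` by transitivity.
  <-cotrans : ∀ {x y} z → x < y → x < z ⊎ z < y
  <-cotrans z x<y with #-cotrans (<⇒# x<y) z
  ... | inj₁ x#z = [ inj₁ , (λ z<x → inj₂ (<-trans z<x x<y)) ]′ (#⇒<⊎> x#z)
  ... | inj₂ z#y = [ inj₂ , (λ y<z → inj₁ (<-trans x<y y<z)) ]′ (#⇒<⊎> z#y)

  <⇒≤ : ∀ {x y} → x < y → x ≤ y
  <⇒≤ x<y y<x = <-asym x<y y<x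

  ≤-reflexive : ∀ {x y} → x ≈ y → x ≤ y
  ≤-reflexive x≈y y<x = <-irrefl (sym x≈y) y<x

  ≤-refl : ∀ {x} → x ≤ x
  ≤-refl = ≤-reflexive refl

  ≤-trans : ∀ {x y z} → x ≤ y → y ≤ z → x ≤ z
  ≤-trans {y = y} x≤y y≤z z<x = [ y≤z , x≤y ]′ (<-cotrans y z<x)

  <-≤-trans : ∀ {x y z} → x < y → y ≤ z → x < z
  <-≤-trans {z = z} x<y y≤z = [ (λ x<z → x<z) , (λ z<y → ⊥-elim (y≤z z<y)) ]′ (<-cotrans z x<y)

  ≤-<-trans : ∀ {x y z} → x ≤ y → y < z → x < z
  ≤-<-trans {x = x} x≤y y<z = [ (λ y<x → ⊥-elim (x≤y y<x)) , (λ x<z → x<z) ]′ (<-cotrans x y<z)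

  ≤-antisym : ∀ {x y} → x ≤ y → y ≤ x → x ≈ y
  ≤-antisym {x} {y} x≤y y≤x = proj₁ (tight x y) (λ x#y → [ y≤x , x≤y ]′ (#⇒<⊎> x#y))

  ≤-isPreorder : IsPreorder _≈_ _≤_
  ≤-isPreorder = record { isEquivalence = isEquivalence ; reflexive = ≤-reflexive ; trans = ≤-trans }

  open TripleReasoning ≤-isPreorder
    <-asym <-trans <-resp-≈ <⇒≤ <-≤-trans ≤-<-trans public

  -- Comparison of x and y is not decidable, but it may be assumed when the goal
  -- is a negation, such as an inequality _≤_.
  ≤-by-cases : ∀ {p} {P : Set p} x y → (x < y → ¬ P) → (y ≤ x → ¬ P) → ¬ P
  ≤-by-cases x y lt ge p = ge (λ x<y → lt x<y p) p

  +-monoʳ-< : ∀ z {x y} → x < y → z + x < z + y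
  +-monoʳ-< z x<y = <-respˡ-≈ (+-comm _ _) (<-respʳ-≈ (+-comm _ _) (+-monoˡ-< z x<y))

  +-cancelʳ-< : ∀ z {x y} → x + z < y + z → x < y
  +-cancelʳ-< z {x} {y} lt = <-respˡ-≈ (lemma x z) (<-respʳ-≈ (lemma y z) (+-monoˡ-< (- z) lt))
    where
    lemma : ∀ x z → x + z - z ≈ x
    lemma = solve 2 (λ x z → x :+ z :- z := x) refl

  +-mono-≤ : ∀ {x y u v} → x ≤ y → u ≤ v → x + u ≤ y + v
  +-mono-≤ {x} {y} {u} {v} x≤y u≤v = ≤-trans
    {y = y + u}
    (λ lt → x≤y (+-cancelʳ-< u lt))
    (λ lt → u≤v (+-cancelʳ-< y (<-respˡ-≈ (+-comm _ _) (<-respʳ-≈ (+-comm _ _) lt))))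

  +-monoˡ-≤ : ∀ z {x y} → x ≤ y → x + z ≤ y + z
  +-monoˡ-≤ z x≤y = +-mono-≤ x≤y ≤-refl

  +-monoʳ-≤ : ∀ z {x y} → x ≤ y → z + x ≤ z + y
  +-monoʳ-≤ z x≤y = +-mono-≤ ≤-refl x≤y

  +-mono-<-≤ : ∀ {x y u v} → x < y → u ≤ v → x + u < y + v
  +-mono-<-≤ {u = u} x<y u≤v = <-≤-trans (+-monoˡ-< u x<y) (+-monoʳ-≤ _ u≤v)

  x≤y⇒0≤y-x : ∀ {x y} → x ≤ y → 0# ≤ y - x
  x≤y⇒0≤y-x {x} {y} x≤y = ≤-trans (≤-reflexive (sym (-‿inverseʳ x))) (+-monoˡ-≤ (- x) x≤y)

  x<y⇒0<y-x : ∀ {x y} → x < y → 0# < y - x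
  x<y⇒0<y-x {x} {y} x<y = <-respˡ-≈ (-‿inverseʳ x) (+-monoˡ-< (- x) x<y)

  0≤d⇒x≤y : ∀ {x y d} → 0# ≤ d → x + d ≈ y → x ≤ y
  0≤d⇒x≤y {x} 0≤d eq = ≤-trans (≤-reflexive (sym (+-identityʳ x))) (≤-trans (+-monoʳ-≤ x 0≤d) (≤-reflexive eq))

  0<d⇒x<y : ∀ {x y d} → 0# < d → x + d ≈ y → x < y
  0<d⇒x<y {x} 0<d eq = <-respˡ-≈ (+-identityʳ x) (<-respʳ-≈ eq (+-monoʳ-< x 0<d))

  +-nonneg : ∀ {x y} → 0# ≤ x → 0# ≤ y → 0# ≤ x + y
  +-nonneg 0≤x 0≤y = ≤-trans (≤-reflexive (sym (+-identityʳ 0#))) (+-mono-≤ 0≤x 0≤y)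

  +-pos-nonneg : ∀ {x y} → 0# < x → 0# ≤ y → 0# < x + y
  +-pos-nonneg 0<x 0≤y = <-respˡ-≈ (+-identityʳ 0#) (+-mono-<-≤ 0<x 0≤y)

  x≤x+y : ∀ {x y} → 0# ≤ y → x ≤ x + y
  x≤x+y 0≤y = 0≤d⇒x≤y 0≤y refl

  x≤y+x : ∀ {x y} → 0# ≤ y → x ≤ y + x
  x≤y+x 0≤y = 0≤d⇒x≤y 0≤y (+-comm _ _)

  neg-mono-≤ : ∀ {x y} → x ≤ y → - y ≤ - x
  neg-mono-≤ {x} {y} x≤y = 0≤d⇒x≤y (x≤y⇒0≤y-x x≤y)
    (solve 2 (λ x y → :- y :+ (y :- x) := :- x) refl x y)

  -- The axiom covers positive factors only. Since the goal is a negation, each factor may be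
  -- assumed to be positive or equal to zero.
  *-nonneg : ∀ {x y} → 0# ≤ x → 0# ≤ y → 0# ≤ x * y
  *-nonneg {x} {y} 0≤x 0≤y = ≤-by-cases 0# x
    (λ 0<x → ≤-by-cases 0# y
      (λ 0<y → <⇒≤ (*-pos 0<x 0<y))
      (λ y≤0 → ≤-reflexive (sym (trans (*-congˡ (≤-antisym y≤0 0≤y)) (zeroʳ x)))))
    (λ x≤0 → ≤-reflexive (sym (trans (*-congʳ (≤-antisym x≤0 0≤x)) (zeroˡ y))))

  *-monoʳ-≤ : ∀ {z x y} → 0# ≤ z → x ≤ y → z * x ≤ z * y
  *-monoʳ-≤ {z} {x} {y} 0≤z x≤y = 0≤d⇒x≤y (*-nonneg 0≤z (x≤y⇒0≤y-x x≤y))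
    (solve 3 (λ x y z → z :* x :+ z :* (y :- x) := z :* y) refl x y z)

  *-monoˡ-≤ : ∀ {z x y} → 0# ≤ z → x ≤ y → x * z ≤ y * z
  *-monoˡ-≤ 0≤z x≤y = ≤-trans (≤-reflexive (*-comm _ _))
    (≤-trans (*-monoʳ-≤ 0≤z x≤y) (≤-reflexive (*-comm _ _)))

  *-mono-≤ : ∀ {x y u v} → 0# ≤ y → 0# ≤ u → x ≤ y → u ≤ v → x * u ≤ y * v
  *-mono-≤ 0≤y 0≤u x≤y u≤v = ≤-trans (*-monoˡ-≤ 0≤u x≤y) (*-monoʳ-≤ 0≤y u≤v)

  *-monoʳ-< : ∀ {z x y} → 0# < z → x < y → z * x < z * y
  *-monoʳ-< {z} {x} {y} 0<z x<y = 0<d⇒x<y (*-pos 0<z (x<y⇒0<y-x x<y))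
    (solve 3 (λ x y z → z :* x :+ z :* (y :- x) := z :* y) refl x y z)

  *-cancelˡ-≤ : ∀ {z x y} → 0# < z → z * x ≤ z * y → x ≤ y
  *-cancelˡ-≤ 0<z le y<x = le (*-monoʳ-< 0<z y<x)

  x*x-nonneg : ∀ x → 0# ≤ x * x
  x*x-nonneg x = ≤-by-cases 0# x
    (λ 0<x → <⇒≤ (*-pos 0<x 0<x))
    (λ x≤0 → ≤-trans (*-nonneg (0≤-x x≤0) (0≤-x x≤0))
      (≤-reflexive (solve 1 (λ x → :- x :* :- x := x :* x) refl x)))
    where
    0≤-x : x ≤ 0# → 0# ≤ - x
    0≤-x x≤0 = 0≤d⇒x≤y (x≤y⇒0≤y-x x≤0) (solve 1 (λ x → :0 :+ (:0 :- x) := :- x) refl x)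

  square-mono-< : ∀ {x y} → 0# ≤ x → x < y → x * x < y * y
  square-mono-< {x} {y} 0≤x x<y = 0<d⇒x<y
    (*-pos (x<y⇒0<y-x x<y) (+-pos-nonneg (≤-<-trans 0≤x x<y) 0≤x))
    (solve 2 (λ x y → x :* x :+ (y :- x) :* (y :+ x) := y :* y) refl x y)

  square-cancel-≤ : ∀ {x y} → 0# ≤ y → x * x ≤ y * y → x ≤ y
  square-cancel-≤ 0≤y le y<x = le (square-mono-< 0≤y y<x)

  square-mono-≤ : ∀ {x y} → 0# ≤ x → x ≤ y → x * x ≤ y * y
  square-mono-≤ 0≤x x≤y = *-mono-≤ (≤-trans 0≤x x≤y) 0≤x x≤y x≤y

  0≤1 : 0# ≤ 1#
  0≤1 = <⇒≤ 0<1

  0<2 : 0# < 2#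
  0<2 = +-pos-nonneg 0<1 0≤1

  reciprocal-inverse : ∀ x (0<x : 0# < x) → x * reciprocal x 0<x ≈ 1#
  reciprocal-inverse x 0<x =
    -- `#⇒invertible` inverts a difference, here x minus zero.
    trans (*-congʳ (solve 1 (λ x → x := x :- :0) refl x)) (proj₂ (proj₂ (#⇒invertible (#-sym (<⇒# 0<x)))))

  *-cancel-pos : ∀ {x y} → 0# < x → 0# < x * y → 0# < y
  *-cancel-pos {x} {y} 0<x 0<xy = <-respʳ-≈ eq (<-respˡ-≈ (zeroʳ r) (*-monoʳ-< 0<r 0<xy))
    where
    r = reciprocal x 0<x
    eq : r * (x * y) ≈ y
    eq = trans (solve 3 (λ r x y → r :* (x :* y) := (x :* r) :* y) refl r x y)
      (trans (*-congʳ (reciprocal-inverse x 0<x)) (*-identityˡ y))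
    0<r : 0# < r
    -- The number r is invertible, hence apart from zero; a negative r would make x r = 1 negative.
    0<r with #⇒<⊎> (CompleteOrderedField.invertible⇒# ℛ {r} {0#}
               (x , trans (*-congˡ (solve 1 (λ r → r :- :0 := r) refl r)) (reciprocal-inverse x 0<x)
                  , trans (*-congʳ (solve 1 (λ r → r :- :0 := r) refl r)) (trans (*-comm _ _) (reciprocal-inverse x 0<x))))
    ... | inj₂ 0<r = 0<r
    ... | inj₁ r<0 = ⊥-elim (<-asym 0<1
          (<-respˡ-≈ (reciprocal-inverse x 0<x) (<-respʳ-≈ (zeroʳ x) (*-monoʳ-< 0<x r<0))))

  0<reciprocal : ∀ x (0<x : 0# < x) → 0# < reciprocal x 0<x
  0<reciprocal x 0<x = *-cancel-pos 0<x (<-respʳ-≈ (sym (reciprocal-inverse x 0<x)) 0<1)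

-- Finite sums, convolutions and binomial series over a commutative ring.

module FormalSeries {c ℓ} (R : CommutativeRing c ℓ) where

  open CommutativeRing R
  open IntegerSolver R
  open RawSemiringOps (Semiring.rawSemiring semiring) using (sum; product; _^_) renaming (_×_ to _×ⁿ_)
  open SemiringMult semiring using (×1-homo-*)
  open SetoidReasoning setoid

  ι : ℕ → Carrier
  ι n = n ×ⁿ 1#

  ∑ ∏ : ℕ → (ℕ → Carrier) → Carrier
  ∑ n x = sum {n} (λ k → x (toℕ k))
  ∏ n x = product {n} (λ k → x (toℕ k))

  ∑-cong : ∀ n {x y} → (∀ k → x k ≈ y k) → ∑ n x ≈ ∑ n y
  ∑-cong zero    x≈y = refl
  ∑-cong (suc n) x≈y = +-cong (x≈y 0) (∑-cong n (x≈y ∘ suc))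

  ∏-cong : ∀ n {x y} → (∀ k → x k ≈ y k) → ∏ n x ≈ ∏ n y
  ∏-cong zero    x≈y = refl
  ∏-cong (suc n) x≈y = *-cong (x≈y 0) (∏-cong n (x≈y ∘ suc))

  ∑-last : ∀ n x → ∑ (suc n) x ≈ ∑ n x + x n
  ∑-last zero x    = +-comm _ _
  ∑-last (suc n) x = trans (+-congˡ (∑-last n (x ∘ suc))) (sym (+-assoc _ _ _))

  ∏-last : ∀ n x → ∏ (suc n) x ≈ ∏ n x * x n
  ∏-last zero x    = *-comm _ _
  ∏-last (suc n) x = trans (*-congˡ (∏-last n (x ∘ suc))) (sym (*-assoc _ _ _))

  ∏-split : ∀ m n x → ∏ (m ℕ.+ n) x ≈ ∏ m x * ∏ n (λ k → x (m ℕ.+ k))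
  ∏-split zero n x    = sym (*-identityˡ _)
  ∏-split (suc m) n x = trans (*-congˡ (∏-split m n (x ∘ suc))) (sym (*-assoc _ _ _))

  ∑-linear : ∀ n a x y → ∑ n (λ k → a * x k + y k) ≈ a * ∑ n x + ∑ n y
  ∑-linear zero a x y    = solve 1 (λ a → :0 := a :* :0 :+ :0) refl a
  ∑-linear (suc n) a x y = begin
    a * x 0 + y 0 + ∑ n (λ k → a * x (suc k) + y (suc k))  ≈⟨ +-congˡ (∑-linear n a (x ∘ suc) (y ∘ suc)) ⟩
    a * x 0 + y 0 + (a * ∑ n (x ∘ suc) + ∑ n (y ∘ suc))
      ≈⟨ solve 5 (λ a x y u v → a :* x :+ y :+ (a :* u :+ v) := a :* (x :+ u) :+ (y :+ v)) refl _ _ _ _ _ ⟩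
    a * ∑ (suc n) x + ∑ (suc n) y  ∎

  ∑-scale : ∀ n a x → ∑ n (λ k → a * x k) ≈ a * ∑ n x
  ∑-scale zero a x    = sym (zeroʳ a)
  ∑-scale (suc n) a x = trans (+-congˡ (∑-scale n a (x ∘ suc))) (sym (distribˡ _ _ _))

  -- Coefficient n of a product of power series. The recursion shifts `x`, so inductions generalise
  -- over `x`; `conv-last` peels off the other end.
  conv : (ℕ → Carrier) → (ℕ → Carrier) → ℕ → Carrier
  conv x y zero    = x 0 * y 0
  conv x y (suc n) = x 0 * y (suc n) + conv (x ∘ suc) y n

  conv-cong : ∀ n {x x′ y y′} → (∀ k → x k ≈ x′ k) → (∀ k → y k ≈ y′ k) →
              conv x y n ≈ conv x′ y′ n
  conv-cong zero    x≈ y≈ = *-cong (x≈ 0) (y≈ 0)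
  conv-cong (suc n) x≈ y≈ = +-cong (*-cong (x≈ 0) (y≈ (suc n))) (conv-cong n (x≈ ∘ suc) y≈)

  conv-as-∑ : ∀ n x y → conv x y n ≈ ∑ (suc n) (λ k → x k * y (n ℕ.∸ k))
  conv-as-∑ zero x y    = sym (+-identityʳ _)
  conv-as-∑ (suc n) x y = +-congˡ (conv-as-∑ n (x ∘ suc) y)

  conv-last : ∀ n x y → conv x y (suc n) ≈ conv x (y ∘ suc) n + x (suc n) * y 0
  conv-last zero x y    = refl
  conv-last (suc n) x y = trans (+-congˡ (conv-last n (x ∘ suc) y)) (sym (+-assoc _ _ _))

  conv-linearˡ : ∀ n a x x′ y →
    conv (λ k → a * x k + x′ k) y n ≈ a * conv x y n + conv x′ y n
  conv-linearˡ zero a x x′ y =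
    solve 4 (λ a x x′ y → (a :* x :+ x′) :* y := a :* (x :* y) :+ x′ :* y) refl _ _ _ _
  conv-linearˡ (suc n) a x x′ y = begin
    (a * x 0 + x′ 0) * y (suc n) + conv (λ k → a * x (suc k) + x′ (suc k)) y n
      ≈⟨ +-congˡ (conv-linearˡ n a (x ∘ suc) (x′ ∘ suc) y) ⟩
    (a * x 0 + x′ 0) * y (suc n) + (a * conv (x ∘ suc) y n + conv (x′ ∘ suc) y n)
      ≈⟨ solve 6 (λ a x x′ y u v → (a :* x :+ x′) :* y :+ (a :* u :+ v)
           := a :* (x :* y :+ u) :+ (x′ :* y :+ v)) refl _ _ _ _ _ _ ⟩
    a * conv x y (suc n) + conv x′ y (suc n) ∎

  conv-comm : ∀ n x y → conv x y n ≈ conv y x n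
  conv-comm zero x y    = *-comm _ _
  conv-comm (suc n) x y = begin
    x 0 * y (suc n) + conv (x ∘ suc) y n  ≈⟨ +-cong (*-comm _ _) (conv-comm n (x ∘ suc) y) ⟩
    y (suc n) * x 0 + conv y (x ∘ suc) n  ≈⟨ +-comm _ _ ⟩
    conv y (x ∘ suc) n + y (suc n) * x 0  ≈⟨ conv-last n y x ⟨
    conv y x (suc n)  ∎

  conv-linearʳ : ∀ n a x y y′ →
    conv x (λ k → a * y k + y′ k) n ≈ a * conv x y n + conv x y′ n
  conv-linearʳ n a x y y′ = begin
    conv x (λ k → a * y k + y′ k) n  ≈⟨ conv-comm n x _ ⟩
    conv (λ k → a * y k + y′ k) x n  ≈⟨ conv-linearˡ n a y y′ x ⟩
    a * conv y x n + conv y′ x n  ≈⟨ +-cong (*-congˡ (conv-comm n y x)) (conv-comm n y′ x) ⟩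
    a * conv x y n + conv x y′ n  ∎

  conv-scaleˡ : ∀ n a x y → conv (λ k → a * x k) y n ≈ a * conv x y n
  conv-scaleˡ zero a x y    = *-assoc _ _ _
  conv-scaleˡ (suc n) a x y = trans (+-cong (*-assoc _ _ _) (conv-scaleˡ n a (x ∘ suc) y)) (sym (distribˡ _ _ _))

  conv-scaleʳ : ∀ n a x y → conv x (λ k → a * y k) n ≈ a * conv x y n
  conv-scaleʳ n a x y = trans (conv-comm n x _) (trans (conv-scaleˡ n a y x) (*-congˡ (conv-comm n y x)))

  -- The substitution of l X for X respects products of power series. It takes the powers of Λ out
  -- of the recurrence.
  conv-dilate : ∀ n l x y → conv (λ k → l ^ k * x k) (λ k → l ^ k * y k) n ≈ l ^ n * conv x y n
  conv-dilate zero l x y =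
    solve 2 (λ x y → (:1 :* x) :* (:1 :* y) := :1 :* (x :* y)) refl _ _
  conv-dilate (suc n) l x y = begin
    (1# * x 0) * (l ^ suc n * y (suc n)) + conv (λ k → (l * l ^ k) * x (suc k)) (λ k → l ^ k * y k) n
      ≈⟨ +-congˡ (trans (conv-cong n (λ k → *-assoc _ _ _) (λ _ → refl)) (conv-scaleˡ n l _ _)) ⟩
    (1# * x 0) * (l ^ suc n * y (suc n)) + l * conv (λ k → l ^ k * x (suc k)) (λ k → l ^ k * y k) n
      ≈⟨ +-congˡ (*-congˡ (conv-dilate n l (x ∘ suc) y)) ⟩
    (1# * x 0) * ((l * l ^ n) * y (suc n)) + l * (l ^ n * conv (x ∘ suc) y n)
      ≈⟨ solve 5 (λ x l p y u → (:1 :* x) :* ((l :* p) :* y) :+ l :* (p :* u) := (l :* p) :* (x :* y :+ u)) refl _ _ _ _ _ ⟩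
    l ^ suc n * conv x y (suc n) ∎

  ∑-conv : ∀ n x y → ∑ (suc n) (conv x y) ≈ x 0 * ∑ (suc n) y + ∑ n (conv (x ∘ suc) y)
  ∑-conv n x y = begin
    x 0 * y 0 + ∑ n (λ k → x 0 * y (suc k) + conv (x ∘ suc) y k)  ≈⟨ +-congˡ (∑-linear n (x 0) (y ∘ suc) (conv (x ∘ suc) y)) ⟩
    x 0 * y 0 + (x 0 * ∑ n (y ∘ suc) + ∑ n (conv (x ∘ suc) y))  ≈⟨ +-assoc _ _ _ ⟨
    x 0 * y 0 + x 0 * ∑ n (y ∘ suc) + ∑ n (conv (x ∘ suc) y)  ≈⟨ +-congʳ (distribˡ _ _ _) ⟨
    x 0 * ∑ (suc n) y + ∑ n (conv (x ∘ suc) y)  ∎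

  -- The operator X d/dX, which multiplies coefficient k by k, is a derivation.
  conv-euler : ∀ n x y →
    conv (λ k → ι k * x k) y n + conv x (λ k → ι k * y k) n ≈ ι n * conv x y n
  conv-euler zero x y =
    solve 2 (λ x y → (:0 :* x) :* y :+ x :* (:0 :* y) := :0 :* (x :* y)) refl _ _
  conv-euler (suc n) x y = begin
    (0# * x 0) * y (suc n) + conv (λ k → (1# + ι k) * x (suc k)) y n
      + (x 0 * (ι (suc n) * y (suc n)) + conv (x ∘ suc) (λ k → ι k * y k) n)
      ≈⟨ +-congʳ (+-congˡ (conv-cong n
           (λ k → solve 2 (λ i x → (:1 :+ i) :* x := :1 :* x :+ i :* x) refl (ι k) (x (suc k)))
           (λ _ → refl))) ⟩
    (0# * x 0) * y (suc n) + conv (λ k → 1# * x (suc k) + ι k * x (suc k)) y n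
      + (x 0 * (ι (suc n) * y (suc n)) + conv (x ∘ suc) (λ k → ι k * y k) n)
      ≈⟨ +-congʳ (+-congˡ (conv-linearˡ n 1# _ _ y)) ⟩
    (0# * x 0) * y (suc n) + (1# * conv (x ∘ suc) y n + conv (λ k → ι k * x (suc k)) y n)
      + (x 0 * (ι (suc n) * y (suc n)) + conv (x ∘ suc) (λ k → ι k * y k) n)
      ≈⟨ solve 6 (λ x y c p q i →
            (:0 :* x) :* y :+ (:1 :* c :+ p) :+ (x :* (i :* y) :+ q)
              := c :+ (p :+ q) :+ i :* (x :* y)) refl _ _ _ _ _ _ ⟩
    conv (x ∘ suc) y n + (conv (λ k → ι k * x (suc k)) y n + conv (x ∘ suc) (λ k → ι k * y k) n)
      + ι (suc n) * (x 0 * y (suc n))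
      ≈⟨ +-congʳ (+-congˡ (conv-euler n (x ∘ suc) y)) ⟩
    conv (x ∘ suc) y n + ι n * conv (x ∘ suc) y n + (1# + ι n) * (x 0 * y (suc n))
      ≈⟨ solve 3 (λ i c z → c :+ i :* c :+ (:1 :+ i) :* z := (:1 :+ i) :* (z :+ c)) refl _ _ _ ⟩
    ι (suc n) * conv x y (suc n) ∎

  module Binomial (inv : ℕ → Carrier) (inv-inverse : ∀ n → ι (suc n) * inv n ≈ 1#) where

    -- The coefficients of (1 - ε X)^(-w/ε), or of exp (w X) if ε = 0.
    P : Carrier → Carrier → ℕ → Carrier
    P ε w zero    = 1#
    P ε w (suc n) = P ε w n * ((w + ι n * ε) * inv n)

    P-cong : ∀ {ε ε′ w w′} → ε ≈ ε′ → w ≈ w′ → ∀ n → P ε w n ≈ P ε′ w′ n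
    P-cong ε≈ w≈ zero    = refl
    P-cong ε≈ w≈ (suc n) = *-cong (P-cong ε≈ w≈ n) (*-congʳ (+-cong w≈ (*-congˡ ε≈)))

    P-suc : ∀ ε w n → ι (suc n) * P ε w (suc n) ≈ (w + ι n * ε) * P ε w n
    P-suc ε w n = begin
      ι (suc n) * (P ε w n * ((w + ι n * ε) * inv n))
        ≈⟨ solve 4 (λ i p v r → i :* (p :* (v :* r)) := (i :* r) :* (v :* p)) refl _ _ _ _ ⟩
      (ι (suc n) * inv n) * ((w + ι n * ε) * P ε w n)  ≈⟨ *-congʳ (inv-inverse n) ⟩
      1# * ((w + ι n * ε) * P ε w n)  ≈⟨ *-identityˡ _ ⟩
      (w + ι n * ε) * P ε w n  ∎

    -- For ε = 0 the coefficients are w^n / n!. Exponential series and inverse factorials are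
    -- written as `P 0#` from here on.
    factorial-P : ∀ w n → ι (n !) * P 0# w n ≈ w ^ n
    factorial-P w zero    = trans (*-identityʳ _) (+-identityʳ 1#)
    factorial-P w (suc n) = begin
      ι (suc n ℕ.* n !) * P 0# w (suc n)  ≈⟨ *-congʳ (×1-homo-* (suc n) (n !)) ⟩
      (ι (suc n) * ι (n !)) * P 0# w (suc n)  ≈⟨ solve 3 (λ i j p → (i :* j) :* p := j :* (i :* p)) refl _ _ _ ⟩
      ι (n !) * (ι (suc n) * P 0# w (suc n))  ≈⟨ *-congˡ (P-suc 0# w n) ⟩
      ι (n !) * ((w + ι n * 0#) * P 0# w n)  ≈⟨ solve 4 (λ j w i p → j :* ((w :+ i :* :0) :* p) := w :* (j :* p)) refl _ _ (ι n) _ ⟩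
      w * (ι (n !) * P 0# w n)  ≈⟨ *-congˡ (factorial-P w n) ⟩
      w ^ suc n  ∎

    P-dilate : ∀ l ε w n → P (l * ε) (l * w) n ≈ l ^ n * P ε w n
    P-dilate l ε w zero    = sym (*-identityˡ 1#)
    P-dilate l ε w (suc n) = begin
      P (l * ε) (l * w) n * ((l * w + ι n * (l * ε)) * inv n)  ≈⟨ *-congʳ (P-dilate l ε w n) ⟩
      (l ^ n * P ε w n) * ((l * w + ι n * (l * ε)) * inv n)
        ≈⟨ solve 7 (λ l p q w i e r → (p :* q) :* ((l :* w :+ i :* (l :* e)) :* r)
             := (l :* p) :* (q :* ((w :+ i :* e) :* r))) refl l _ _ _ _ _ _ ⟩
      l ^ suc n * P ε w (suc n)  ∎

    -- The series F for w solves (1 - ε X) F' = w F. By the product rule, the product of the series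
    -- for w and v solves the equation for w + v; in coefficients this is the recursion `P-suc`, and
    -- division by n + 1 closes the induction.
    vandermonde : ∀ ε w v n → conv (P ε w) (P ε v) n ≈ P ε (w + v) n
    vandermonde ε w v zero    = *-identityˡ 1#
    vandermonde ε w v (suc n) = begin
      conv x y (suc n)  ≈⟨ *-identityˡ _ ⟨
      1# * conv x y (suc n)  ≈⟨ *-congʳ (inv-inverse n) ⟨
      (ι (suc n) * inv n) * conv x y (suc n)
        ≈⟨ solve 3 (λ i r d → (i :* r) :* d := (i :* d) :* r) refl _ _ _ ⟩
      (ι (suc n) * conv x y (suc n)) * inv n  ≈⟨ *-congʳ recurrence ⟩
      ((w + v + ι n * ε) * conv x y n) * inv n  ≈⟨ *-congʳ (*-congˡ (vandermonde ε w v n)) ⟩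
      ((w + v + ι n * ε) * P ε (w + v) n) * inv n
        ≈⟨ solve 3 (λ a p r → (a :* p) :* r := p :* (a :* r)) refl _ _ _ ⟩
      P ε (w + v) (suc n)  ∎
      where
      x y : ℕ → Carrier
      x = P ε w
      y = P ε v

      shift : ∀ w k → ι (suc k) * P ε w (suc k) ≈ w * P ε w k + ε * (ι k * P ε w k)
      shift w k = trans (P-suc ε w k)
        (solve 4 (λ w i e p → (w :+ i :* e) :* p := w :* p :+ e :* (i :* p)) refl _ _ _ _)

      recurrence : ι (suc n) * conv x y (suc n) ≈ (w + v + ι n * ε) * conv x y n
      recurrence = begin
        ι (suc n) * conv x y (suc n)  ≈⟨ conv-euler (suc n) x y ⟨
        conv (λ k → ι k * x k) y (suc n) + conv x (λ k → ι k * y k) (suc n)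
          ≈⟨ +-congˡ (conv-last n x _) ⟩
        (0# * x 0) * y (suc n) + conv (λ k → ι (suc k) * x (suc k)) y n
          + (conv x (λ k → ι (suc k) * y (suc k)) n + x (suc n) * (0# * y 0))
          ≈⟨ +-cong (+-congˡ (conv-cong n (shift w) (λ _ → refl)))
                    (+-congʳ (conv-cong n (λ _ → refl) (shift v))) ⟩
        (0# * x 0) * y (suc n) + conv (λ k → w * x k + ε * (ι k * x k)) y n
          + (conv x (λ k → v * y k + ε * (ι k * y k)) n + x (suc n) * (0# * y 0))
          ≈⟨ +-cong (+-congˡ (trans (conv-linearˡ n w x _ y) (+-congˡ (conv-scaleˡ n ε _ y))))
                    (+-congʳ (trans (conv-linearʳ n v x y _) (+-congˡ (conv-scaleʳ n ε x _)))) ⟩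
        (0# * x 0) * y (suc n) + (w * conv x y n + ε * conv (λ k → ι k * x k) y n)
          + (v * conv x y n + ε * conv x (λ k → ι k * y k) n + x (suc n) * (0# * y 0))
          ≈⟨ solve 10 (λ a b c d w v e u p q →
                (:0 :* a) :* b :+ (w :* u :+ e :* p) :+ (v :* u :+ e :* q :+ c :* (:0 :* d))
                  := (w :+ v) :* u :+ e :* (p :+ q)) refl _ _ _ _ _ _ _ _ _ _ ⟩
        (w + v) * conv x y n + ε * (conv (λ k → ι k * x k) y n + conv x (λ k → ι k * y k) n)
          ≈⟨ +-congˡ (*-congˡ (conv-euler n x y)) ⟩
        (w + v) * conv x y n + ε * (ι n * conv x y n)
          ≈⟨ solve 5 (λ w v e u i → (w :+ v) :* u :+ e :* (i :* u) := (w :+ v :+ i :* e) :* u) refl _ _ _ _ _ ⟩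
        (w + v + ι n * ε) * conv x y n  ∎

-- Real partial sums, and the bound of the binomial series by an exponential.

module RealSeries {c ℓ₁ ℓ₂} (ℛ : CompleteOrderedField c ℓ₁ ℓ₂) where

  open OrderedField ℛ public
  open FormalSeries commutativeRing public

  ι-nonneg : ∀ n → 0# ≤ ι n
  ι-nonneg zero    = ≤-refl
  ι-nonneg (suc n) = +-nonneg 0≤1 (ι-nonneg n)

  ι-mono : ∀ {m n} → m ℕ.≤ n → ι m ≤ ι n
  ι-mono {n = n} ℕ.z≤n = ι-nonneg n
  ι-mono (ℕ.s≤s m≤n)   = +-monoʳ-≤ 1# (ι-mono m≤n)

  0<ι-suc : ∀ n → 0# < ι (suc n)
  0<ι-suc = 0<fromℕ-suc

  inv : ℕ → Carrier
  inv n = 1/ (suc n)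

  inv-inverse : ∀ n → ι (suc n) * inv n ≈ 1#
  inv-inverse n = reciprocal-inverse (ι (suc n)) (0<ι-suc n)

  0<inv : ∀ n → 0# < inv n
  0<inv n = 0<reciprocal (ι (suc n)) (0<ι-suc n)

  inv≤1 : ∀ n → inv n ≤ 1#
  inv≤1 n = begin
    inv n  ≈⟨ *-identityˡ _ ⟨
    1# * inv n  ≤⟨ *-monoˡ-≤ (<⇒≤ (0<inv n)) (x≤x+y (ι-nonneg n)) ⟩
    ι (suc n) * inv n  ≈⟨ inv-inverse n ⟩
    1#  ∎

  open Binomial inv inv-inverse public

  -- If y < x, some N exceeds c / (x - y), and the hypothesis at N is violated.
  ≤-limit : ∀ {x y} c → (∀ n → x ≤ y + c * inv n) → x ≤ y
  ≤-limit {x} {y} c x≤ y<x = x≤ N $ begin-strict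
    y + c * inv N  <⟨ +-monoʳ-< y (<-respˡ-≈ (*-comm _ _) (*-monoʳ-< (0<inv N) c<)) ⟩
    y + inv N * (d * ι (suc N))  ≈⟨ +-congˡ (solve 3 (λ r d i → r :* (d :* i) := (i :* r) :* d) refl _ _ _) ⟩
    y + (ι (suc N) * inv N) * d  ≈⟨ +-congˡ (trans (*-congʳ (inv-inverse N)) (*-identityˡ d)) ⟩
    y + d  ≈⟨ solve 2 (λ x y → y :+ (x :- y) := x) refl x y ⟩
    x  ∎
    where
    d = x - y
    0<d = x<y⇒0<y-x y<x
    N = proj₁ (archimedean (c * reciprocal d 0<d))
    c< : c < d * ι (suc N)
    c< = begin-strict
      c  ≈⟨ *-identityʳ c ⟨
      c * 1#  ≈⟨ *-congˡ (reciprocal-inverse d 0<d) ⟨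
      c * (d * reciprocal d 0<d)  ≈⟨ solve 3 (λ c d r → c :* (d :* r) := d :* (c :* r)) refl _ _ _ ⟩
      d * (c * reciprocal d 0<d)  <⟨ *-monoʳ-< 0<d (proj₂ (archimedean (c * reciprocal d 0<d))) ⟩
      d * ι N  ≤⟨ *-monoʳ-≤ (<⇒≤ 0<d) (ι-mono (ℕ.n≤1+n N)) ⟩
      d * ι (suc N)  ∎

  ^-nonneg : ∀ {x} → 0# ≤ x → ∀ n → 0# ≤ x ^ n
  ^-nonneg 0≤x zero    = 0≤1
  ^-nonneg 0≤x (suc n) = *-nonneg 0≤x (^-nonneg 0≤x n)

  ^-pos : ∀ {x} → 0# < x → ∀ n → 0# < x ^ n
  ^-pos 0<x zero    = 0<1
  ^-pos 0<x (suc n) = *-pos 0<x (^-pos 0<x n)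

  ^-mono-≤ : ∀ {x y} → 0# ≤ x → x ≤ y → ∀ n → x ^ n ≤ y ^ n
  ^-mono-≤ 0≤x x≤y zero    = ≤-refl
  ^-mono-≤ 0≤x x≤y (suc n) = *-mono-≤ (≤-trans 0≤x x≤y) (^-nonneg 0≤x n) x≤y (^-mono-≤ 0≤x x≤y n)

  ^-mono-< : ∀ {x y} → 0# ≤ x → x < y → ∀ n → x ^ suc n < y ^ suc n
  ^-mono-< {x} {y} 0≤x x<y n = ≤-<-trans
    (*-monoʳ-≤ 0≤x (^-mono-≤ 0≤x (<⇒≤ x<y) n))
    (<-respˡ-≈ (*-comm _ _) (<-respʳ-≈ (*-comm _ _) (*-monoʳ-< (^-pos (≤-<-trans 0≤x x<y) n) x<y)))

  ^-cancel-≤ : ∀ {x y} n → 0# ≤ y → x ^ suc n ≤ y ^ suc n → x ≤ y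
  ^-cancel-≤ n 0≤y le y<x = le (^-mono-< 0≤y y<x n)

  1≤^ : ∀ {x} → 1# ≤ x → ∀ n → 1# ≤ x ^ n
  1≤^ 1≤x zero    = ≤-refl
  1≤^ {x} 1≤x (suc n) = ≤-trans (≤-reflexive (sym (*-identityˡ 1#)))
    (*-mono-≤ (≤-trans 0≤1 1≤x) 0≤1 1≤x (1≤^ 1≤x n))

  ^≤1 : ∀ {x} → 0# ≤ x → x ≤ 1# → ∀ n → x ^ n ≤ 1#
  ^≤1 0≤x x≤1 zero    = ≤-refl
  ^≤1 0≤x x≤1 (suc n) = ≤-trans (*-mono-≤ 0≤1 (^-nonneg 0≤x n) x≤1 (^≤1 0≤x x≤1 n)) (≤-reflexive (*-identityˡ 1#))

  1^n≈1 : ∀ n → 1# ^ n ≈ 1#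
  1^n≈1 zero    = refl
  1^n≈1 (suc n) = trans (*-identityˡ _) (1^n≈1 n)

  bernoulli : ∀ {h} → 0# ≤ h → ∀ n → 1# + ι n * h ≤ (1# + h) ^ n
  bernoulli {h} 0≤h zero = ≤-reflexive (solve 1 (λ h → :1 :+ :0 :* h := :1) refl h)
  bernoulli {h} 0≤h (suc n) = begin
    1# + (1# + ι n) * h  ≤⟨ x≤x+y (*-nonneg (ι-nonneg n) (*-nonneg 0≤h 0≤h)) ⟩
    1# + (1# + ι n) * h + ι n * (h * h)  ≈⟨ solve 2 (λ i h → :1 :+ (:1 :+ i) :* h :+ i :* (h :* h) := (:1 :+ h) :* (:1 :+ i :* h)) refl _ _ ⟩
    (1# + h) * (1# + ι n * h)  ≤⟨ *-monoʳ-≤ (+-nonneg 0≤1 0≤h) (bernoulli 0≤h n) ⟩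
    (1# + h) ^ suc n  ∎

  ∑-mono : ∀ n {x y} → (∀ k → x k ≤ y k) → ∑ n x ≤ ∑ n y
  ∑-mono zero    x≤y = ≤-refl
  ∑-mono (suc n) x≤y = +-mono-≤ (x≤y 0) (∑-mono n (x≤y ∘ suc))

  ∑-nonneg : ∀ n {x} → (∀ k → 0# ≤ x k) → 0# ≤ ∑ n x
  ∑-nonneg zero    0≤x = ≤-refl
  ∑-nonneg (suc n) 0≤x = +-nonneg (0≤x 0) (∑-nonneg n (0≤x ∘ suc))

  ∑-mono-length : ∀ {m n x} → (∀ k → 0# ≤ x k) → m ℕ.≤ n → ∑ m x ≤ ∑ n x
  ∑-mono-length {n = n} 0≤x ℕ.z≤n = ∑-nonneg n 0≤x
  ∑-mono-length 0≤x (ℕ.s≤s m≤n)   = +-monoʳ-≤ _ (∑-mono-length (0≤x ∘ suc) m≤n)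

  conv-nonneg : ∀ n {x y} → (∀ k → 0# ≤ x k) → (∀ k → 0# ≤ y k) → 0# ≤ conv x y n
  conv-nonneg zero    0≤x 0≤y = *-nonneg (0≤x 0) (0≤y 0)
  conv-nonneg (suc n) 0≤x 0≤y = +-nonneg (*-nonneg (0≤x 0) (0≤y (suc n))) (conv-nonneg n (0≤x ∘ suc) 0≤y)

  conv-monoˡ : ∀ n {x x′ y} → (∀ k → x k ≤ x′ k) → (∀ k → 0# ≤ y k) → conv x y n ≤ conv x′ y n
  conv-monoˡ zero    x≤ 0≤y = *-monoˡ-≤ (0≤y 0) (x≤ 0)
  conv-monoˡ (suc n) x≤ 0≤y = +-mono-≤ (*-monoˡ-≤ (0≤y (suc n)) (x≤ 0)) (conv-monoˡ n (x≤ ∘ suc) 0≤y)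

  conv-monoʳ : ∀ n {x y y′} → (∀ k → 0# ≤ x k) → (∀ k → y k ≤ y′ k) → conv x y n ≤ conv x y′ n
  conv-monoʳ n {x} {y} {y′} 0≤x y≤ = begin
    conv x y n  ≈⟨ conv-comm n x y ⟩
    conv y x n  ≤⟨ conv-monoˡ n y≤ 0≤x ⟩
    conv y′ x n  ≈⟨ conv-comm n y′ x ⟩
    conv x y′ n  ∎

  -- The triangle of index pairs i + j < n lies in the rectangle i < n, j < N.
  ∑-conv-≤ : ∀ {n N x y} → (∀ k → 0# ≤ x k) → (∀ k → 0# ≤ y k) → n ℕ.≤ N →
             ∑ n (conv x y) ≤ ∑ n x * ∑ N y
  ∑-conv-≤ {zero} {N} {x} {y} 0≤x 0≤y n≤N = ≤-reflexive (sym (zeroˡ _))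
  ∑-conv-≤ {suc n} {N} {x} {y} 0≤x 0≤y n≤N = begin
    ∑ (suc n) (conv x y)  ≈⟨ ∑-conv n x y ⟩
    x 0 * ∑ (suc n) y + ∑ n (conv (x ∘ suc) y)
      ≤⟨ +-mono-≤ (*-monoʳ-≤ (0≤x 0) (∑-mono-length 0≤y n≤N)) (∑-conv-≤ (0≤x ∘ suc) 0≤y (ℕ.<⇒≤ n≤N)) ⟩
    x 0 * ∑ N y + ∑ n (x ∘ suc) * ∑ N y  ≈⟨ distribʳ _ _ _ ⟨
    ∑ (suc n) x * ∑ N y  ∎

  -- The rectangle i < n, j < m lies in the triangle i + j < n + m.
  ∑-conv-≥ : ∀ n m {x y} → (∀ k → 0# ≤ x k) → (∀ k → 0# ≤ y k) →
             ∑ n x * ∑ m y ≤ ∑ (n ℕ.+ m) (conv x y)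
  ∑-conv-≥ zero m {x} {y} 0≤x 0≤y = ≤-trans (≤-reflexive (zeroˡ _)) (∑-nonneg m (λ k → conv-nonneg k 0≤x 0≤y))
  ∑-conv-≥ (suc n) m {x} {y} 0≤x 0≤y = begin
    ∑ (suc n) x * ∑ m y  ≈⟨ distribʳ _ _ _ ⟩
    x 0 * ∑ m y + ∑ n (x ∘ suc) * ∑ m y
      ≤⟨ +-mono-≤ (*-monoʳ-≤ (0≤x 0) (∑-mono-length 0≤y (ℕ.m≤n+m m (suc n)))) (∑-conv-≥ n m (0≤x ∘ suc) 0≤y) ⟩
    x 0 * ∑ (suc n ℕ.+ m) y + ∑ (n ℕ.+ m) (conv (x ∘ suc) y)  ≈⟨ ∑-conv (n ℕ.+ m) x y ⟨
    ∑ (suc n ℕ.+ m) (conv x y)  ∎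

  P-nonneg : ∀ {ε w} → 0# ≤ ε → 0# ≤ w → ∀ n → 0# ≤ P ε w n
  P-nonneg 0≤ε 0≤w zero    = 0≤1
  P-nonneg 0≤ε 0≤w (suc n) = *-nonneg (P-nonneg 0≤ε 0≤w n)
    (*-nonneg (+-nonneg 0≤w (*-nonneg (ι-nonneg n) 0≤ε)) (<⇒≤ (0<inv n)))

  P-mono : ∀ {ε w w′} → 0# ≤ ε → 0# ≤ w → w ≤ w′ → ∀ n → P ε w n ≤ P ε w′ n
  P-mono 0≤ε 0≤w w≤w′ zero    = ≤-refl
  P-mono 0≤ε 0≤w w≤w′ (suc n) = *-mono-≤
    (P-nonneg 0≤ε (≤-trans 0≤w w≤w′) n)
    (*-nonneg (+-nonneg 0≤w (*-nonneg (ι-nonneg n) 0≤ε)) (<⇒≤ (0<inv n)))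
    (P-mono 0≤ε 0≤w w≤w′ n)
    (*-monoˡ-≤ (<⇒≤ (0<inv n)) (+-monoˡ-≤ _ w≤w′))

  -- Partial sums of the binomial series of (1 - θ)^(-y).
  T : Carrier → Carrier → ℕ → Carrier
  T θ y n = ∑ n (P θ (θ * y))

  T-cong : ∀ θ {y y′} → y ≈ y′ → ∀ n → T θ y n ≈ T θ y′ n
  T-cong θ y≈y′ n = ∑-cong n (P-cong refl (*-congˡ y≈y′))

  T-mono : ∀ {θ y y′} → 0# ≤ θ → 0# ≤ y → y ≤ y′ → ∀ n → T θ y n ≤ T θ y′ n
  T-mono 0≤θ 0≤y y≤y′ n = ∑-mono n (P-mono 0≤θ (*-nonneg 0≤θ 0≤y) (*-monoʳ-≤ 0≤θ y≤y′))

  T-+ : ∀ θ y z n → ∑ n (conv (P θ (θ * y)) (P θ (θ * z))) ≈ T θ (y + z) n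
  T-+ θ y z n = ∑-cong n (λ k → trans (vandermonde θ _ _ k) (P-cong refl (sym (distribˡ θ y z)) k))

  T-+-≤ : ∀ {θ y z} → 0# ≤ θ → 0# ≤ y → 0# ≤ z → ∀ n → T θ (y + z) n ≤ T θ y n * T θ z n
  T-+-≤ {θ} {y} {z} 0≤θ 0≤y 0≤z n = ≤-trans (≤-reflexive (sym (T-+ θ y z n)))
    (∑-conv-≤ {n} (P-nonneg 0≤θ (*-nonneg 0≤θ 0≤y)) (P-nonneg 0≤θ (*-nonneg 0≤θ 0≤z)) ℕ.≤-refl)

  T-+-≥ : ∀ {θ y z} → 0# ≤ θ → 0# ≤ y → 0# ≤ z → ∀ n m → T θ y n * T θ z m ≤ T θ (y + z) (n ℕ.+ m)
  T-+-≥ {θ} {y} {z} 0≤θ 0≤y 0≤z n m = ≤-trans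
    (∑-conv-≥ n m (P-nonneg 0≤θ (*-nonneg 0≤θ 0≤y)) (P-nonneg 0≤θ (*-nonneg 0≤θ 0≤z)))
    (≤-reflexive (T-+ θ y z (n ℕ.+ m)))

  -- At exponent 1 the binomial series is the geometric series.
  P-one : ∀ θ n → P θ (θ * 1#) n ≈ θ ^ n
  P-one θ zero    = refl
  P-one θ (suc n) = begin-equality
    P θ (θ * 1#) n * ((θ * 1# + ι n * θ) * inv n)  ≈⟨ *-congʳ (P-one θ n) ⟩
    θ ^ n * ((θ * 1# + ι n * θ) * inv n)
      ≈⟨ solve 4 (λ t p i r → p :* ((t :* :1 :+ i :* t) :* r) := (((:1 :+ i) :* r) :* t) :* p) refl _ _ _ _ ⟩
    ((ι (suc n) * inv n) * θ) * θ ^ n  ≈⟨ *-congʳ (trans (*-congʳ (inv-inverse n)) (*-identityˡ θ)) ⟩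
    θ ^ suc n  ∎

  -- `τ` is 1 / (1 - θ), specified by an equation so that any expression for it can be supplied.
  geometric : ∀ {θ τ} → 0# ≤ θ → 0# < τ → (1# - θ) * τ ≈ 1# → ∀ n → ∑ n (θ ^_) ≤ τ
  geometric {θ} {τ} 0≤θ 0<τ eq n = begin
    ∑ n (θ ^_)  ≈⟨ trans (*-congʳ eq) (*-identityˡ _) ⟨
    ((1# - θ) * τ) * ∑ n (θ ^_)  ≈⟨ solve 3 (λ t u s → ((:1 :- t) :* u) :* s := u :* ((:1 :- t) :* s)) refl _ _ _ ⟩
    τ * ((1# - θ) * ∑ n (θ ^_))  ≈⟨ *-congˡ (telescope n) ⟩
    τ * (1# - θ ^ n)  ≤⟨ *-monoʳ-≤ (<⇒≤ 0<τ) (+-monoʳ-≤ 1# (neg-mono-≤ (^-nonneg 0≤θ n))) ⟩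
    τ * (1# - 0#)  ≈⟨ solve 1 (λ t → t :* (:1 :- :0) := t) refl τ ⟩
    τ  ∎
    where
    telescope : ∀ n → (1# - θ) * ∑ n (θ ^_) ≈ 1# - θ ^ n
    telescope zero    = solve 1 (λ t → (:1 :- t) :* :0 := :1 :- :1) refl θ
    telescope (suc n) = begin-equality
      (1# - θ) * ∑ (suc n) (θ ^_)  ≈⟨ *-congˡ (∑-last n (θ ^_)) ⟩
      (1# - θ) * (∑ n (θ ^_) + θ ^ n)  ≈⟨ distribˡ _ _ _ ⟩
      (1# - θ) * ∑ n (θ ^_) + (1# - θ) * θ ^ n ≈⟨ +-congʳ (telescope n) ⟩
      1# - θ ^ n + (1# - θ) * θ ^ n  ≈⟨ solve 2 (λ t p → :1 :- p :+ (:1 :- t) :* p := :1 :- t :* p) refl _ _ ⟩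
      1# - θ ^ suc n  ∎

  -- At exponent 1 the partial sums are geometric sums, at most τ; submultiplicativity `T-+-≤` turns
  -- this into the l-th power.
  T-ℕ : ∀ {θ τ} → 0# ≤ θ → 0# < τ → (1# - θ) * τ ≈ 1# → ∀ l n → T θ (ι l) n ≤ τ ^ l
  T-ℕ {θ} 0≤θ 0<τ eq zero n = begin
    ∑ n (P θ (θ * 0#))  ≤⟨ ∑≤1 n ⟩
    1#  ∎
    where
    P-zero : ∀ k → P θ (θ * 0#) (suc k) ≈ 0#
    P-zero zero    = solve 2 (λ t r → :1 :* ((t :* :0 :+ :0 :* t) :* r) := :0) refl _ _
    P-zero (suc k) = trans (*-congʳ (P-zero k)) (zeroˡ _)
    ∑-zero : ∀ n → ∑ n (λ _ → 0#) ≈ 0#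
    ∑-zero zero    = refl
    ∑-zero (suc n) = trans (+-identityˡ _) (∑-zero n)
    ∑≤1 : ∀ n → ∑ n (P θ (θ * 0#)) ≤ 1#
    ∑≤1 zero    = 0≤1
    ∑≤1 (suc n) = ≤-reflexive (trans (+-congˡ (trans (∑-cong n P-zero) (∑-zero n))) (+-identityʳ 1#))
  T-ℕ {θ} {τ} 0≤θ 0<τ eq (suc l) n = begin
    T θ (1# + ι l) n  ≤⟨ T-+-≤ 0≤θ 0≤1 (ι-nonneg l) n ⟩
    T θ 1# n * T θ (ι l) n
      ≤⟨ *-mono-≤ (<⇒≤ 0<τ) (∑-nonneg n (P-nonneg 0≤θ (*-nonneg 0≤θ (ι-nonneg l))))
           (≤-trans (≤-reflexive (∑-cong n (P-one θ))) (geometric 0≤θ 0<τ eq n))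
           (T-ℕ 0≤θ 0<τ eq l n) ⟩
    τ ^ suc l  ∎

  -- Iterated supermultiplicativity, with the lengths adding up to k n. The extra 1 serves k = 0,
  -- where the empty product 1 has to be matched by the constant coefficient.
  T-^-≤ : ∀ {θ y} → 0# ≤ θ → 0# ≤ y → ∀ n k → T θ y n ^ k ≤ T θ (ι k * y) (1 ℕ.+ k ℕ.* n)
  T-^-≤ {θ} {y} 0≤θ 0≤y n zero    = x≤x+y ≤-refl
  T-^-≤ {θ} {y} 0≤θ 0≤y n (suc k) = begin
    T θ y n * T θ y n ^ k  ≤⟨ *-monoʳ-≤ (∑-nonneg n (P-nonneg 0≤θ (*-nonneg 0≤θ 0≤y))) (T-^-≤ 0≤θ 0≤y n k) ⟩
    T θ y n * T θ (ι k * y) (1 ℕ.+ k ℕ.* n)  ≤⟨ T-+-≥ 0≤θ 0≤y (*-nonneg (ι-nonneg k) 0≤y) n (1 ℕ.+ k ℕ.* n) ⟩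
    T θ (y + ι k * y) (n ℕ.+ (1 ℕ.+ k ℕ.* n))  ≈⟨ T-cong θ (solve 2 (λ y i → y :+ i :* y := (:1 :+ i) :* y) refl y (ι k)) (n ℕ.+ (1 ℕ.+ k ℕ.* n)) ⟩
    T θ (ι (suc k) * y) (n ℕ.+ (1 ℕ.+ k ℕ.* n))  ≡⟨ ≡.cong (T θ (ι (suc k) * y)) (ℕ.+-suc n (k ℕ.* n)) ⟩
    T θ (ι (suc k) * y) (1 ℕ.+ suc k ℕ.* n)  ∎

  -- The exact ceiling is not computable. Each downward step compares z with two consecutive
  -- integers by cotransitivity, and the overlap costs a second unit.
  approximate-ceiling : ∀ z → 0# ≤ z → ∃[ l ] z ≤ ι l × ι l ≤ z + 2#
  approximate-ceiling z 0≤z = search (proj₁ (archimedean z)) (proj₂ (archimedean z))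
    where
    search : ∀ n → z < ι n → ∃[ l ] z ≤ ι l × ι l ≤ z + 2#
    search zero    z<0 = ⊥-elim (0≤z z<0)
    search (suc zero) z<1 = 1 , <⇒≤ z<1 ,
      ≤-trans (≤-reflexive (+-identityʳ 1#)) (≤-trans (x≤x+y 0≤1) (x≤y+x 0≤z))
    search (suc (suc n)) z<n = [ found , (λ z<n′ → search (suc n) (<-respʳ-≈ (+-comm _ _) z<n′)) ]′
      (<-cotrans z (+-monoʳ-< (ι n) 0<1))
      where
      found : ι n + 0# < z → _
      found n<z = suc (suc n) , <⇒≤ z<n , (begin
        1# + (1# + ι n)  ≈⟨ solve 1 (λ i → :1 :+ (:1 :+ i) := (i :+ :0) :+ (:1 :+ :1)) refl _ ⟩
        (ι n + 0#) + 2#  ≤⟨ +-monoˡ-≤ 2# (<⇒≤ n<z) ⟩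
        z + 2#  ∎)

  -- φ stands for the function (1 - q)^(-x) of x. No series is summed at a real exponent:
  -- multiplicativity and monotonicity carry the bound from natural to rational and then to real
  -- exponents.
  module BinomialBound
    (φ : Carrier → Carrier)
    (φ-cong : ∀ {x y} → x ≈ y → φ x ≈ φ y)
    (φ-+ : ∀ x y → φ (x + y) ≈ φ x * φ y)
    (φ-mono : ∀ {x y} → x ≤ y → φ x ≤ φ y)
    (φ-0 : φ 0# ≈ 1#)
    (q : Carrier) (0≤q : 0# ≤ q)
    (eq : (1# - q) * φ 1# ≈ 1#)
    where

    φ-nonneg : ∀ {x} → 0# ≤ x → 0# ≤ φ x
    φ-nonneg 0≤x = ≤-trans 0≤1 (≤-trans (≤-reflexive (sym φ-0)) (φ-mono 0≤x))

    φ-^ : ∀ x n → φ (ι n * x) ≈ φ x ^ n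
    φ-^ x zero    = trans (φ-cong (zeroˡ x)) φ-0
    φ-^ x (suc n) = begin-equality
      φ ((1# + ι n) * x)  ≈⟨ φ-cong (solve 2 (λ i x → (:1 :+ i) :* x := x :+ i :* x) refl _ _) ⟩
      φ (x + ι n * x)  ≈⟨ φ-+ x _ ⟩
      φ x * φ (ι n * x)  ≈⟨ *-congˡ (φ-^ x n) ⟩
      φ x ^ suc n  ∎

    private
      β = φ 1#
      1≤β : 1# ≤ β
      1≤β = ≤-trans (≤-reflexive (sym φ-0)) (φ-mono 0≤1)
      0≤β = ≤-trans 0≤1 1≤β

    -- The powers of order k + 1 are compared: `T-^-≤` raises the exponent l / (k + 1) to l, where
    -- `T-ℕ` applies.
    T≤φ-rational : ∀ l k n → T q (ι l * inv k) n ≤ φ (ι l * inv k)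
    T≤φ-rational l k n = ^-cancel-≤ k (φ-nonneg 0≤h) $ begin
      T q h n ^ suc k  ≤⟨ T-^-≤ 0≤q 0≤h n (suc k) ⟩
      T q (ι (suc k) * h) (1 ℕ.+ suc k ℕ.* n)  ≈⟨ T-cong q clear (1 ℕ.+ suc k ℕ.* n) ⟩
      T q (ι l) (1 ℕ.+ suc k ℕ.* n)  ≤⟨ T-ℕ {q} 0≤q (<-≤-trans 0<1 1≤β) eq l (1 ℕ.+ suc k ℕ.* n) ⟩
      β ^ l  ≈⟨ φ-^ 1# l ⟨
      φ (ι l * 1#)  ≈⟨ φ-cong (trans (*-identityʳ _) (sym clear)) ⟩
      φ (ι (suc k) * h)  ≈⟨ φ-^ h (suc k) ⟩
      φ h ^ suc k  ∎
      where
      h = ι l * inv k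
      0≤h = *-nonneg (ι-nonneg l) (<⇒≤ (0<inv k))
      clear : ι (suc k) * h ≈ ι l
      clear = trans (solve 3 (λ i l r → i :* (l :* r) := l :* (i :* r)) refl _ _ _)
        (trans (*-congˡ (inv-inverse k)) (*-identityʳ _))

    -- With d = φ (inv k) - 1, Bernoulli's inequality gives (k + 1) d ≤ (1 + d)^(k + 1) = β.
    φ-inv : ∀ k → φ (inv k) ≤ 1# + β * inv k
    φ-inv k = begin
      φ (inv k)  ≈⟨ solve 1 (λ p → p := :1 :+ (p :- :1) :* :1) refl _ ⟩
      1# + d * 1#  ≈⟨ +-congˡ (*-congˡ (inv-inverse k)) ⟨
      1# + d * (ι (suc k) * inv k)  ≈⟨ solve 3 (λ d i r → :1 :+ d :* (i :* r) := :1 :+ (i :* d) :* r) refl _ _ _ ⟩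
      1# + (ι (suc k) * d) * inv k  ≤⟨ +-monoʳ-≤ 1# (*-monoˡ-≤ (<⇒≤ (0<inv k)) (≤-trans (x≤y+x 0≤1) (bernoulli 0≤d (suc k)))) ⟩
      1# + (1# + d) ^ suc k * inv k  ≈⟨ +-congˡ (*-congʳ root) ⟩
      1# + β * inv k  ∎
      where
      d = φ (inv k) - 1#
      0≤d : 0# ≤ d
      0≤d = x≤y⇒0≤y-x (≤-trans (≤-reflexive (sym φ-0)) (φ-mono (<⇒≤ (0<inv k))))
      root : (1# + d) ^ suc k ≈ β
      root = begin-equality
        (1# + d) ^ suc k  ≈⟨ ^-congˡ (suc k) (solve 1 (λ p → :1 :+ (p :- :1) := p) refl _) ⟩
        φ (inv k) ^ suc k  ≈⟨ φ-^ (inv k) (suc k) ⟨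
        φ (ι (suc k) * inv k)  ≈⟨ φ-cong (inv-inverse k) ⟩
        β  ∎

    -- y is rounded up to a fraction with denominator k + 1. The excess is at most 2 / (k + 1), and
    -- by `φ-inv` its effect vanishes as k grows.
    T≤φ : ∀ y → 0# ≤ y → ∀ n → T q y n ≤ φ y
    T≤φ y 0≤y n = ≤-limit (φ y * (2# * β + β * β)) bound
      where
      bound : ∀ k → T q y n ≤ φ y + φ y * (2# * β + β * β) * inv k
      bound k with approximate-ceiling (ι (suc k) * y) (*-nonneg (ι-nonneg (suc k)) 0≤y)
      ... | l , ky≤l , l≤ky+2 = begin
        T q y n  ≤⟨ T-mono 0≤q 0≤y y≤h n ⟩
        T q (ι l * inv k) n  ≤⟨ T≤φ-rational l k n ⟩
        φ (ι l * inv k)  ≤⟨ φ-mono h≤ ⟩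
        φ (y + (inv k + inv k))  ≈⟨ trans (φ-+ _ _) (*-congˡ (φ-+ _ _)) ⟩
        φ y * (φ (inv k) * φ (inv k))  ≤⟨ *-monoʳ-≤ (φ-nonneg 0≤y) (square-mono-≤ (φ-nonneg (<⇒≤ (0<inv k))) (φ-inv k)) ⟩
        φ y * ((1# + β * inv k) * (1# + β * inv k))
          ≈⟨ solve 3 (λ p b r → p :* ((:1 :+ b :* r) :* (:1 :+ b :* r)) := p :+ p :* ((:1 :+ :1) :* b :+ (b :* b) :* r) :* r) refl _ _ _ ⟩
        φ y + φ y * (2# * β + (β * β) * inv k) * inv k
          ≤⟨ +-monoʳ-≤ _ (*-monoˡ-≤ (<⇒≤ (0<inv k)) (*-monoʳ-≤ (φ-nonneg 0≤y) (+-monoʳ-≤ _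
               (≤-trans (*-monoʳ-≤ (*-nonneg 0≤β 0≤β) (inv≤1 k)) (≤-reflexive (*-identityʳ _)))))) ⟩
        φ y + φ y * (2# * β + β * β) * inv k ∎
        where
        clear : (ι (suc k) * y) * inv k ≈ y
        clear = trans (solve 3 (λ i y r → (i :* y) :* r := (i :* r) :* y) refl _ _ _)
          (trans (*-congʳ (inv-inverse k)) (*-identityˡ y))
        y≤h : y ≤ ι l * inv k
        y≤h = ≤-trans (≤-reflexive (sym clear)) (*-monoˡ-≤ (<⇒≤ (0<inv k)) ky≤l)
        h≤ : ι l * inv k ≤ y + (inv k + inv k)
        h≤ = begin
          ι l * inv k  ≤⟨ *-monoˡ-≤ (<⇒≤ (0<inv k)) l≤ky+2 ⟩
          (ι (suc k) * y + 2#) * inv k  ≈⟨ solve 2 (λ y r → (y :+ (:1 :+ :1)) :* r := y :* r :+ (r :+ r)) refl _ _ ⟩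
          (ι (suc k) * y) * inv k + (inv k + inv k) ≈⟨ +-congʳ clear ⟩
          y + (inv k + inv k)  ∎

-- The complex field and bounds on moduli without square roots.

module ComplexPlane {c ℓ₁ ℓ₂} (ℛ : CompleteOrderedField c ℓ₁ ℓ₂) where

  open RealSeries ℛ public
  open Analysis ℛ public
    using (ℂ; _+i_; re; im; ℂ-rawRing; real; normSq; ∣_∣≤_; ∣_∣<_; _⟶_; IsExp; Nonzero; inverse; Entire; HasDerivative; IsCompact)

  ℂ-commutativeRing : CommutativeRing c ℓ₁
  ℂ-commutativeRing = record
    { Carrier = ℂ
    ; _≈_ = Z._≈_
    ; _+_ = Z._+_
    ; _*_ = Z._*_
    ; -_ = Z.-_
    ; 0# = Z.0#
    ; 1# = Z.1#
    ; isCommutativeRing = record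
      { isRing = record
        { +-isAbelianGroup = record
          { isGroup = record
            { isMonoid = record
              { isSemigroup = record
                { isMagma = record
                  { isEquivalence = record
                    { refl  = refl , refl
                    ; sym   = λ (p , q) → sym p , sym q
                    ; trans = λ (p , q) (p′ , q′) → trans p p′ , trans q q′ }
                  ; ∙-cong = λ (p , q) (p′ , q′) → +-cong p p′ , +-cong q q′ }
                ; assoc = λ _ _ _ → +-assoc _ _ _ , +-assoc _ _ _ }
              ; identity = (λ _ → +-identityˡ _ , +-identityˡ _) , (λ _ → +-identityʳ _ , +-identityʳ _) }
            ; inverse = (λ _ → -‿inverseˡ _ , -‿inverseˡ _) , (λ _ → -‿inverseʳ _ , -‿inverseʳ _)
            ; ⁻¹-cong = λ (p , q) → -‿cong p , -‿cong q }
          ; comm = λ _ _ → +-comm _ _ , +-comm _ _ }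
        ; *-cong = λ (p , q) (p′ , q′) →
            +-cong (*-cong p p′) (-‿cong (*-cong q q′)) , +-cong (*-cong p q′) (*-cong q p′)
        ; *-assoc = λ (a +i b) (c +i d) (e +i f) →
            solve 6 (λ a b c d e f → (a :* c :- b :* d) :* e :- (a :* d :+ b :* c) :* f
              := a :* (c :* e :- d :* f) :- b :* (c :* f :+ d :* e)) refl a b c d e f ,
            solve 6 (λ a b c d e f → (a :* c :- b :* d) :* f :+ (a :* d :+ b :* c) :* e
              := a :* (c :* f :+ d :* e) :+ b :* (c :* e :- d :* f)) refl a b c d e f
        ; *-identity =
            (λ (a +i b) → solve 2 (λ a b → :1 :* a :- :0 :* b := a) refl a b ,
                          solve 2 (λ a b → :1 :* b :+ :0 :* a := b) refl a b) ,
            (λ (a +i b) → solve 2 (λ a b → a :* :1 :- b :* :0 := a) refl a b ,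
                          solve 2 (λ a b → a :* :0 :+ b :* :1 := b) refl a b)
        ; distrib =
            (λ (a +i b) (c +i d) (e +i f) →
              solve 6 (λ a b c d e f → a :* (c :+ e) :- b :* (d :+ f) := (a :* c :- b :* d) :+ (a :* e :- b :* f)) refl a b c d e f ,
              solve 6 (λ a b c d e f → a :* (d :+ f) :+ b :* (c :+ e) := (a :* d :+ b :* c) :+ (a :* f :+ b :* e)) refl a b c d e f) ,
            (λ (a +i b) (c +i d) (e +i f) →
              solve 6 (λ a b c d e f → (c :+ e) :* a :- (d :+ f) :* b := (c :* a :- d :* b) :+ (e :* a :- f :* b)) refl a b c d e f ,
              solve 6 (λ a b c d e f → (c :+ e) :* b :+ (d :+ f) :* a := (c :* b :+ d :* a) :+ (e :* b :+ f :* a)) refl a b c d e f)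
        }
      ; *-comm = λ (a +i b) (c +i d) →
          solve 4 (λ a b c d → a :* c :- b :* d := c :* a :- d :* b) refl a b c d ,
          solve 4 (λ a b c d → a :* d :+ b :* c := c :* b :+ d :* a) refl a b c d
      }
    }
    where module Z = Analysis ℛ

  open CommutativeRing ℂ-commutativeRing public
    using ()
    renaming ( _≈_ to _≈ᶜ_; _+_ to _+ᶜ_; _*_ to _*ᶜ_; -_ to -ᶜ_; _-_ to _-ᶜ_; 0# to 0ᶜ; 1# to 1ᶜ
             ; refl to reflᶜ; sym to symᶜ; trans to transᶜ
             ; +-cong to +ᶜ-cong; *-cong to *ᶜ-cong; +-congˡ to +ᶜ-congˡ; +-congʳ to +ᶜ-congʳ
             ; *-congˡ to *ᶜ-congˡ; *-congʳ to *ᶜ-congʳ; -‿cong to -ᶜ‿cong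
             ; *-comm to *ᶜ-comm; *-assoc to *ᶜ-assoc; *-identityˡ to *ᶜ-identityˡ; *-identityʳ to *ᶜ-identityʳ
             ; +-identityˡ to +ᶜ-identityˡ; +-assoc to +ᶜ-assoc
             ; zeroʳ to zeroᶜʳ)
  module S = FormalSeries ℂ-commutativeRing
  module CS = IntegerSolver ℂ-commutativeRing

  infixr 2 _≈ᶜ⟨_⟩_ _≈ᶜ⟨_⟨_
  infix  3 _∎ᶜ

  _≈ᶜ⟨_⟩_ : ∀ z {w v} → z ≈ᶜ w → w ≈ᶜ v → z ≈ᶜ v
  _ ≈ᶜ⟨ p ⟩ q = transᶜ p q

  _≈ᶜ⟨_⟨_ : ∀ z {w v} → w ≈ᶜ z → w ≈ᶜ v → z ≈ᶜ v
  _ ≈ᶜ⟨ p ⟨ q = transᶜ (symᶜ p) q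

  _∎ᶜ : ∀ z → z ≈ᶜ z
  _ ∎ᶜ = reflᶜ

  ≡⇒≈ᶜ : ∀ {z w} → z ≡ w → z ≈ᶜ w
  ≡⇒≈ᶜ ≡.refl = reflᶜ

  real-cong : ∀ {x y} → x ≈ y → real x ≈ᶜ real y
  real-cong x≈y = x≈y , refl

  real-+ : ∀ x y → real (x + y) ≈ᶜ real x +ᶜ real y
  real-+ x y = refl , sym (+-identityʳ 0#)

  real-* : ∀ x y → real (x * y) ≈ᶜ real x *ᶜ real y
  real-* x y =
    solve 2 (λ x y → x :* y := x :* y :- :0 :* :0) refl x y ,
    solve 2 (λ x y → :0 := x :* :0 :+ :0 :* y) refl x y

  real-neg : ∀ x → real (- x) ≈ᶜ -ᶜ real x
  real-neg x = refl , solve 0 (:0 := :- :0) refl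

  real-ι : ∀ n → real (ι n) ≈ᶜ S.ι n
  real-ι zero    = reflᶜ
  real-ι (suc n) = transᶜ (real-+ 1# (ι n)) (+ᶜ-congˡ (real-ι n))

  invᶜ : ℕ → ℂ
  invᶜ n = real (inv n)

  invᶜ-inverse : ∀ n → S.ι (suc n) *ᶜ invᶜ n ≈ᶜ 1ᶜ
  invᶜ-inverse n = transᶜ (*ᶜ-congʳ (symᶜ (real-ι (suc n))))
    (transᶜ (symᶜ (real-* _ _)) (real-cong (inv-inverse n)))

  module PS = S.Binomial invᶜ invᶜ-inverse

  real-∑ : ∀ n x → real (∑ n x) ≈ᶜ S.∑ n (λ k → real (x k))
  real-∑ zero x    = reflᶜ
  real-∑ (suc n) x = transᶜ (real-+ _ _) (+ᶜ-congˡ (real-∑ n (x ∘ suc)))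

  real-P : ∀ ε w n → real (P ε w n) ≈ᶜ PS.P (real ε) (real w) n
  real-P ε w zero    = reflᶜ
  real-P ε w (suc n) = transᶜ (real-* _ _) (*ᶜ-cong (real-P ε w n) (transᶜ (real-* _ _)
    (*ᶜ-congʳ (transᶜ (real-+ _ _) (+ᶜ-congˡ (transᶜ (real-* _ _) (*ᶜ-congʳ (real-ι n))))))))

  normSq-cong : ∀ {z w} → z ≈ᶜ w → normSq z ≈ normSq w
  normSq-cong (p , q) = +-cong (*-cong p p) (*-cong q q)

  normSq-nonneg : ∀ z → 0# ≤ normSq z
  normSq-nonneg z = +-nonneg (x*x-nonneg (re z)) (x*x-nonneg (im z))

  normSq-* : ∀ z w → normSq (z *ᶜ w) ≈ normSq z * normSq w
  normSq-* (a +i b) (c +i d) = solve 4 (λ a b c d →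
    (a :* c :- b :* d) :* (a :* c :- b :* d) :+ (a :* d :+ b :* c) :* (a :* d :+ b :* c)
      := (a :* a :+ b :* b) :* (c :* c :+ d :* d)) refl a b c d

  normSq-neg : ∀ z → normSq (-ᶜ z) ≈ normSq z
  normSq-neg (a +i b) = solve 2 (λ a b → :- a :* :- a :+ :- b :* :- b := a :* a :+ b :* b) refl a b

  ∣∣-resp-≈ : ∀ {z w r} → z ≈ᶜ w → ∣ z ∣≤ r → ∣ w ∣≤ r
  ∣∣-resp-≈ z≈w (0≤r , le) = 0≤r , ≤-trans (≤-reflexive (sym (normSq-cong z≈w))) le

  ∣∣-mono : ∀ {z r s} → r ≤ s → ∣ z ∣≤ r → ∣ z ∣≤ s
  ∣∣-mono r≤s (0≤r , le) = ≤-trans 0≤r r≤s , ≤-trans le (square-mono-≤ 0≤r r≤s)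

  <⇒∣∣≤ : ∀ {z r} → ∣ z ∣< r → ∣ z ∣≤ r
  <⇒∣∣≤ (0<r , lt) = <⇒≤ 0<r , <⇒≤ lt

  ∣0∣≤0 : ∣ 0ᶜ ∣≤ 0#
  ∣0∣≤0 = ≤-refl , ≤-reflexive (solve 0 (:0 :* :0 :+ :0 :* :0 := :0 :* :0) refl)

  ∣∣-real : ∀ {x} → 0# ≤ x → ∣ real x ∣≤ x
  ∣∣-real {x} 0≤x = 0≤x , ≤-reflexive (solve 1 (λ x → x :* x :+ :0 :* :0 := x :* x) refl x)

  ∣1∣≤1 : ∣ 1ᶜ ∣≤ 1#
  ∣1∣≤1 = ∣∣-real 0≤1

  ∣∣-ι : ∀ n → ∣ S.ι n ∣≤ ι n
  ∣∣-ι n = ∣∣-resp-≈ (real-ι n) (∣∣-real (ι-nonneg n))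

  ∣∣-neg : ∀ {z r} → ∣ z ∣≤ r → ∣ -ᶜ z ∣≤ r
  ∣∣-neg {z} (0≤r , le) = 0≤r , ≤-trans (≤-reflexive (normSq-neg z)) le

  ∣∣-* : ∀ {z w r s} → ∣ z ∣≤ r → ∣ w ∣≤ s → ∣ z *ᶜ w ∣≤ (r * s)
  ∣∣-* {z} {w} {r} {s} (0≤r , z≤) (0≤s , w≤) = *-nonneg 0≤r 0≤s , (begin
    normSq (z *ᶜ w)  ≈⟨ normSq-* z w ⟩
    normSq z * normSq w  ≤⟨ *-mono-≤ (x*x-nonneg r) (normSq-nonneg w) z≤ w≤ ⟩
    (r * r) * (s * s)  ≈⟨ solve 2 (λ r s → (r :* r) :* (s :* s) := (r :* s) :* (r :* s)) refl r s ⟩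
    (r * s) * (r * s)  ∎)

  -- The mixed term D is the real part of z times the conjugate of w. Lagrange's identity D² + E² =
  -- |z|² |w|² gives the Cauchy-Schwarz bound D ≤ r s.
  ∣∣-+ : ∀ {z w r s} → ∣ z ∣≤ r → ∣ w ∣≤ s → ∣ z +ᶜ w ∣≤ (r + s)
  ∣∣-+ {z@(a +i b)} {w@(c +i d)} {r} {s} (0≤r , z≤) (0≤s , w≤) = +-nonneg 0≤r 0≤s , (begin
    (a + c) * (a + c) + (b + d) * (b + d)
      ≈⟨ solve 4 (λ a b c d → (a :+ c) :* (a :+ c) :+ (b :+ d) :* (b :+ d)
           := (a :* a :+ b :* b) :+ (c :* c :+ d :* d) :+ ((a :* c :+ b :* d) :+ (a :* c :+ b :* d))) refl a b c d ⟩
    normSq z + normSq w + (D + D)  ≤⟨ +-mono-≤ (+-mono-≤ z≤ w≤) (+-mono-≤ D≤rs D≤rs) ⟩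
    r * r + s * s + (r * s + r * s)
      ≈⟨ solve 2 (λ r s → r :* r :+ s :* s :+ (r :* s :+ r :* s) := (r :+ s) :* (r :+ s)) refl r s ⟩
    (r + s) * (r + s)  ∎)
    where
    D = a * c + b * d
    E = a * d - b * c
    D≤rs : D ≤ r * s
    D≤rs = square-cancel-≤ (*-nonneg 0≤r 0≤s) $ begin
      D * D  ≤⟨ x≤x+y (x*x-nonneg E) ⟩
      D * D + E * E
        ≈⟨ solve 4 (λ a b c d → (a :* c :+ b :* d) :* (a :* c :+ b :* d) :+ (a :* d :- b :* c) :* (a :* d :- b :* c)
             := (a :* a :+ b :* b) :* (c :* c :+ d :* d)) refl a b c d ⟩
      normSq z * normSq w  ≤⟨ *-mono-≤ (x*x-nonneg r) (normSq-nonneg w) z≤ w≤ ⟩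
      (r * r) * (s * s)  ≈⟨ solve 2 (λ r s → (r :* r) :* (s :* s) := (r :* s) :* (r :* s)) refl r s ⟩
      (r * s) * (r * s)  ∎

  ∣∣-- : ∀ {z w r s} → ∣ z ∣≤ r → ∣ w ∣≤ s → ∣ z -ᶜ w ∣≤ (r + s)
  ∣∣-- z≤ w≤ = ∣∣-+ z≤ (∣∣-neg w≤)

  ∣∣-∑ : ∀ n {x r} → (∀ k → ∣ x k ∣≤ r k) → ∣ S.∑ n x ∣≤ ∑ n r
  ∣∣-∑ zero    x≤ = ∣0∣≤0
  ∣∣-∑ (suc n) x≤ = ∣∣-+ (x≤ 0) (∣∣-∑ n (x≤ ∘ suc))

  ∣∣-conv : ∀ n {x y r s} → (∀ k → k ℕ.≤ n → ∣ x k ∣≤ r k) → (∀ k → k ℕ.≤ n → ∣ y k ∣≤ s k) →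
            ∣ S.conv x y n ∣≤ conv r s n
  ∣∣-conv zero    x≤ y≤ = ∣∣-* (x≤ 0 ℕ.≤-refl) (y≤ 0 ℕ.≤-refl)
  ∣∣-conv (suc n) x≤ y≤ = ∣∣-+ (∣∣-* (x≤ 0 ℕ.z≤n) (y≤ (suc n) ℕ.≤-refl))
    (∣∣-conv n (λ k k≤n → x≤ (suc k) (ℕ.s≤s k≤n)) (λ k k≤n → y≤ k (ℕ.m≤n⇒m≤1+n k≤n)))

  ∣∣-P : ∀ {ε w e r} → ∣ ε ∣≤ e → ∣ w ∣≤ r → ∀ n → ∣ PS.P ε w n ∣≤ P e r n
  ∣∣-P ε≤ w≤ zero    = ∣1∣≤1
  ∣∣-P ε≤ w≤ (suc n) = ∣∣-* (∣∣-P ε≤ w≤ n)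
    (∣∣-* (∣∣-+ w≤ (∣∣-* (∣∣-ι n) ε≤)) (∣∣-real (<⇒≤ (0<inv n))))

  -- From n ≤ (1 + n)² with n = |z|²: a bound for the modulus that avoids the square root.
  ∣∣-bound : ∀ z → ∣ z ∣≤ (1# + normSq z)
  ∣∣-bound z = +-nonneg 0≤1 (normSq-nonneg z) ,
    0≤d⇒x≤y (+-nonneg (+-nonneg 0≤1 (normSq-nonneg z)) (*-nonneg (normSq-nonneg z) (normSq-nonneg z)))
      (solve 1 (λ n → n :+ (:1 :+ n :+ n :* n) := (:1 :+ n) :* (:1 :+ n)) refl (normSq z))

  re≤ : ∀ {z r} → ∣ z ∣≤ r → re z ≤ r
  re≤ {z} (0≤r , le) = square-cancel-≤ 0≤r (≤-trans (x≤x+y (x*x-nonneg (im z))) le)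

  -- A reverse triangle inequality. On the circle of radius r the real part is at most r, so r is
  -- the point of the circle nearest to x.
  circle-distance : ∀ {z r x} → 0# ≤ r → normSq z ≈ r * r → 0# ≤ x →
    (r - x) * (r - x) ≤ normSq (z -ᶜ real x)
  circle-distance {z@(a +i b)} {r} {x} 0≤r eq 0≤x = begin
    (r - x) * (r - x)  ≈⟨ solve 2 (λ r x → (r :- x) :* (r :- x) := r :* r :- (x :+ x) :* r :+ x :* x) refl r x ⟩
    r * r - (x + x) * r + x * x
      ≤⟨ +-monoˡ-≤ _ (+-mono-≤ (≤-reflexive (sym eq)) (neg-mono-≤ (*-monoʳ-≤ (+-nonneg 0≤x 0≤x) (re≤ {z} (0≤r , ≤-reflexive eq))))) ⟩
    normSq z - (x + x) * a + x * x
      ≈⟨ solve 3 (λ a b x → (a :* a :+ b :* b) :- (x :+ x) :* a :+ x :* x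
           := (a :- x) :* (a :- x) :+ (b :- :0) :* (b :- :0)) refl a b x ⟩
    normSq (z -ᶜ real x)  ∎

  -- Division by z by means of the lower bound ζ of its modulus; neither |z| nor 1 / z is formed.
  ∣∣-cancel : ∀ {z w ζ s g} → 0# < ζ → ζ * ζ ≤ normSq z → ∣ z *ᶜ w ∣≤ s → s ≤ ζ * g → 0# ≤ g → ∣ w ∣≤ g
  ∣∣-cancel {z} {w} {ζ} {s} {g} 0<ζ ζ≤z (0≤s , zw≤) s≤ζg 0≤g = 0≤g , *-cancelˡ-≤ (*-pos 0<ζ 0<ζ) (begin
    (ζ * ζ) * normSq w  ≤⟨ *-monoˡ-≤ (normSq-nonneg w) ζ≤z ⟩
    normSq z * normSq w  ≈⟨ normSq-* z w ⟨
    normSq (z *ᶜ w)  ≤⟨ zw≤ ⟩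
    s * s  ≤⟨ square-mono-≤ 0≤s s≤ζg ⟩
    (ζ * g) * (ζ * g)  ≈⟨ solve 2 (λ r s → (r :* s) :* (r :* s) := (r :* r) :* (s :* s)) refl ζ g ⟩
    (ζ * ζ) * (g * g)  ∎)

  ∣∣-limit : ∀ {z r} c → 0# ≤ r → 0# ≤ c → (∀ n → ∣ z ∣≤ (r + c * inv n)) → ∣ z ∣≤ r
  ∣∣-limit {z} {r} c 0≤r 0≤c z≤ = 0≤r , ≤-limit (2# * (r * c) + c * c) (λ n → begin
    normSq z  ≤⟨ proj₂ (z≤ n) ⟩
    (r + c * inv n) * (r + c * inv n)
      ≈⟨ solve 3 (λ r c i → (r :+ c :* i) :* (r :+ c :* i) := r :* r :+ ((:1 :+ :1) :* (r :* c) :+ (c :* c) :* i) :* i) refl r c (inv n) ⟩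
    r * r + (2# * (r * c) + (c * c) * inv n) * inv n
      ≤⟨ +-monoʳ-≤ _ (*-monoˡ-≤ (<⇒≤ (0<inv n)) (+-monoʳ-≤ _
           (≤-trans (*-monoʳ-≤ (*-nonneg 0≤c 0≤c) (inv≤1 n)) (≤-reflexive (*-identityʳ _))))) ⟩
    r * r + (2# * (r * c) + c * c) * inv n  ∎)

  ∣z∣≤0⇒z≈0 : ∀ {z} → ∣ z ∣≤ 0# → z ≈ᶜ 0ᶜ
  ∣z∣≤0⇒z≈0 {a +i b} (_ , le) =
    x*x≤0⇒x≈0 a (≤-trans (x≤x+y (x*x-nonneg b)) le) , x*x≤0⇒x≈0 b (≤-trans (x≤y+x (x*x-nonneg a)) le)
    where
    x*x≤0⇒x≈0 : ∀ x → x * x ≤ 0# * 0# → x ≈ 0#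
    x*x≤0⇒x≈0 x le = ≤-antisym (square-cancel-≤ ≤-refl le)
      (0≤d⇒x≤y (x≤y⇒0≤y-x (square-cancel-≤ {x = - x} ≤-refl
         (≤-trans (≤-reflexive (solve 1 (λ x → :- x :* :- x := x :* x) refl x)) le)))
        (solve 1 (λ x → :0 :+ (:0 :- :- x) := x) refl x))

-- Limits of complex sequences and the exponential function.

module Limits {c ℓ₁ ℓ₂} (ℛ : CompleteOrderedField c ℓ₁ ℓ₂) where

  open ComplexPlane ℛ public

  -- Convergence at the scale c / k: the constant c makes limit theorems
  -- composable without dividing ε.
  Lim : (ℕ → ℂ) → ℂ → Set _
  Lim x l = ∃[ c ] 0# ≤ c × (∀ k → ∃[ n₀ ] ∀ n → n₀ ℕ.≤ n → ∣ x n -ᶜ l ∣≤ (c * inv k))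

  ⟶⇒Lim : ∀ {x l} → x ⟶ l → Lim x l
  ⟶⇒Lim x⟶l = 1# , 0≤1 , λ k → let n₀ , near = x⟶l (inv k) (0<inv k) in
    n₀ , λ n n₀≤n → ∣∣-mono (≤-reflexive (sym (*-identityˡ _))) (<⇒∣∣≤ (near n n₀≤n))

  Lim-cong : ∀ {x y l} → (∀ n → x n ≈ᶜ y n) → Lim x l → Lim y l
  Lim-cong x≈y (c , 0≤c , near) = c , 0≤c , λ k → let n₀ , bound = near k in
    n₀ , λ n n₀≤n → ∣∣-resp-≈ (+ᶜ-congʳ (x≈y n)) (bound n n₀≤n)

  Lim-const : ∀ l → Lim (λ _ → l) l
  Lim-const l = 0# , ≤-refl , λ k → 0 , λ n _ → ∣∣-mono (≤-reflexive (sym (zeroˡ _)))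
    (∣∣-resp-≈ (symᶜ (CommutativeRing.-‿inverseʳ ℂ-commutativeRing l)) ∣0∣≤0)

  Lim-- : ∀ {x y l l′} → Lim x l → Lim y l′ → Lim (λ n → x n -ᶜ y n) (l -ᶜ l′)
  Lim-- {x} {y} {l} {l′} (c , 0≤c , x≤) (d , 0≤d , y≤) = c + d , +-nonneg 0≤c 0≤d , λ k →
    let m , x≤ = x≤ k ; n , y≤ = y≤ k in
    m ℕ.+ n , λ N m+n≤N → ∣∣-mono (≤-reflexive (sym (distribʳ _ _ _)))
      (∣∣-resp-≈ (CS.solve 4 (λ x y l l′ → (x CS.:- l) CS.:- (y CS.:- l′) CS.:= (x CS.:- y) CS.:- (l CS.:- l′)) reflᶜ (x N) (y N) l l′)
        (∣∣-- (x≤ N (ℕ.≤-trans (ℕ.m≤m+n m n) m+n≤N)) (y≤ N (ℕ.≤-trans (ℕ.m≤n+m n m) m+n≤N))))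

  Lim-* : ∀ {x y l l′} → Lim x l → Lim y l′ → Lim (λ n → x n *ᶜ y n) (l *ᶜ l′)
  Lim-* {x} {y} {l} {l′} (c , 0≤c , x≤) (d , 0≤d , y≤) =
    c * d + c * B′ + B * d , +-nonneg (+-nonneg (*-nonneg 0≤c 0≤d) (*-nonneg 0≤c 0≤B′)) (*-nonneg 0≤B 0≤d) , λ k →
    let m , x≤ = x≤ k ; n , y≤ = y≤ k in
    m ℕ.+ n , λ N m+n≤N →
      let x-l = x≤ N (ℕ.≤-trans (ℕ.m≤m+n m n) m+n≤N)
          y-l = y≤ N (ℕ.≤-trans (ℕ.m≤n+m n m) m+n≤N) in
      ∣∣-mono (bound k) $
      ∣∣-resp-≈ (CS.solve 4 (λ x y l l′ → (x CS.:- l) CS.:* (y CS.:- l′) CS.:+ (x CS.:- l) CS.:* l′ CS.:+ l CS.:* (y CS.:- l′)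
          CS.:= x CS.:* y CS.:- l CS.:* l′) reflᶜ (x N) (y N) l l′)
        (∣∣-+ (∣∣-+ (∣∣-* x-l y-l) (∣∣-* x-l (∣∣-bound l′))) (∣∣-* (∣∣-bound l) y-l))
    where
    B B′ : _
    B = 1# + normSq l
    B′ = 1# + normSq l′
    0≤B = +-nonneg 0≤1 (normSq-nonneg l)
    0≤B′ = +-nonneg 0≤1 (normSq-nonneg l′)
    bound : ∀ k → (c * inv k) * (d * inv k) + (c * inv k) * B′ + B * (d * inv k) ≤ (c * d + c * B′ + B * d) * inv k
    bound k = begin
      (c * inv k) * (d * inv k) + (c * inv k) * B′ + B * (d * inv k)
        ≈⟨ solve 5 (λ c d i p q → (c :* i) :* (d :* i) :+ (c :* i) :* p :+ q :* (d :* i)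
             := ((c :* d) :* i :+ c :* p :+ q :* d) :* i) refl c d (inv k) B′ B ⟩
      ((c * d) * inv k + c * B′ + B * d) * inv k
        ≤⟨ *-monoˡ-≤ (<⇒≤ (0<inv k)) (+-monoˡ-≤ _ (+-monoˡ-≤ _
             (≤-trans (*-monoʳ-≤ (*-nonneg 0≤c 0≤d) (inv≤1 k)) (≤-reflexive (*-identityʳ _))))) ⟩
      (c * d + c * B′ + B * d) * inv k ∎

  Lim-unique : ∀ {x l l′} → Lim x l → Lim x l′ → l ≈ᶜ l′
  Lim-unique {x} {l} {l′} (c , 0≤c , x≤) (d , 0≤d , x≤′) =
    l  ≈ᶜ⟨ CS.solve 2 (λ l l′ → l CS.:= (l CS.:- l′) CS.:+ l′) reflᶜ l l′ ⟩
    (l -ᶜ l′) +ᶜ l′  ≈ᶜ⟨ +ᶜ-congʳ (∣z∣≤0⇒z≈0 (∣∣-limit (c + d) ≤-refl (+-nonneg 0≤c 0≤d) bound)) ⟩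
    0ᶜ +ᶜ l′  ≈ᶜ⟨ +ᶜ-identityˡ l′ ⟩
    l′  ∎ᶜ
    where
    bound : ∀ k → ∣ l -ᶜ l′ ∣≤ (0# + (c + d) * inv k)
    bound k = let m , x≤ = x≤ k ; n , x≤′ = x≤′ k in
      ∣∣-mono (≤-reflexive (solve 3 (λ c d i → d :* i :+ c :* i := :0 :+ (c :+ d) :* i) refl c d (inv k)))
      (∣∣-resp-≈ (CS.solve 3 (λ x l l′ → (x CS.:- l′) CS.:- (x CS.:- l) CS.:= l CS.:- l′) reflᶜ (x (m ℕ.+ n)) l l′)
        (∣∣-- (x≤′ (m ℕ.+ n) (ℕ.m≤n+m n m)) (x≤ (m ℕ.+ n) (ℕ.m≤m+n m n))))

  Lim-∣∣ : ∀ {x l r} n₁ → 0# ≤ r → Lim x l → (∀ n → n₁ ℕ.≤ n → ∣ x n ∣≤ r) → ∣ l ∣≤ r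
  Lim-∣∣ {x} {l} {r} n₁ 0≤r (c , 0≤c , near) x≤ = ∣∣-limit c 0≤r 0≤c bound
    where
    bound : ∀ k → ∣ l ∣≤ (r + c * inv k)
    bound k = let n₀ , near = near k in
      ∣∣-resp-≈ (CS.solve 2 (λ x l → x CS.:- (x CS.:- l) CS.:= l) reflᶜ (x (n₀ ℕ.+ n₁)) l)
        (∣∣-- (x≤ (n₀ ℕ.+ n₁) (ℕ.m≤n+m n₁ n₀)) (near (n₀ ℕ.+ n₁) (ℕ.m≤m+n n₀ n₁)))

  1/-inverse : ∀ n .{{_ : NonZero n}} → ι n * 1/ n ≈ 1#
  1/-inverse (suc n) = inv-inverse n

  ∣∑-∑∣ : ∀ {m n x r} → (∀ k → ∣ x k ∣≤ r k) → m ℕ.≤ n → ∣ S.∑ n x -ᶜ S.∑ m x ∣≤ (∑ n r - ∑ m r)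
  ∣∑-∑∣ {n = n} x≤ ℕ.z≤n = ∣∣-mono
    (≤-reflexive (solve 1 (λ s → s := s :- :0) refl _))
    (∣∣-resp-≈ (CS.solve 1 (λ s → s CS.:= s CS.:- CS.:0) reflᶜ _) (∣∣-∑ n x≤))
  ∣∑-∑∣ x≤ (ℕ.s≤s m≤n) = ∣∣-mono
    (≤-reflexive (solve 3 (λ x s t → s :- t := (x :+ s) :- (x :+ t)) refl _ _ _))
    (∣∣-resp-≈ (CS.solve 3 (λ x s t → s CS.:- t CS.:= (x CS.:+ s) CS.:- (x CS.:+ t)) reflᶜ _ _ _) (∣∑-∑∣ (x≤ ∘ suc) m≤n))

  -- The terms of ∑ x * ∑ y that are missing from the truncated Cauchy product
  -- are dominated by those of any majorants of x and y.
  ∣∑*∑-∑conv∣ : ∀ {n N x y r s} → (∀ k → ∣ x k ∣≤ r k) → (∀ k → ∣ y k ∣≤ s k) → n ℕ.≤ N →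
    ∣ S.∑ n x *ᶜ S.∑ N y -ᶜ S.∑ n (S.conv x y) ∣≤ (∑ n r * ∑ N s - ∑ n (conv r s))
  ∣∑*∑-∑conv∣ {zero} {N} {x} {y} {r} {s} x≤ y≤ n≤N = ∣∣-mono
    (≤-reflexive (solve 1 (λ s → :0 := :0 :* s :- :0) refl (∑ N s)))
    (∣∣-resp-≈ (CS.solve 1 (λ s → CS.:0 CS.:= CS.:0 CS.:* s CS.:- CS.:0) reflᶜ (S.∑ N y)) ∣0∣≤0)
  ∣∑*∑-∑conv∣ {suc n} {N} {x} {y} {r} {s} x≤ y≤ n≤N = ∣∣-mono
    (≤-reflexive (begin-equality
      r 0 * (∑ N s - ∑ (suc n) s) + (∑ n (r ∘ suc) * ∑ N s - ∑ n (conv (r ∘ suc) s))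
        ≈⟨ solve 5 (λ r a b u v → r :* (a :- b) :+ (u :* a :- v) := (r :+ u) :* a :- (r :* b :+ v)) refl _ _ _ _ _ ⟩
      ∑ (suc n) r * ∑ N s - (r 0 * ∑ (suc n) s + ∑ n (conv (r ∘ suc) s))  ≈⟨ +-congˡ (-‿cong (∑-conv n r s)) ⟨
      ∑ (suc n) r * ∑ N s - ∑ (suc n) (conv r s)  ∎))
    (∣∣-resp-≈ (transᶜ
        (CS.solve 5 (λ r a b u v → r CS.:* (a CS.:- b) CS.:+ (u CS.:* a CS.:- v) CS.:= (r CS.:+ u) CS.:* a CS.:- (r CS.:* b CS.:+ v)) reflᶜ
          (x 0) (S.∑ N y) (S.∑ (suc n) y) (S.∑ n (x ∘ suc)) (S.∑ n (S.conv (x ∘ suc) y)))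
        (+ᶜ-congˡ (-ᶜ‿cong (symᶜ (S.∑-conv n x y)))))
      (∣∣-+ (∣∣-* (x≤ 0) (∣∑-∑∣ y≤ n≤N)) (∣∑*∑-∑conv∣ (x≤ ∘ suc) y≤ (ℕ.<⇒≤ n≤N))))

  conj : ℂ → ℂ
  conj (a +i b) = a +i (- b)

  conj-cong : ∀ {z w} → z ≈ᶜ w → conj z ≈ᶜ conj w
  conj-cong (p , q) = p , -‿cong q

  conj-+ : ∀ z w → conj (z +ᶜ w) ≈ᶜ conj z +ᶜ conj w
  conj-+ (a +i b) (c +i d) = refl , solve 2 (λ b d → :- (b :+ d) := :- b :+ :- d) refl b d

  conj-* : ∀ z w → conj (z *ᶜ w) ≈ᶜ conj z *ᶜ conj w
  conj-* (a +i b) (c +i d) =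
    solve 4 (λ a b c d → a :* c :- b :* d := a :* c :- (:- b) :* (:- d)) refl a b c d ,
    solve 4 (λ a b c d → :- (a :* d :+ b :* c) := a :* (:- d) :+ (:- b) :* c) refl a b c d

  conj-real : ∀ x → conj (real x) ≈ᶜ real x
  conj-real x = refl , solve 0 (:- :0 := :0) refl

  conj-∑ : ∀ n x → conj (S.∑ n x) ≈ᶜ S.∑ n (λ k → conj (x k))
  conj-∑ zero x    = conj-real 0#
  conj-∑ (suc n) x = transᶜ (conj-+ _ _) (+ᶜ-congˡ (conj-∑ n (x ∘ suc)))

  conj-P : ∀ z n → conj (PS.P 0ᶜ z n) ≈ᶜ PS.P 0ᶜ (conj z) n
  conj-P z zero    = conj-real 1#
  conj-P z (suc n) = transᶜ (conj-* _ _) (*ᶜ-cong (conj-P z n) (transᶜ (conj-* _ _)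
    (*ᶜ-cong (transᶜ (conj-+ _ _) (+ᶜ-congˡ
      (transᶜ (conj-cong (zeroᶜʳ (S.ι n))) (transᶜ (conj-real 0#) (symᶜ (zeroᶜʳ (S.ι n)))))))
      (conj-real (inv n)))))

  conj-Lim : ∀ {x l} → Lim x l → Lim (λ n → conj (x n)) (conj l)
  conj-Lim {x} {l} (c , 0≤c , near) = c , 0≤c , λ k → let n₀ , bound = near k in
    n₀ , λ n n₀≤n → let 0≤ , le = bound n n₀≤n in
      0≤ , ≤-trans (≤-reflexive (eq (x n) l)) le
    where
    eq : ∀ z w → normSq (conj z -ᶜ conj w) ≈ normSq (z -ᶜ w)
    eq (a +i b) (c +i d) = solve 4 (λ a b c d →
      (a :- c) :* (a :- c) :+ (:- b :- :- d) :* (:- b :- :- d) := (a :- c) :* (a :- c) :+ (b :- d) :* (b :- d)) refl a b c d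

  module Exponential (exp : ℂ → ℂ) (isExp : IsExp exp) where

    E : ℂ → ℕ → ℂ
    E z n = S.∑ n (PS.P 0ᶜ z)

    E⟶exp : ∀ z → Lim (E z) (exp z)
    E⟶exp z = Lim-cong (λ n → S.∑-cong n term) (⟶⇒Lim (isExp z))
      where
      term : ∀ k → Analysis._^_ ℛ z k *ᶜ real (1/ (k !) {{k ℕ.!≢0}}) ≈ᶜ PS.P 0ᶜ z k
      term k =
        Analysis._^_ ℛ z k *ᶜ real (1/ (k !) {{k ℕ.!≢0}})  ≈ᶜ⟨ *ᶜ-congʳ (PS.factorial-P z k) ⟨
        (S.ι (k !) *ᶜ PS.P 0ᶜ z k) *ᶜ real (1/ (k !) {{k ℕ.!≢0}})
          ≈ᶜ⟨ CS.solve 3 (λ i p r → (i CS.:* p) CS.:* r CS.:= (i CS.:* r) CS.:* p) reflᶜ _ _ _ ⟩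
        (S.ι (k !) *ᶜ real (1/ (k !) {{k ℕ.!≢0}})) *ᶜ PS.P 0ᶜ z k
          ≈ᶜ⟨ *ᶜ-congʳ (transᶜ (*ᶜ-congʳ (symᶜ (real-ι (k !)))) (transᶜ (symᶜ (real-* _ _)) (real-cong (1/-inverse (k !) {{k ℕ.!≢0}})))) ⟩
        1ᶜ *ᶜ PS.P 0ᶜ z k  ≈ᶜ⟨ *ᶜ-identityˡ _ ⟩
        PS.P 0ᶜ z k  ∎ᶜ

    exp-cong : ∀ {z w} → z ≈ᶜ w → exp z ≈ᶜ exp w
    exp-cong {z} {w} z≈w = Lim-unique
      (Lim-cong (λ n → S.∑-cong n (PS.P-cong reflᶜ z≈w)) (E⟶exp z)) (E⟶exp w)

    -- The series has real coefficients. Both the reality of exp on the real line and the modulus of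
    -- exp z follow from this.
    conj-exp : ∀ z → conj (exp z) ≈ᶜ exp (conj z)
    conj-exp z = Lim-unique
      (Lim-cong (λ n → transᶜ (conj-∑ n (PS.P 0ᶜ z)) (S.∑-cong n (conj-P z))) (conj-Lim (E⟶exp z))) (E⟶exp (conj z))

    e : Carrier → Carrier
    e x = re (exp (real x))

    X : Carrier → ℕ → Carrier
    X x n = ∑ n (P 0# x)

    real-X : ∀ x n → real (X x n) ≈ᶜ E (real x) n
    real-X x n = transᶜ (real-∑ n (P 0# x)) (S.∑-cong n (real-P 0# x))

    -- By `conj-exp` the imaginary part y equals -y; `inv 1` is the factor 1/2.
    exp-real : ∀ x → exp (real x) ≈ᶜ real (e x)
    exp-real x = refl , (begin-equality
      y  ≈⟨ *-identityˡ y ⟨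
      1# * y  ≈⟨ *-congʳ (inv-inverse 1) ⟨
      ((1# + (1# + 0#)) * inv 1) * y
        ≈⟨ solve 2 (λ r y → ((:1 :+ (:1 :+ :0)) :* r) :* y := (y :+ y) :* r) refl (inv 1) y ⟩
      (y + y) * inv 1  ≈⟨ *-congʳ (+-congˡ (sym -y≈y)) ⟩
      (y + - y) * inv 1  ≈⟨ solve 2 (λ r y → (y :- y) :* r := :0) refl (inv 1) y ⟩
      0#  ∎)
      where
      y = im (exp (real x))
      -y≈y : - y ≈ y
      -y≈y = proj₂ (transᶜ (conj-exp (real x)) (exp-cong (conj-real x)))

    X-Lim : ∀ x → Lim (λ n → real (X x n)) (real (e x))
    X-Lim x = let c , 0≤c , near = Lim-cong (λ n → symᶜ (real-X x n)) (E⟶exp (real x)) in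
      c , 0≤c , λ k → let n₀ , bound = near k in
      n₀ , λ n n₀≤n → ∣∣-resp-≈ (+ᶜ-congˡ (-ᶜ‿cong (exp-real x))) (bound n n₀≤n)

    -- The block from n to 2 n of a convergent series tends to zero. It majorises the defect in the
    -- addition theorem.
    X-tail : ∀ x → 0# ≤ x → Lim (λ n → real (X x (n ℕ.+ n) - X x n)) 0ᶜ
    X-tail x 0≤x = let c , 0≤c , near = X-Lim x in
      c + c , +-nonneg 0≤c 0≤c , λ k → let n₀ , bound = near k in
      n₀ , λ n n₀≤n → ∣∣-mono (≤-reflexive (sym (distribʳ _ _ _)))
        (∣∣-resp-≈ (transᶜ
            (CS.solve 3 (λ u v l → (u CS.:- l) CS.:- (v CS.:- l) CS.:= (u CS.:- v) CS.:- CS.:0) reflᶜ (real (X x (n ℕ.+ n))) (real (X x n)) (real (e x)))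
            (+ᶜ-congʳ (symᶜ (transᶜ (real-+ _ _) (+ᶜ-congˡ (real-neg _))))))
          (∣∣-- (bound (n ℕ.+ n) (ℕ.≤-trans n₀≤n (ℕ.m≤m+n n n))) (bound n n₀≤n)))

    Lim-dominated : ∀ {x : ℕ → ℂ} {r : ℕ → Carrier} → Lim (λ n → real (r n)) 0ᶜ → (∀ n → ∣ x n ∣≤ r n) → Lim x 0ᶜ
    Lim-dominated {x} {r} (c , 0≤c , near) x≤r = c , 0≤c , λ k → let n₀ , bound = near k in
      n₀ , λ n n₀≤n → ∣∣-resp-≈ (CS.solve 1 (λ x → x CS.:= x CS.:- CS.:0) reflᶜ (x n))
        (∣∣-mono (≤-trans (≤-reflexive (solve 1 (λ r → r := r :- :0) refl (r n))) (re≤ {z = real (r n) -ᶜ 0ᶜ} (bound n n₀≤n))) (x≤r n))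

    -- The defect D n of the truncated Cauchy product is majorised by the same defect for positive
    -- numbers r ≥ |z| and s ≥ |w|, and `∑-conv-≥` places that one inside the block from n to 2 n of
    -- the series for r + s.
    exp-+ : ∀ z w → exp (z +ᶜ w) ≈ᶜ exp z *ᶜ exp w
    exp-+ z w = symᶜ (transᶜ (CS.solve 1 (λ x → x CS.:= x CS.:- CS.:0) reflᶜ (exp z *ᶜ exp w)) (Lim-unique
      (Lim-cong (λ n → CS.solve 2 (λ x y → x CS.:- (x CS.:- y) CS.:= y) reflᶜ (E z n *ᶜ E w n) (E (z +ᶜ w) n))
        (Lim-- {x = λ n → E z n *ᶜ E w n} {y = D} (Lim-* (E⟶exp z) (E⟶exp w)) D⟶0))
      (E⟶exp (z +ᶜ w))))
      where
      r s : Carrier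
      r = 1# + normSq z
      s = 1# + normSq w
      0≤r = proj₁ (∣∣-bound z)
      0≤s = proj₁ (∣∣-bound w)
      z≤ : ∀ k → ∣ PS.P 0ᶜ z k ∣≤ P 0# r k
      z≤ = ∣∣-P ∣0∣≤0 (∣∣-bound z)
      w≤ : ∀ k → ∣ PS.P 0ᶜ w k ∣≤ P 0# s k
      w≤ = ∣∣-P ∣0∣≤0 (∣∣-bound w)
      D : ℕ → ℂ
      D n = E z n *ᶜ E w n -ᶜ E (z +ᶜ w) n
      bound : ∀ n → ∣ D n ∣≤ (X (r + s) (n ℕ.+ n) - X (r + s) n)
      bound n = ∣∣-mono
        (+-mono-≤
          (≤-trans (∑-conv-≥ n n (P-nonneg ≤-refl 0≤r) (P-nonneg ≤-refl 0≤s))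
            (≤-reflexive (∑-cong (n ℕ.+ n) (vandermonde 0# r s))))
          (≤-reflexive (-‿cong (∑-cong n (vandermonde 0# r s)))))
        (∣∣-resp-≈ (+ᶜ-congˡ (-ᶜ‿cong (S.∑-cong n (PS.vandermonde 0ᶜ z w))))
          (∣∑*∑-∑conv∣ z≤ w≤ (ℕ.≤-refl {n})))

      D⟶0 : Lim D 0ᶜ
      D⟶0 = Lim-dominated {x = D} {r = λ n → X (r + s) (n ℕ.+ n) - X (r + s) n} (X-tail (r + s) (+-nonneg 0≤r 0≤s)) bound

    e-cong : ∀ {x y} → x ≈ y → e x ≈ e y
    e-cong x≈y = proj₁ (exp-cong (real-cong x≈y))

    e-+ : ∀ x y → e (x + y) ≈ e x * e y
    e-+ x y = proj₁ (transᶜ (exp-cong (real-+ x y)) (transᶜ (exp-+ _ _)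
      (transᶜ (*ᶜ-cong (exp-real x) (exp-real y)) (symᶜ (real-* _ _)))))

    -- All terms of the series are nonnegative, so its first two bound the limit from below.
    1+x≤e : ∀ {x} → 0# ≤ x → 1# + x ≤ e x
    1+x≤e {x} 0≤x = ≤-limit scale bound
      where
      scale = proj₁ (X-Lim x)
      bound : ∀ k → 1# + x ≤ e x + scale * inv k
      bound k = let n₀ , near = proj₂ (proj₂ (X-Lim x)) k ; N = 2 ℕ.+ n₀ in begin
        1# + x  ≈⟨ two ⟨
        X x 2  ≤⟨ ∑-mono-length (P-nonneg ≤-refl 0≤x) (ℕ.m≤m+n 2 n₀) ⟩
        X x N  ≈⟨ solve 2 (λ X e → X := e :+ (X :- e)) refl (X x N) (e x) ⟩
        e x + (X x N - e x)  ≤⟨ +-monoʳ-≤ (e x) (re≤ (near N (ℕ.m≤n+m n₀ 2))) ⟩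
        e x + scale * inv k  ∎
        where
        two : X x 2 ≈ 1# + x
        two = begin-equality
          1# + (1# * ((x + 0# * 0#) * inv 0) + 0#)
            ≈⟨ solve 2 (λ x i → :1 :+ (:1 :* ((x :+ :0 :* :0) :* i) :+ :0) := :1 :+ ((:1 :+ :0) :* i) :* x) refl x (inv 0) ⟩
          1# + ((1# + 0#) * inv 0) * x  ≈⟨ +-congˡ (trans (*-congʳ (inv-inverse 0)) (*-identityˡ x)) ⟩
          1# + x  ∎

    1≤e : ∀ {x} → 0# ≤ x → 1# ≤ e x
    1≤e 0≤x = ≤-trans (x≤x+y 0≤x) (1+x≤e 0≤x)

    -- For N > -x one has e N * e x = e (N + x) ≥ 1, and the positive factor e N is cancelled.
    0<e : ∀ x → 0# < e x
    0<e x = let N , -x<N = archimedean (- x) in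
      *-cancel-pos (<-≤-trans 0<1 (1≤e (ι-nonneg N)))
        (<-≤-trans 0<1 (≤-trans
          (1≤e (≤-trans (x≤y⇒0≤y-x (<⇒≤ -x<N)) (≤-reflexive (solve 2 (λ x n → n :- :- x := n :+ x) refl x (ι N)))))
          (≤-reflexive (e-+ (ι N) x))))

    e-0 : e 0# ≈ 1#
    e-0 = ≤-antisym (*-cancelˡ-≤ (0<e 0#) (≤-reflexive e0*e0)) (1≤e ≤-refl)
      where
      e0*e0 : e 0# * e 0# ≈ e 0# * 1#
      e0*e0 = trans (sym (e-+ 0# 0#)) (trans (e-cong (+-identityʳ 0#)) (sym (*-identityʳ _)))

    e-split : ∀ x y → e y ≈ e x * e (y - x)
    e-split x y = trans (e-cong (solve 2 (λ x y → y := x :+ (y :- x)) refl x y)) (e-+ x (y - x))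

    e-mono : ∀ {x y} → x ≤ y → e x ≤ e y
    e-mono {x} {y} x≤y = begin
      e x  ≈⟨ *-identityʳ _ ⟨
      e x * 1#  ≤⟨ *-monoʳ-≤ (<⇒≤ (0<e x)) (1≤e (x≤y⇒0≤y-x x≤y)) ⟩
      e x * e (y - x)  ≈⟨ e-split x y ⟨
      e y  ∎

    e-mono-< : ∀ {x y} → x < y → e x < e y
    e-mono-< {x} {y} x<y = begin-strict
      e x  ≈⟨ *-identityʳ _ ⟨
      e x * 1#  <⟨ *-monoʳ-< (0<e x) (0<d⇒x<y (x<y⇒0<y-x x<y) refl) ⟩
      e x * (1# + (y - x))  ≤⟨ *-monoʳ-≤ (<⇒≤ (0<e x)) (1+x≤e (<⇒≤ (x<y⇒0<y-x x<y))) ⟩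
      e x * e (y - x)  ≈⟨ e-split x y ⟨
      e y  ∎

    -- |exp z|² = exp z * exp (conj z) = exp (2 Re z).
    normSq-exp : ∀ z → normSq (exp z) ≈ e (re z) * e (re z)
    normSq-exp z@(a +i b) = proj₁ (
      real (normSq (exp z))  ≈ᶜ⟨ real-normSq (exp z) ⟩
      exp z *ᶜ conj (exp z)  ≈ᶜ⟨ *ᶜ-congˡ (conj-exp z) ⟩
      exp z *ᶜ exp (conj z)  ≈ᶜ⟨ exp-+ z (conj z) ⟨
      exp (z +ᶜ conj z)  ≈ᶜ⟨ exp-cong (refl , -‿inverseʳ b) ⟩
      exp (real (a + a))  ≈ᶜ⟨ exp-real (a + a) ⟩
      real (e (a + a))  ≈ᶜ⟨ real-cong (e-+ a a) ⟩
      real (e a * e a)  ∎ᶜ)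
      where
      real-normSq : ∀ z → real (normSq z) ≈ᶜ z *ᶜ conj z
      real-normSq (a +i b) =
        solve 2 (λ a b → a :* a :+ b :* b := a :* a :- b :* (:- b)) refl a b ,
        solve 2 (λ a b → :0 := a :* (:- b) :+ b :* a) refl a b

-- The supersolution and its convolution with the digit coefficients.

module Gauge {c ℓ₁ ℓ₂} (ℛ : CompleteOrderedField c ℓ₁ ℓ₂) where

  open RealSeries ℛ

  P-0-dilate : ∀ l w n → P 0# (l * w) n ≈ l ^ n * P 0# w n
  P-0-dilate l w n = trans (P-cong (sym (zeroʳ l)) refl n) (P-dilate l 0# w n)

  P-0-pos : ∀ {w} → 0# < w → ∀ n → 0# < P 0# w n
  P-0-pos 0<w zero    = 0<1
  P-0-pos {w} 0<w (suc n) = *-pos (P-0-pos 0<w n)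
    (*-pos (<-respʳ-≈ (solve 2 (λ w i → w := w :+ i :* :0) refl w (ι n)) 0<w) (0<inv n))

  conv-term : ∀ m n {x y} → (∀ k → 0# ≤ x k) → (∀ k → 0# ≤ y k) → x m * y n ≤ conv x y (m ℕ.+ n)
  conv-term zero zero    0≤x 0≤y = ≤-refl
  conv-term zero (suc n) 0≤x 0≤y = x≤x+y (conv-nonneg n (0≤x ∘ suc) 0≤y)
  conv-term (suc m) n {x} {y} 0≤x 0≤y = ≤-trans (conv-term m n (0≤x ∘ suc) 0≤y)
    (x≤y+x (*-nonneg (0≤x 0) (0≤y (suc m ℕ.+ n))))

  inv-antitone : ∀ m n → inv (m ℕ.+ n) ≤ inv n
  inv-antitone m n = *-cancelˡ-≤ (0<ι-suc n) $ begin
    ι (suc n) * inv (m ℕ.+ n)  ≤⟨ *-monoˡ-≤ (<⇒≤ (0<inv (m ℕ.+ n))) (ι-mono (ℕ.s≤s (ℕ.m≤n+m n m))) ⟩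
    ι (suc (m ℕ.+ n)) * inv (m ℕ.+ n)  ≈⟨ trans (inv-inverse (m ℕ.+ n)) (sym (inv-inverse n)) ⟩
    ι (suc n) * inv n  ∎

  -- m! n! ≤ (m + n)!, which enters the induction as `inv-antitone`.
  P-0-split : ∀ {w} → 0# ≤ w → ∀ m n → P 0# w (m ℕ.+ n) ≤ P 0# w m * P 0# w n
  P-0-split {w} 0≤w m zero = ≤-reflexive (trans (reflexive (≡.cong (P 0# w) (ℕ.+-identityʳ m))) (sym (*-identityʳ _)))
  P-0-split {w} 0≤w m (suc n) = begin
    P 0# w (m ℕ.+ suc n)  ≡⟨ ≡.cong (P 0# w) (ℕ.+-suc m n) ⟩
    P 0# w (m ℕ.+ n) * ((w + ι (m ℕ.+ n) * 0#) * inv (m ℕ.+ n))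
      ≈⟨ *-congˡ (solve 3 (λ w i r → (w :+ i :* :0) :* r := w :* r) refl w (ι (m ℕ.+ n)) (inv (m ℕ.+ n))) ⟩
    P 0# w (m ℕ.+ n) * (w * inv (m ℕ.+ n))
      ≤⟨ *-mono-≤ (*-nonneg (0≤P m) (0≤P n)) (*-nonneg 0≤w (<⇒≤ (0<inv (m ℕ.+ n)))) (P-0-split 0≤w m n) (*-monoʳ-≤ 0≤w (inv-antitone m n)) ⟩
    (P 0# w m * P 0# w n) * (w * inv n)
      ≈⟨ solve 5 (λ a b w i r → (a :* b) :* (w :* r) := a :* (b :* ((w :+ i :* :0) :* r))) refl (P 0# w m) (P 0# w n) w (ι n) (inv n) ⟩
    P 0# w m * P 0# w (suc n)  ∎
    where 0≤P = P-nonneg ≤-refl 0≤w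

  P-0-≤1 : ∀ {w} → 0# ≤ w → w ≤ 1# → ∀ n → P 0# w n ≤ 1#
  P-0-≤1 0≤w w≤1 zero    = ≤-refl
  P-0-≤1 {w} 0≤w w≤1 (suc n) = begin
    P 0# w n * ((w + ι n * 0#) * inv n)  ≈⟨ *-congˡ (solve 3 (λ w i r → (w :+ i :* :0) :* r := w :* r) refl w (ι n) (inv n)) ⟩
    P 0# w n * (w * inv n)
      ≤⟨ *-mono-≤ 0≤1 (*-nonneg 0≤w (<⇒≤ (0<inv n))) (P-0-≤1 0≤w w≤1 n)
           (*-mono-≤ 0≤1 (<⇒≤ (0<inv n)) w≤1 (inv≤1 n)) ⟩
    1# * (1# * 1#)  ≈⟨ solve 0 (:1 :* (:1 :* :1) := :1) refl ⟩
    1#  ∎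

  -- `P` appends the last factor of a rising product. Here the first factor θ w is split off, and
  -- the remaining product starts at 1 + w.
  P-front : ∀ θ w n → P θ (θ * w) (suc n) ≈ (θ * w) * inv n * P θ (θ * (1# + w)) n
  P-front θ w zero    = solve 3 (λ t w r → :1 :* ((t :* w :+ :0 :* t) :* r) := (t :* w) :* r :* :1) refl θ w (inv 0)
  P-front θ w (suc n) = trans (*-congʳ (P-front θ w n))
    (solve 6 (λ t w r s i p → ((t :* w) :* r :* p) :* ((t :* w :+ (:1 :+ i) :* t) :* s)
      := (t :* w) :* s :* (p :* ((t :* (:1 :+ w) :+ i :* t) :* r))) refl θ w (inv n) (inv (suc n)) (ι n) (P θ (θ * (1# + w)) n))

  -- Coefficients of (1 - θ X) (1 - θ X)^(-(1 + y)) = (1 - θ X)^(-y).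
  P-pascal : ∀ θ y n → P θ (θ * (1# + y)) (suc n) ≈ P θ (θ * y) (suc n) + θ * P θ (θ * (1# + y)) n
  P-pascal θ y n = begin-equality
    P θ (θ * (1# + y)) (suc n)  ≈⟨ vandermonde′ (suc n) ⟨
    1# * P θ (θ * y) (suc n) + conv (P θ (θ * 1#) ∘ suc) (P θ (θ * y)) n
      ≈⟨ +-congˡ (conv-cong n (λ k → trans (P-one θ (suc k)) (*-congˡ (sym (P-one θ k)))) (λ _ → refl)) ⟩
    1# * P θ (θ * y) (suc n) + conv (λ k → θ * P θ (θ * 1#) k) (P θ (θ * y)) n
      ≈⟨ +-cong (*-identityˡ _) (trans (conv-scaleˡ n θ _ _) (*-congˡ (vandermonde′ n))) ⟩
    P θ (θ * y) (suc n) + θ * P θ (θ * (1# + y)) n  ∎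
    where
    vandermonde′ : ∀ n → conv (P θ (θ * 1#)) (P θ (θ * y)) n ≈ P θ (θ * (1# + y)) n
    vandermonde′ n = trans (vandermonde θ _ _ n) (P-cong refl (sym (distribˡ θ 1# y)) n)

  -- The sum of the identities `P-pascal`; the last term is what the truncation leaves over.
  T-shift : ∀ θ y n → T θ y (suc n) ≈ (1# - θ) * T θ (1# + y) n + P θ (θ * (1# + y)) n
  T-shift θ y zero    = solve 1 (λ t → :1 :+ :0 := (:1 :- t) :* :0 :+ :1) refl θ
  T-shift θ y (suc n) = begin-equality
    T θ y (suc (suc n))  ≈⟨ ∑-last (suc n) (P θ (θ * y)) ⟩
    T θ y (suc n) + z  ≈⟨ +-congʳ (T-shift θ y n) ⟩
    (1# - θ) * T θ (1# + y) n + x n + z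
      ≈⟨ solve 4 (λ t s x z → (:1 :- t) :* s :+ x :+ z := (:1 :- t) :* (s :+ x) :+ (z :+ t :* x)) refl θ (T θ (1# + y) n) (x n) z ⟩
    (1# - θ) * (T θ (1# + y) n + x n) + (z + θ * x n)  ≈⟨ +-cong (*-congˡ (∑-last n x)) (P-pascal θ y n) ⟨
    (1# - θ) * T θ (1# + y) (suc n) + x (suc n)  ∎
    where
    x = P θ (θ * (1# + y))
    z = P θ (θ * y) (suc n)

  0<1+y : ∀ {y} → 0# ≤ y → 0# < 1# + y
  0<1+y = +-pos-nonneg 0<1

  -- 1 / ((y + 1) ⋯ (y + n)).
  ρ : ∀ y → 0# ≤ y → ℕ → Carrier
  ρ y 0≤y zero    = 1#
  ρ y 0≤y (suc n) = reciprocal (1# + y) (0<1+y 0≤y) * ρ (1# + y) (<⇒≤ (0<1+y 0≤y)) n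

  0<ρ : ∀ y 0≤y n → 0# < ρ y 0≤y n
  0<ρ y 0≤y zero    = 0<1
  0<ρ y 0≤y (suc n) = *-pos (0<reciprocal _ (0<1+y 0≤y)) (0<ρ _ _ n)

  -- P θ (θ (1 + y)) n is θ^n (y + 1) ⋯ (y + n) / n!, and `ρ` cancels the rising product.
  ρ-P : ∀ θ y 0≤y n → ρ y 0≤y n * P θ (θ * (1# + y)) n ≈ P 0# θ n
  ρ-P θ y 0≤y zero    = *-identityˡ 1#
  ρ-P θ y 0≤y (suc n) = begin-equality
    (κ * ρ′) * P θ (θ * (1# + y)) (suc n)  ≈⟨ *-congˡ (P-front θ (1# + y) n) ⟩
    (κ * ρ′) * ((θ * (1# + y)) * inv n * P θ (θ * (1# + (1# + y))) n)
      ≈⟨ solve 6 (λ k r t y i p → (k :* r) :* ((t :* y) :* i :* p) := (y :* k) :* (t :* i) :* (r :* p)) refl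
           κ ρ′ θ (1# + y) (inv n) (P θ (θ * (1# + (1# + y))) n) ⟩
    ((1# + y) * κ) * (θ * inv n) * (ρ′ * P θ (θ * (1# + (1# + y))) n)
      ≈⟨ *-cong (*-congʳ (reciprocal-inverse _ (0<1+y 0≤y))) (ρ-P θ (1# + y) _ n) ⟩
    1# * (θ * inv n) * P 0# θ n
      ≈⟨ solve 4 (λ t i j p → :1 :* (t :* i) :* p := p :* ((t :+ j :* :0) :* i)) refl θ (inv n) (ι n) (P 0# θ n) ⟩
    P 0# θ (suc n)  ∎
    where
    κ = reciprocal (1# + y) (0<1+y 0≤y)
    ρ′ = ρ (1# + y) (<⇒≤ (0<1+y 0≤y)) n

  -- Peeling ρ from the front replaces y by y + 1; T-shift is the same step for
  -- the binomial series.
  conv-ρ : ∀ {β q} → β * (1# - q) ≈ 1# → ∀ y 0≤y n →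
    conv (P 0# (β * q)) (ρ y 0≤y) n ≈ ρ y 0≤y n * (β ^ n * T q y (suc n))
  conv-ρ βp≈1 y 0≤y zero = solve 0 (:1 :* :1 := :1 :* (:1 :* (:1 :+ :0))) refl
  conv-ρ {β} {q} βp≈1 y 0≤y (suc n) = begin-equality
    conv (P 0# (β * q)) (ρ y 0≤y) (suc n)  ≈⟨ conv-last n _ _ ⟩
    conv (P 0# (β * q)) (λ k → κ * ρ′ k) n + P 0# (β * q) (suc n) * 1#
      ≈⟨ +-cong (trans (conv-scaleʳ n κ _ _) (*-congˡ (conv-ρ βp≈1 (1# + y) _ n)))
           (trans (*-identityʳ _) (trans (P-0-dilate β q (suc n)) (*-congˡ (sym (ρ-P q y 0≤y (suc n)))))) ⟩
    κ * (ρ′ n * (β ^ n * T q (1# + y) (suc n))) + β ^ suc n * ((κ * ρ′ n) * x)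
      ≈⟨ +-congʳ (*-identityˡ _) ⟨
    1# * (κ * (ρ′ n * (β ^ n * T q (1# + y) (suc n)))) + β ^ suc n * ((κ * ρ′ n) * x)
      ≈⟨ +-congʳ (*-congʳ βp≈1) ⟨
    (β * (1# - q)) * (κ * (ρ′ n * (β ^ n * T q (1# + y) (suc n)))) + β ^ suc n * ((κ * ρ′ n) * x)
      ≈⟨ solve 7 (λ b q k r p s x → (b :* (:1 :- q)) :* (k :* (r :* (p :* s))) :+ (b :* p) :* ((k :* r) :* x)
           := (k :* r) :* ((b :* p) :* ((:1 :- q) :* s :+ x))) refl β q κ (ρ′ n) (β ^ n) (T q (1# + y) (suc n)) x ⟩
    (κ * ρ′ n) * (β ^ suc n * ((1# - q) * T q (1# + y) (suc n) + x))
      ≈⟨ *-congˡ (*-congˡ (T-shift q y (suc n))) ⟨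
    ρ y 0≤y (suc n) * (β ^ suc n * T q y (suc (suc n)))  ∎
    where
    κ = reciprocal (1# + y) (0<1+y 0≤y)
    ρ′ = ρ (1# + y) (<⇒≤ (0<1+y 0≤y))
    x = P q (q * (1# + y)) (suc n)

  glue : ℕ → (ℕ → Carrier) → (ℕ → Carrier) → ℕ → Carrier
  glue zero    u v k       = v k
  glue (suc K) u v zero    = u 0
  glue (suc K) u v (suc k) = glue K (u ∘ suc) v k

  glue-elim : ∀ {ℓ} (Q : ℕ → Carrier → Set ℓ) K {u v} →
    (∀ k → k ℕ.< K → Q k (u k)) → (∀ l → Q (K ℕ.+ l) (v l)) → ∀ k → Q k (glue K u v k)
  glue-elim Q zero    Qu Qv k       = Qv k
  glue-elim Q (suc K) Qu Qv zero    = Qu 0 (ℕ.s≤s ℕ.z≤n)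
  glue-elim Q (suc K) Qu Qv (suc k) = glue-elim (Q ∘ suc) K (λ k k<K → Qu (suc k) (ℕ.s≤s k<K)) Qv k

  glue-< : ∀ {K k} u v → k ℕ.< K → glue K u v k ≡ u k
  glue-< {suc K} {zero}  u v _            = ≡.refl
  glue-< {suc K} {suc k} u v (ℕ.s≤s k<K) = glue-< (u ∘ suc) v k<K

  glue-+ : ∀ K l u v → glue K u v (K ℕ.+ l) ≡ v l
  glue-+ zero    l u v = ≡.refl
  glue-+ (suc K) l u v = glue-+ K l (u ∘ suc) v

  zeros : ℕ → Carrier
  zeros _ = 0#

  -- Separates the indices below K from the rest. The factor 1 fits the shape of `conv-linearʳ`.
  glue-sum : ∀ K u v k → glue K u v k ≈ 1# * glue K u zeros k + glue K zeros v k
  glue-sum zero    u v k       = solve 1 (λ v → v := :1 :* :0 :+ v) refl (v k)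
  glue-sum (suc K) u v zero    = solve 1 (λ u → u := :1 :* u :+ :0) refl (u 0)
  glue-sum (suc K) u v (suc k) = glue-sum K (u ∘ suc) v k

  conv-glue : ∀ K n x v → conv x (glue K zeros v) (K ℕ.+ n) ≈ conv x v n
  conv-glue zero    n x v = refl
  conv-glue (suc K) n x v = trans (conv-last (K ℕ.+ n) x _)
    (trans (+-cong (conv-glue K n x v) (zeroʳ _)) (+-identityʳ _))

  module Base (d : ℕ) where

    -- Since inv n = 1 / (n + 1), p = 1/b, h = 1/2 and θ = 1 - 1/(4b).
    b = suc (suc d)
    β p q t h θ τ s : Carrier
    β = ι b
    p = inv (suc d)
    q = 1# - p
    t = ι (suc d)
    h = inv 1
    θ = 1# - p * inv 3
    τ = ι 4 * β
    s = t + h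

    0≤β = ι-nonneg b

    1≤β : 1# ≤ β
    1≤β = x≤x+y (ι-nonneg (suc d))

    βp≈1 : β * p ≈ 1#
    βp≈1 = inv-inverse (suc d)

    βp≈1′ : β * (1# - q) ≈ 1#
    βp≈1′ = trans (solve 2 (λ b p → b :* (:1 :- (:1 :- p)) := b :* p) refl β p) βp≈1

    0≤q : 0# ≤ q
    0≤q = x≤y⇒0≤y-x (inv≤1 (suc d))

    βq≈t : β * q ≈ t
    βq≈t = begin-equality
      β * (1# - p)  ≈⟨ solve 2 (λ b p → b :* (:1 :- p) := b :- b :* p) refl β p ⟩
      β - β * p  ≈⟨ +-congˡ (-‿cong βp≈1) ⟩
      (1# + t) - 1#  ≈⟨ solve 1 (λ t → (:1 :+ t) :- :1 := t) refl t ⟩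
      t  ∎

    h+h≈1 : h + h ≈ 1#
    h+h≈1 = trans (solve 1 (λ h → h :+ h := (:1 :+ (:1 :+ :0)) :* h) refl h) (inv-inverse 1)

    0<h = 0<inv 1

    4inv3 : ι 4 * inv 3 ≈ 1#
    4inv3 = inv-inverse 3

    0≤θ : 0# ≤ θ
    0≤θ = x≤y⇒0≤y-x (≤-trans (*-mono-≤ 0≤1 (<⇒≤ (0<inv 3)) (inv≤1 (suc d)) (inv≤1 3)) (≤-reflexive (*-identityˡ 1#)))

    0<τ : 0# < τ
    0<τ = *-pos (0<ι-suc 3) (0<ι-suc (suc d))

    1-θ : (1# - θ) * τ ≈ 1#
    1-θ = begin-equality
      (1# - (1# - p * inv 3)) * (ι 4 * β)  ≈⟨ solve 4 (λ p r f b → (:1 :- (:1 :- p :* r)) :* (f :* b) := (b :* p) :* (f :* r)) refl p (inv 3) (ι 4) β ⟩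
      (β * p) * (ι 4 * inv 3)  ≈⟨ *-cong βp≈1 4inv3 ⟩
      1# * 1#  ≈⟨ *-identityˡ 1# ⟩
      1#  ∎

    βθ≈ : β * θ ≈ β - inv 3
    βθ≈ = begin-equality
      β * (1# - p * inv 3)  ≈⟨ solve 3 (λ b p r → b :* (:1 :- p :* r) := b :- (b :* p) :* r) refl β p (inv 3) ⟩
      β - (β * p) * inv 3  ≈⟨ +-congˡ (-‿cong (trans (*-congʳ βp≈1) (*-identityˡ _))) ⟩
      β - inv 3  ∎

    1≤βθ : 1# ≤ β * θ
    1≤βθ = begin
      1#  ≤⟨ x≤x+y (+-nonneg (x≤y⇒0≤y-x (inv≤1 3)) (ι-nonneg d)) ⟩
      1# + ((1# - inv 3) + ι d)  ≈⟨ solve 2 (λ r d → :1 :+ ((:1 :- r) :+ d) := (:1 :+ (:1 :+ d)) :- r) refl (inv 3) (ι d) ⟩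
      β - inv 3  ≈⟨ βθ≈ ⟨
      β * θ  ∎

    -- This inequality dictates θ: b θ² = b - 1/2 + 1/(16 b), while s = b - 1/2. The surplus is p r²
    -- with r = 1/4.
    s≤βθθ : s ≤ (β * θ) * θ
    s≤βθθ = 0≤d⇒x≤y (*-nonneg (<⇒≤ (0<inv (suc d))) (*-nonneg 0≤r 0≤r)) (begin-equality
      (t + h) + p * (r * r)  ≈⟨ solve 3 (λ t h e → (t :+ h) :+ e := (:1 :+ t) :- (:1 :- h) :+ e) refl t h (p * (r * r)) ⟩
      β - (1# - h) + p * (r * r)  ≈⟨ +-congʳ (+-congˡ (-‿cong 1-h≈r+r)) ⟩
      β - (r + r) + p * (r * r)  ≈⟨ solve 3 (λ b r e → b :- (r :+ r) :+ e := b :- (:1 :* r :+ :1 :* r) :+ :1 :* e) refl β r (p * (r * r)) ⟩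
      β - (1# * r + 1# * r) + 1# * (p * (r * r))
        ≈⟨ +-cong (+-congˡ (-‿cong (+-cong (*-congʳ βp≈1) (*-congʳ βp≈1)))) (*-congʳ βp≈1) ⟨
      β - ((β * p) * r + (β * p) * r) + (β * p) * (p * (r * r))
        ≈⟨ solve 3 (λ b p r → b :- ((b :* p) :* r :+ (b :* p) :* r) :+ (b :* p) :* (p :* (r :* r))
             := (b :* (:1 :- p :* r)) :* (:1 :- p :* r)) refl β p r ⟩
      (β * θ) * θ  ∎)
      where
      r = inv 3
      0≤r = <⇒≤ (0<inv 3)
      1-h≈r+r : 1# - h ≈ r + r
      1-h≈r+r = begin-equality
        1# - h  ≈⟨ +-congʳ h+h≈1 ⟨
        (h + h) - h  ≈⟨ solve 1 (λ h → (h :+ h) :- h := h :* :1) refl h ⟩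
        h * 1#  ≈⟨ *-congˡ 4inv3 ⟨
        h * (ι 4 * r)  ≈⟨ solve 2 (λ h r → h :* ((:1 :+ (:1 :+ (:1 :+ (:1 :+ :0)))) :* r) := (h :+ h) :* (r :+ r)) refl h r ⟩
        (h + h) * (r + r)  ≈⟨ trans (*-congʳ h+h≈1) (*-identityˡ _) ⟩
        r + r  ∎

    -- Majorant of the normalised power sums after division by Λ^n: t^n / n! comes from the largest
    -- digit, the second term from at most b smaller ones.
    ε : ℕ → Carrier
    ε n = P 0# t n + β * P 0# (ι d) n

    -- The bracket collects the factors of `error₁` and `error₂`; the rest is the constant of
    -- `tail≤`.
    W : ℕ → ℕ → Carrier
    W K r = (2# ^ K + β * reciprocal (P 0# h K) (P-0-pos 0<h K)) * (P 0# s K * τ ^ r)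

    module _ (K : ℕ) (y : Carrier) (0≤y : 0# ≤ y) where

      -- The supersolution without its powers of Λ. Below K, where the recurrence may be singular,
      -- it is 1 / k!, and the moments are bounded there by other means.
      gauge : ℕ → Carrier
      gauge = glue K (P 0# 1#) (ρ y 0≤y)

      0<gauge : ∀ k → 0# < gauge k
      0<gauge = glue-elim (λ _ x → 0# < x) K (λ k _ → P-0-pos 0<1 k) (0<ρ y 0≤y)

      gauge-nonneg : ∀ k → 0# ≤ gauge k
      gauge-nonneg k = <⇒≤ (0<gauge k)

      private
        0≤s : 0# ≤ s
        0≤s = +-nonneg (ι-nonneg (suc d)) (<⇒≤ 0<h)

        -- Below K one has 1 / k! ≤ 2^K (1/2)^k / k!. The exponents then add up to t + 1/2 = s,
        -- still less than b.
        error₁ : ∀ n → conv (P 0# t) (glue K (P 0# 1#) zeros) n ≤ 2# ^ K * P 0# s n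
        error₁ n = begin
          conv (P 0# t) (glue K (P 0# 1#) zeros) n  ≤⟨ conv-monoʳ n (P-nonneg ≤-refl (ι-nonneg (suc d))) head≤ ⟩
          conv (P 0# t) (λ k → 2# ^ K * P 0# h k) n  ≈⟨ conv-scaleʳ n _ _ _ ⟩
          2# ^ K * conv (P 0# t) (P 0# h) n  ≈⟨ *-congˡ (vandermonde 0# t h n) ⟩
          2# ^ K * P 0# s n  ∎
          where
          0≤2 = <⇒≤ 0<2
          1≤2 : 1# ≤ 2#
          1≤2 = x≤x+y 0≤1
          0≤Ph = P-nonneg ≤-refl (<⇒≤ 0<h)
          ^-mono-exponent : ∀ {m n} → m ℕ.≤ n → 2# ^ m ≤ 2# ^ n
          ^-mono-exponent {n = n} ℕ.z≤n = 1≤^ 1≤2 n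
          ^-mono-exponent (ℕ.s≤s m≤n)   = *-monoʳ-≤ 0≤2 (^-mono-exponent m≤n)
          head≤ : ∀ k → glue K (P 0# 1#) zeros k ≤ 2# ^ K * P 0# h k
          head≤ = glue-elim (λ k x → x ≤ 2# ^ K * P 0# h k) K
            (λ k k<K → begin
              P 0# 1# k  ≈⟨ P-cong refl (trans (solve 1 (λ h → (:1 :+ :1) :* h := h :+ h) refl h) h+h≈1) k ⟨
              P 0# (2# * h) k  ≈⟨ P-0-dilate 2# h k ⟩
              2# ^ k * P 0# h k  ≤⟨ *-monoˡ-≤ (0≤Ph k) (^-mono-exponent (ℕ.<⇒≤ k<K)) ⟩
              2# ^ K * P 0# h k  ∎)
            (λ l → *-nonneg (^-nonneg 0≤2 K) (0≤Ph (K ℕ.+ l)))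

        ρ≤P1 : ∀ n → ρ y 0≤y n ≤ P 0# 1# n
        ρ≤P1 n = begin
          ρ y 0≤y n  ≈⟨ *-identityʳ _ ⟨
          ρ y 0≤y n * 1#  ≤⟨ *-monoʳ-≤ (<⇒≤ (0<ρ y 0≤y n)) (≤-trans (≤-reflexive (sym (1^n≈1 n))) (≤-trans (≤-reflexive (sym (P-one 1# n))) (P-mono 0≤1 (*-nonneg 0≤1 0≤1) (*-monoʳ-≤ 0≤1 (x≤x+y 0≤y)) n))) ⟩
          ρ y 0≤y n * P 1# (1# * (1# + y)) n  ≈⟨ ρ-P 1# y 0≤y n ⟩
          P 0# 1# n  ∎

        -- The factor R is 2^K K!. At index K + l, the product h^K / K! * 1 / l! is a single term of
        -- the binomial expansion of (h + 1)^(K + l) / (K + l)!.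
        gauge≤ : ∀ k → gauge k ≤ reciprocal (P 0# h K) (P-0-pos 0<h K) * P 0# (1# + h) k
        gauge≤ = glue-elim (λ k x → x ≤ R * P 0# (1# + h) k) K
          (λ k k<K → begin
            P 0# 1# k  ≈⟨ *-identityˡ _ ⟨
            1# * P 0# 1# k  ≤⟨ *-mono-≤ (<⇒≤ 0<R) (P-nonneg ≤-refl 0≤1 k) 1≤R (P-mono ≤-refl 0≤1 (x≤x+y (<⇒≤ 0<h)) k) ⟩
            R * P 0# (1# + h) k  ∎)
          (λ l → begin
            ρ y 0≤y l  ≤⟨ ρ≤P1 l ⟩
            P 0# 1# l  ≈⟨ *-identityˡ _ ⟨
            1# * P 0# 1# l  ≈⟨ *-congʳ (reciprocal-inverse _ (P-0-pos 0<h K)) ⟨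
            (P 0# h K * R) * P 0# 1# l  ≈⟨ solve 3 (λ a r b → (a :* r) :* b := r :* (a :* b)) refl (P 0# h K) R (P 0# 1# l) ⟩
            R * (P 0# h K * P 0# 1# l)  ≤⟨ *-monoʳ-≤ (<⇒≤ 0<R) (conv-term K l (P-nonneg ≤-refl (<⇒≤ 0<h)) (P-nonneg ≤-refl 0≤1)) ⟩
            R * conv (P 0# h) (P 0# 1#) (K ℕ.+ l)  ≈⟨ *-congˡ (trans (vandermonde 0# h 1# (K ℕ.+ l)) (P-cong refl (+-comm h 1#) (K ℕ.+ l))) ⟩
            R * P 0# (1# + h) (K ℕ.+ l)  ∎)
          where
          R = reciprocal (P 0# h K) (P-0-pos 0<h K)
          0<R = 0<reciprocal _ (P-0-pos 0<h K)
          1≤R : 1# ≤ R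
          1≤R = *-cancelˡ-≤ (P-0-pos 0<h K) (begin
            P 0# h K * 1#  ≈⟨ *-identityʳ _ ⟩
            P 0# h K  ≤⟨ P-0-≤1 (<⇒≤ 0<h) (inv≤1 1) K ⟩
            1#  ≈⟨ reciprocal-inverse _ (P-0-pos 0<h K) ⟨
            P 0# h K * R  ∎)

        -- The exponents add up to d + (1 + 1/2) = s: the unit by which the smaller digits fall
        -- short leaves room for the growth in `gauge≤`.
        error₂ : ∀ n → conv (P 0# (ι d)) gauge n ≤ reciprocal (P 0# h K) (P-0-pos 0<h K) * P 0# s n
        error₂ n = begin
          conv (P 0# (ι d)) gauge n  ≤⟨ conv-monoʳ n (P-nonneg ≤-refl (ι-nonneg d)) gauge≤ ⟩
          conv (P 0# (ι d)) (λ k → R * P 0# (1# + h) k) n  ≈⟨ conv-scaleʳ n _ _ _ ⟩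
          R * conv (P 0# (ι d)) (P 0# (1# + h)) n
            ≈⟨ *-congˡ (trans (vandermonde 0# (ι d) (1# + h) n)
                 (P-cong refl (solve 2 (λ d h → d :+ (:1 :+ h) := (:1 :+ d) :+ h) refl (ι d) h) n)) ⟩
          R * P 0# s n  ∎
          where R = reciprocal (P 0# h K) (P-0-pos 0<h K)

        -- One θ in s ≤ (β θ) θ is kept as decay. The other produces θ^i / i!, which is `ρ` times
        -- one coefficient of a binomial series whose partial sums are at most τ^r.
        tail≤ : ∀ r → 1# + y ≤ ι r → ∀ i → P 0# s (K ℕ.+ i) ≤ (P 0# s K * τ ^ r) * ((β * θ) ^ (K ℕ.+ i) * ρ y 0≤y i)
        tail≤ r y≤r i = begin
          P 0# s (K ℕ.+ i)  ≤⟨ P-0-split 0≤s K i ⟩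
          P 0# s K * P 0# s i  ≤⟨ *-monoʳ-≤ (P-nonneg ≤-refl 0≤s K) (begin
            P 0# s i  ≤⟨ P-mono ≤-refl 0≤s s≤βθθ i ⟩
            P 0# ((β * θ) * θ) i  ≈⟨ P-0-dilate (β * θ) θ i ⟩
            (β * θ) ^ i * P 0# θ i  ≤⟨ *-mono-≤ (^-nonneg 0≤βθ (K ℕ.+ i)) (P-nonneg ≤-refl 0≤θ i) βθ^ Pθ≤ ⟩
            (β * θ) ^ (K ℕ.+ i) * (τ ^ r * ρ y 0≤y i)  ∎) ⟩
          P 0# s K * ((β * θ) ^ (K ℕ.+ i) * (τ ^ r * ρ y 0≤y i))
            ≈⟨ solve 4 (λ a b c d → a :* (b :* (c :* d)) := (a :* c) :* (b :* d)) refl (P 0# s K) ((β * θ) ^ (K ℕ.+ i)) (τ ^ r) (ρ y 0≤y i) ⟩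
          (P 0# s K * τ ^ r) * ((β * θ) ^ (K ℕ.+ i) * ρ y 0≤y i) ∎
          where
          0≤βθ = ≤-trans 0≤1 1≤βθ
          βθ^ : (β * θ) ^ i ≤ (β * θ) ^ (K ℕ.+ i)
          βθ^ = begin
            (β * θ) ^ i  ≈⟨ *-identityˡ _ ⟨
            1# * (β * θ) ^ i  ≤⟨ *-monoˡ-≤ (^-nonneg 0≤βθ i) (1≤^ 1≤βθ K) ⟩
            (β * θ) ^ K * (β * θ) ^ i  ≈⟨ ^-homo-* (β * θ) K i ⟨
            (β * θ) ^ (K ℕ.+ i)  ∎
          0≤1+y = <⇒≤ (0<1+y 0≤y)
          Pθ≤ : P 0# θ i ≤ τ ^ r * ρ y 0≤y i
          Pθ≤ = begin
            P 0# θ i  ≈⟨ ρ-P θ y 0≤y i ⟨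
            ρ y 0≤y i * P θ (θ * (1# + y)) i  ≤⟨ *-monoʳ-≤ (<⇒≤ (0<ρ y 0≤y i)) (begin
              P θ (θ * (1# + y)) i  ≤⟨ x≤y+x (∑-nonneg i (P-nonneg 0≤θ (*-nonneg 0≤θ 0≤1+y))) ⟩
              T θ (1# + y) i + P θ (θ * (1# + y)) i  ≈⟨ ∑-last i (P θ (θ * (1# + y))) ⟨
              T θ (1# + y) (suc i)  ≤⟨ T-mono 0≤θ 0≤1+y y≤r (suc i) ⟩
              T θ (ι r) (suc i)  ≤⟨ T-ℕ 0≤θ 0<τ 1-θ r (suc i) ⟩
              τ ^ r  ∎) ⟩
            ρ y 0≤y i * τ ^ r  ≈⟨ *-comm _ _ ⟩
            τ ^ r * ρ y 0≤y i  ∎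

      -- The main term t^j / j! against the part of `gauge` from K on is evaluated exactly by
      -- `conv-ρ`, and Φ will be b^y. All other contributions carry the factor θ^(K + i).
      gauge-supersolution : ∀ r Φ → 1# + y ≤ ι r → (∀ n → T q y n ≤ Φ) → ∀ i →
        conv ε gauge (K ℕ.+ i) ≤ (β ^ i * Φ + W K r * (β * θ) ^ (K ℕ.+ i)) * ρ y 0≤y i
      gauge-supersolution r Φ y≤r T≤Φ i = begin
        conv ε gauge m
          ≈⟨ conv-cong m (λ k → solve 2 (λ a b → a :+ b := b :+ a) refl (P 0# t k) (β * P 0# (ι d) k)) (λ _ → refl) ⟩
        conv (λ k → β * P 0# (ι d) k + P 0# t k) gauge m
          ≈⟨ conv-linearˡ m β _ _ gauge ⟩
        β * conv (P 0# (ι d)) gauge m + conv (P 0# t) gauge m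
          ≈⟨ +-congˡ (trans (conv-cong m (λ _ → refl) (glue-sum K _ _)) (conv-linearʳ m 1# _ _ _)) ⟩
        β * conv (P 0# (ι d)) gauge m + (1# * conv (P 0# t) (glue K (P 0# 1#) zeros) m + conv (P 0# t) (glue K zeros (ρ y 0≤y)) m)
          ≤⟨ +-mono-≤ (*-monoʳ-≤ 0≤β (error₂ m)) (+-mono-≤ (≤-trans (≤-reflexive (*-identityˡ _)) (error₁ m)) main≤) ⟩
        β * (R * P 0# s m) + (2# ^ K * P 0# s m + ρ y 0≤y i * (β ^ i * Φ))
          ≈⟨ solve 6 (λ b r p k x z → b :* (r :* p) :+ (k :* p :+ x :* z) := (k :+ b :* r) :* p :+ z :* x) refl
               β R (P 0# s m) (2# ^ K) (ρ y 0≤y i) (β ^ i * Φ) ⟩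
        (2# ^ K + β * R) * P 0# s m + (β ^ i * Φ) * ρ y 0≤y i
          ≤⟨ +-monoˡ-≤ _ (*-monoʳ-≤ (+-nonneg (^-nonneg (<⇒≤ 0<2) K) (*-nonneg 0≤β (<⇒≤ (0<reciprocal _ (P-0-pos 0<h K))))) (tail≤ r y≤r i)) ⟩
        (2# ^ K + β * R) * ((P 0# s K * τ ^ r) * ((β * θ) ^ m * ρ y 0≤y i)) + (β ^ i * Φ) * ρ y 0≤y i
          ≈⟨ solve 5 (λ w v z x u → w :* (v :* (z :* x)) :+ u :* x := (u :+ (w :* v) :* z) :* x) refl
               (2# ^ K + β * R) (P 0# s K * τ ^ r) ((β * θ) ^ m) (ρ y 0≤y i) (β ^ i * Φ) ⟩
        (β ^ i * Φ + W K r * (β * θ) ^ m) * ρ y 0≤y i ∎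
        where
        m = K ℕ.+ i
        R = reciprocal (P 0# h K) (P-0-pos 0<h K)
        main≤ : conv (P 0# t) (glue K zeros (ρ y 0≤y)) m ≤ ρ y 0≤y i * (β ^ i * Φ)
        main≤ = begin
          conv (P 0# t) (glue K zeros (ρ y 0≤y)) m  ≈⟨ conv-glue K i (P 0# t) (ρ y 0≤y) ⟩
          conv (P 0# t) (ρ y 0≤y) i  ≈⟨ conv-cong i (P-cong refl (sym βq≈t)) (λ _ → refl) ⟩
          conv (P 0# (β * q)) (ρ y 0≤y) i  ≈⟨ conv-ρ βp≈1′ y 0≤y i ⟩
          ρ y 0≤y i * (β ^ i * T q y (suc i))  ≤⟨ *-monoʳ-≤ (<⇒≤ (0<ρ y 0≤y i)) (*-monoʳ-≤ (^-nonneg 0≤β i) (T≤Φ (suc i))) ⟩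
          ρ y 0≤y i * (β ^ i * Φ)  ∎

-- Binomial coefficients and power sums of digits.

C-factorial : ∀ {n k} → k ℕ.≤ n → (n choose k) ℕ.* (k ! ℕ.* (n ℕ.∸ k) !) ≡ n !
C-factorial {n} {k} k≤n =
  ≡.trans (≡.cong (ℕ._* (k ! ℕ.* (n ℕ.∸ k) !)) (nCk≡n!/k![n-k]! k≤n)) (m/n*n≡m {{k ℕ.!* (n ℕ.∸ k) !≢0}} (k![n∸k]!∣n! k≤n))

power-sum : ℕ → List ℕ → ℕ
power-sum j xs = ListAction.sum (map (ℕ._^ j) xs)

power-sum-≤ : ∀ j n xs → All (ℕ._≤ n) xs → power-sum j xs ℕ.≤ length xs ℕ.* n ℕ.^ j
power-sum-≤ j n [] []              = ℕ.z≤n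
power-sum-≤ j n (x ∷ xs) (x≤n ∷ xs≤n) = ℕ.+-mono-≤ (ℕ.^-monoˡ-≤ j x≤n) (power-sum-≤ j n xs xs≤n)

-- Distinctness keeps the coefficient of the leading power at 1, on which the comparison with
-- b^(s+m) depends: the value suc n occurs at most once, and all other entries are at most n.
power-sum-unique : ∀ j n xs → Unique xs → All (ℕ._≤ suc n) xs →
  power-sum j xs ℕ.≤ suc n ℕ.^ j ℕ.+ length xs ℕ.* n ℕ.^ j
power-sum-unique j n [] _ _ = ℕ.z≤n
power-sum-unique j n (x ∷ xs) (x∉xs ∷ unique) (x≤n ∷ xs≤n) with x ℕ.≟ suc n
-- Here x is the largest value, and the n^j allotted to it by `length` is left over.
... | yes ≡.refl = ℕ.+-monoʳ-≤ (suc n ℕ.^ j)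
        (ℕ.≤-trans (power-sum-≤ j n xs (All.zipWith (λ (x≢y , y≤n) → ℕ.s≤s⁻¹ (ℕ.≤∧≢⇒< y≤n (x≢y ∘ ≡.sym))) (x∉xs , xs≤n)))
                   (ℕ.m≤n+m _ (n ℕ.^ j)))
... | no x≢ = begin
        x ℕ.^ j ℕ.+ power-sum j xs
          ≤⟨ ℕ.+-mono-≤ (ℕ.^-monoˡ-≤ j (ℕ.s≤s⁻¹ (ℕ.≤∧≢⇒< x≤n x≢))) (power-sum-unique j n xs unique xs≤n) ⟩
        n ℕ.^ j ℕ.+ (suc n ℕ.^ j ℕ.+ length xs ℕ.* n ℕ.^ j)  ≡⟨ ℕ.+-assoc (n ℕ.^ j) _ _ ⟨
        n ℕ.^ j ℕ.+ suc n ℕ.^ j ℕ.+ length xs ℕ.* n ℕ.^ j  ≡⟨ ≡.cong (ℕ._+ length xs ℕ.* n ℕ.^ j) (ℕ.+-comm (n ℕ.^ j) _) ⟩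
        suc n ℕ.^ j ℕ.+ n ℕ.^ j ℕ.+ length xs ℕ.* n ℕ.^ j  ≡⟨ ℕ.+-assoc (suc n ℕ.^ j) _ _ ⟩
        suc n ℕ.^ j ℕ.+ length (x ∷ xs) ℕ.* n ℕ.^ j  ∎
        where
        open ℕ.≤-Reasoning

module DigitBounds {b : ℕ} (A : Subset b) where

  open Digits A

  f<b : .{{_ : NonZero b}} → f ℕ.< b
  f<b = ℕ.≤-<-trans
    (Extrema.max≤v⁺ {v = ℕ.pred b} ℕ.z≤n
      (All.map⁺ (All.universal (λ a → ℕ.s≤s⁻¹ (≡.subst (suc (toℕ a) ℕ.≤_) (≡.sym (ℕ.suc-pred b)) (Fin.toℕ<n a))) (filter (_∈? A) (allFin b)))))
    (ℕ.≤-reflexive (ℕ.suc-pred b))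

  0<f : ∃[ a ] a ∈ A × toℕ a ≢ 0 → 0 ℕ.< f
  0<f (a , a∈A , a≢0) = ℕ.<-≤-trans (ℕ.n≢0⇒n>0 a≢0)
    (All.lookup (Extrema.xs≤max 0 elements)
      (Membership.∈-map⁺ toℕ (Membership.∈-filter⁺ (_∈? A) (Membership.∈-allFin a) a∈A)))

  γ≤ : ∀ j → 0 ℕ.< f → γ j ℕ.≤ f ℕ.^ j ℕ.+ b ℕ.* ℕ.pred f ℕ.^ j
  γ≤ j 0<f = ℕ.≤-trans
    (≡.subst (λ f → γ j ℕ.≤ f ℕ.^ j ℕ.+ length elements ℕ.* ℕ.pred f ℕ.^ j) f≡
      (power-sum-unique j (ℕ.pred f) elements
        (Unique.map⁺ Fin.toℕ-injective (Unique.filter⁺ (_∈? A) (Unique.allFin⁺ b)))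
        (≡.subst (λ f → All (ℕ._≤ f) elements) (≡.sym f≡) (Extrema.xs≤max 0 elements))))
    (ℕ.+-monoʳ-≤ (f ℕ.^ j) (ℕ.*-monoˡ-≤ (ℕ.pred f ℕ.^ j) length≤))
    where
    f≡ : suc (ℕ.pred f) ≡ f
    f≡ = ℕ.suc-pred f {{ℕ.>-nonZero 0<f}}
    length≤ : length elements ℕ.≤ b
    length≤ = ℕ.≤-trans (ℕ.≤-reflexive (List.length-map toℕ (filter (_∈? A) (allFin b))))
      (ℕ.≤-trans (List.length-filter (_∈? A) (allFin b)) (ℕ.≤-reflexive (List.length-tabulate {n = b} (λ i → i))))

-- Finite products and complex inverses.

module Growth {c ℓ₁ ℓ₂} (ℛ : CompleteOrderedField c ℓ₁ ℓ₂)
  (exp : Analysis.ℂ ℛ → Analysis.ℂ ℛ) (isExp : Analysis.IsExp ℛ exp) where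

  open Limits ℛ public
  open Exponential exp isExp public

  ∏-nonneg : ∀ n {x} → (∀ k → 0# ≤ x k) → 0# ≤ ∏ n x
  ∏-nonneg zero    0≤x = 0≤1
  ∏-nonneg (suc n) 0≤x = *-nonneg (0≤x 0) (∏-nonneg n (0≤x ∘ suc))

  ∏-mono-length : ∀ {m n} x → (∀ k → 1# ≤ x k) → m ℕ.≤ n → ∏ m x ≤ ∏ n x
  ∏-mono-length {n = zero}  x 1≤x ℕ.z≤n = ≤-refl
  ∏-mono-length {n = suc n} x 1≤x ℕ.z≤n = begin
    1#  ≈⟨ *-identityˡ 1# ⟨
    1# * 1#  ≤⟨ *-mono-≤ (≤-trans 0≤1 (1≤x 0)) 0≤1 (1≤x 0) (∏-mono-length {n = n} (x ∘ suc) (1≤x ∘ suc) ℕ.z≤n) ⟩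
    x 0 * ∏ n (x ∘ suc)  ∎
  ∏-mono-length x 1≤x (ℕ.s≤s m≤n) = *-monoʳ-≤ (≤-trans 0≤1 (1≤x 0)) (∏-mono-length (x ∘ suc) (1≤x ∘ suc) m≤n)

  ∏-exp : ∀ n {x} → (∀ k → 0# ≤ x k) → ∏ n (λ k → 1# + x k) ≤ e (∑ n x)
  ∏-exp zero    0≤x = ≤-reflexive (sym e-0)
  ∏-exp (suc n) {x} 0≤x = begin
    (1# + x 0) * ∏ n (λ k → 1# + x (suc k))
      ≤⟨ *-mono-≤ (<⇒≤ (0<e (x 0))) (∏-nonneg n (λ k → +-nonneg 0≤1 (0≤x (suc k)))) (1+x≤e (0≤x 0)) (∏-exp n (0≤x ∘ suc)) ⟩
    e (x 0) * e (∑ n (x ∘ suc))  ≈⟨ e-+ _ _ ⟨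
    e (∑ (suc n) x)  ∎

  -- By 1 + x ≤ e^x, perturbations of relative size θ^k accumulate to a bounded factor. This serves
  -- both the partial products of α and the main induction.
  ∏-geometric : ∀ {κ θ τ} → 0# ≤ κ → 0# ≤ θ → 0# < τ → (1# - θ) * τ ≈ 1# →
    ∀ n → ∏ n (λ k → 1# + κ * θ ^ k) ≤ e (κ * τ)
  ∏-geometric {κ} {θ} {τ} 0≤κ 0≤θ 0<τ eq n = begin
    ∏ n (λ k → 1# + κ * θ ^ k)  ≤⟨ ∏-exp n (λ k → *-nonneg 0≤κ (^-nonneg 0≤θ k)) ⟩
    e (∑ n (λ k → κ * θ ^ k))  ≤⟨ e-mono (≤-trans (≤-reflexive (∑-scale n κ (θ ^_))) (*-monoʳ-≤ 0≤κ (geometric 0≤θ 0<τ eq n))) ⟩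
    e (κ * τ)  ∎

  ∣∣-∏ : ∀ n {x r} → (∀ k → k ℕ.< n → ∣ x k ∣≤ r k) → ∣ S.∏ n x ∣≤ ∏ n r
  ∣∣-∏ zero    x≤ = ∣1∣≤1
  ∣∣-∏ (suc n) x≤ = ∣∣-* (x≤ 0 (ℕ.s≤s ℕ.z≤n)) (∣∣-∏ n (λ k k<n → x≤ (suc k) (ℕ.s≤s k<n)))

  inverse-inverse : ∀ z z≠0 → z *ᶜ inverse z z≠0 ≈ᶜ 1ᶜ
  inverse-inverse z@(a +i b) z≠0 =
    trans (solve 3 (λ a b r → a :* (a :* r) :- b :* (:- b :* r) := (a :* a :+ b :* b) :* r) refl a b _) (reciprocal-inverse _ z≠0) ,
    solve 3 (λ a b r → a :* (:- b :* r) :+ b :* (a :* r) := :0) refl a b _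

base-power : ∀ {c ℓ₁ ℓ₂} (ℛ : CompleteOrderedField c ℓ₁ ℓ₂) →
  (Analysis.ℂ ℛ → Analysis.ℂ ℛ) → CompleteOrderedField.Carrier ℛ → Analysis.ℂ ℛ → Analysis.ℂ ℛ
base-power ℛ exp L s = exp (Analysis._*_ ℛ s (Analysis.real ℛ L))

IsLog : ∀ {c ℓ₁ ℓ₂} (ℛ : CompleteOrderedField c ℓ₁ ℓ₂) →
  (Analysis.ℂ ℛ → Analysis.ℂ ℛ) → ℕ → CompleteOrderedField.Carrier ℛ → Set ℓ₁
IsLog ℛ exp b L = Analysis._≈_ ℛ (exp (Analysis.real ℛ L)) (Analysis.nat ℛ b)

-- The recurrence for the moments and its normalisation by factorials.

module Recurrence {c ℓ₁ ℓ₂} (ℛ : CompleteOrderedField c ℓ₁ ℓ₂)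
  (exp : Analysis.ℂ ℛ → Analysis.ℂ ℛ) (isExp : Analysis.IsExp ℛ exp)
  (d : ℕ) (A : Subset (suc (suc d))) (L : CompleteOrderedField.Carrier ℛ)
  (exp-L : IsLog ℛ exp (suc (suc d)) L) where

  open Growth ℛ exp isExp public
  open Gauge ℛ public
  open Base d public
  open Digits A public
  open Analysis ℛ public using (nat)
  open Moments ℛ (base-power ℛ exp L) A public using (IsAlpha; Regular; uTable; u)

  bpow : ℂ → ℂ
  bpow = base-power ℛ exp L

  e-L : e L ≈ β
  e-L = proj₁ exp-L

  1<β : 1# < β
  1<β = 0<d⇒x<y (0<ι-suc d) refl

  0≤L : 0# ≤ L
  0≤L L<0 = 1<β′ (begin-strict
    e L  <⟨ e-mono-< L<0 ⟩
    e 0#  ≈⟨ e-0 ⟩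
    1#  ∎)
    where
    1<β′ : ¬ (e L < 1#)
    1<β′ lt = <-asym 1<β (<-respˡ-≈ e-L lt)

  φ : Carrier → Carrier
  φ x = e (x * L)

  φ-cong : ∀ {x y} → x ≈ y → φ x ≈ φ y
  φ-cong x≈y = e-cong (*-congʳ x≈y)

  φ-+ : ∀ x y → φ (x + y) ≈ φ x * φ y
  φ-+ x y = trans (e-cong (distribʳ L x y)) (e-+ _ _)

  φ-mono : ∀ {x y} → x ≤ y → φ x ≤ φ y
  φ-mono x≤y = e-mono (*-monoˡ-≤ 0≤L x≤y)

  φ-0 : φ 0# ≈ 1#
  φ-0 = trans (e-cong (zeroˡ L)) e-0

  φ-1 : φ 1# ≈ β
  φ-1 = trans (e-cong (*-identityˡ L)) e-L

  0<φ : ∀ x → 0# < φ x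
  0<φ x = 0<e (x * L)

  φ-neg : ∀ x → φ (- x) * φ x ≈ 1#
  φ-neg x = trans (sym (φ-+ _ _)) (trans (φ-cong (-‿inverseˡ x)) φ-0)

  open BinomialBound φ φ-cong φ-+ φ-mono φ-0 q 0≤q (trans (*-congˡ φ-1) (trans (*-comm _ _) βp≈1′)) public
    using (T≤φ)

  φ-ι : ∀ n → φ (ι n) ≈ β ^ n
  φ-ι zero    = φ-0
  φ-ι (suc n) = trans (φ-+ 1# (ι n)) (*-cong φ-1 (φ-ι n))

  normSq-bpow : ∀ s → normSq (bpow s) ≈ φ (re s) * φ (re s)
  normSq-bpow s = trans (normSq-exp _) (*-cong eq eq)
    where
    eq : e (re s * L - im s * 0#) ≈ φ (re s)
    eq = e-cong (solve 3 (λ a b l → a :* l :- b :* :0 := a :* l) refl (re s) (im s) L)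

  ∣bpow∣ : ∀ s → ∣ bpow s ∣≤ φ (re s)
  ∣bpow∣ s = <⇒≤ (0<φ (re s)) , ≤-reflexive (normSq-bpow s)

  bpow-inverse : ∀ s n → bpow (-ᶜ s -ᶜ nat n) *ᶜ bpow (s +ᶜ nat n) ≈ᶜ 1ᶜ
  bpow-inverse s n =
    bpow (-ᶜ s -ᶜ nat n) *ᶜ bpow (s +ᶜ nat n)  ≈ᶜ⟨ exp-+ _ _ ⟨
    exp ((-ᶜ s -ᶜ nat n) *ᶜ real L +ᶜ (s +ᶜ nat n) *ᶜ real L)
      ≈ᶜ⟨ exp-cong (CS.solve 3 (λ s n l → (CS.:- s CS.:- n) CS.:* l CS.:+ (s CS.:+ n) CS.:* l CS.:= CS.:0) reflᶜ s (nat n) (real L)) ⟩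
    exp (real 0#)  ≈ᶜ⟨ exp-real 0# ⟩
    real (e 0#)  ≈ᶜ⟨ real-cong e-0 ⟩
    1ᶜ  ∎ᶜ

  Z : ℂ → ℕ → ℂ
  Z s n = bpow (s +ᶜ nat n) -ᶜ nat N

  -- The table runs from u_m down to u_0; `entry` addresses it by the index of the moment. Beyond m
  -- it returns the head, a default outside the range of `IsSolution`.
  entry : ∀ {m} → Vec ℂ (suc m) → ℕ → ℂ
  entry {zero}  (x ∷ _) k = x
  entry {suc m} (x ∷ v) k with k ℕ.≤? m
  ... | yes _ = entry v k
  ... | no _  = x

  entry-≤ : ∀ {m} x (v : Vec ℂ (suc m)) {k} → k ℕ.≤ m → entry (x ∷ v) k ≡ entry v k
  entry-≤ {m} x v {k} k≤m with k ℕ.≤? m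
  ... | yes _  = ≡.refl
  ... | no k≰m = ⊥-elim (k≰m k≤m)

  entry-head : ∀ m (v : Vec ℂ (suc m)) → entry v m ≡ head v
  entry-head zero    (x ∷ v) = ≡.refl
  entry-head (suc m) (x ∷ v) with suc m ℕ.≤? m
  ... | yes 1+m≤m = ⊥-elim (ℕ.1+n≰n 1+m≤m)
  ... | no _      = ≡.refl

  entry-lookup : ∀ m (v : Vec ℂ (suc m)) (i : Fin (suc m)) → lookup v i ≡ entry v (m ℕ.∸ toℕ i)
  entry-lookup zero    (x ∷ v) Fin.zero    = ≡.refl
  entry-lookup (suc m) (x ∷ v) Fin.zero    = ≡.sym (entry-head (suc m) (x ∷ v))
  entry-lookup (suc m) (x ∷ v) (Fin.suc i) = ≡.trans (entry-lookup m v i) (≡.sym (entry-≤ x v (ℕ.m∸n≤m m (toℕ i))))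

  sum-cong : ∀ n {x y : Fin n → ℂ} → (∀ i → x i ≈ᶜ y i) → Analysis.sum ℛ x ≈ᶜ Analysis.sum ℛ y
  sum-cong zero    x≈y = reflᶜ
  sum-cong (suc n) x≈y = +ᶜ-cong (x≈y Fin.zero) (sum-cong n (x≈y ∘ Fin.suc))

  -- The recurrence multiplied out, so that no inverse occurs, and only up to m, where regularity is
  -- assumed.
  IsSolution : ℂ → ℕ → (ℕ → ℂ) → Set ℓ₁
  IsSolution s m a = (Z s 0 *ᶜ a 0 ≈ᶜ bpow s) × (∀ n → n ℕ.< m → Z s (suc n) *ᶜ a (suc n) ≈ᶜ
    S.∑ (suc n) (λ i → nat (suc n choose suc i) *ᶜ nat (γ (suc i)) *ᶜ a (n ℕ.∸ i)))

  table-solution : ∀ m s reg → IsSolution s m (entry (uTable m s reg))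
  table-solution zero s reg = (
    Z s 0 *ᶜ (bpow s *ᶜ inverse (Z s 0) (reg 0 ℕ.≤-refl))
      ≈ᶜ⟨ CS.solve 3 (λ z b i → z CS.:* (b CS.:* i) CS.:= (z CS.:* i) CS.:* b) reflᶜ _ _ _ ⟩
    (Z s 0 *ᶜ inverse (Z s 0) (reg 0 ℕ.≤-refl)) *ᶜ bpow s  ≈ᶜ⟨ *ᶜ-congʳ (inverse-inverse _ _) ⟩
    1ᶜ *ᶜ bpow s  ≈ᶜ⟨ *ᶜ-identityˡ (bpow s) ⟩
    bpow s  ∎ᶜ) , λ n ()
  table-solution (suc m) s reg = transᶜ (*ᶜ-congˡ (≡⇒≈ᶜ (entry-≤ x₀ v ℕ.z≤n))) (proj₁ IH) , step
    where
    v = uTable m s (λ j j≤m → reg j (ℕ.m≤n⇒m≤1+n j≤m))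
    IH = table-solution m s (λ j j≤m → reg j (ℕ.m≤n⇒m≤1+n j≤m))
    x₀ = head (uTable (suc m) s reg)
    a = entry (uTable (suc m) s reg)
    coefficient : ℕ → ℕ → ℂ
    coefficient n i = nat (suc n choose suc i) *ᶜ nat (γ (suc i))
    step : ∀ n → n ℕ.< suc m → Z s (suc n) *ᶜ a (suc n) ≈ᶜ S.∑ (suc n) (λ i → coefficient n i *ᶜ a (n ℕ.∸ i))
    step n n<1+m = [ old , new ]′ (ℕ.m≤n⇒m<n∨m≡n (ℕ.s≤s⁻¹ n<1+m))
      where
      Σ = Analysis.sum ℛ (λ i → coefficient m (toℕ i) *ᶜ lookup v i)

      old : n ℕ.< m → Z s (suc n) *ᶜ a (suc n) ≈ᶜ S.∑ (suc n) (λ i → coefficient n i *ᶜ a (n ℕ.∸ i))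
      old n<m =
        Z s (suc n) *ᶜ a (suc n)  ≈ᶜ⟨ *ᶜ-congˡ (≡⇒≈ᶜ (entry-≤ x₀ v n<m)) ⟩
        Z s (suc n) *ᶜ entry v (suc n)  ≈ᶜ⟨ proj₂ IH n n<m ⟩
        S.∑ (suc n) (λ i → coefficient n i *ᶜ entry v (n ℕ.∸ i))
          ≈ᶜ⟨ S.∑-cong (suc n) (λ i → *ᶜ-congˡ {coefficient n i} (≡⇒≈ᶜ (entry-≤ x₀ v (ℕ.≤-trans (ℕ.m∸n≤m n i) (ℕ.<⇒≤ n<m))))) ⟨
        S.∑ (suc n) (λ i → coefficient n i *ᶜ a (n ℕ.∸ i)) ∎ᶜ

      new : n ≡ m → Z s (suc n) *ᶜ a (suc n) ≈ᶜ S.∑ (suc n) (λ i → coefficient n i *ᶜ a (n ℕ.∸ i))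
      new ≡.refl =
        Z s (suc m) *ᶜ a (suc m)  ≈ᶜ⟨ *ᶜ-congˡ (≡⇒≈ᶜ (entry-head (suc m) (uTable (suc m) s reg))) ⟩
        Z s (suc m) *ᶜ (Σ *ᶜ inverse (Z s (suc m)) (reg (suc m) ℕ.≤-refl))
          ≈ᶜ⟨ CS.solve 3 (λ z b i → z CS.:* (b CS.:* i) CS.:= (z CS.:* i) CS.:* b) reflᶜ (Z s (suc m)) Σ _ ⟩
        (Z s (suc m) *ᶜ inverse (Z s (suc m)) (reg (suc m) ℕ.≤-refl)) *ᶜ Σ  ≈ᶜ⟨ *ᶜ-congʳ (inverse-inverse _ _) ⟩
        1ᶜ *ᶜ Σ  ≈ᶜ⟨ *ᶜ-identityˡ Σ ⟩
        Σ  ≈ᶜ⟨ sum-cong (suc m) (λ i → *ᶜ-congˡ {coefficient m (toℕ i)}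
                                                          (≡⇒≈ᶜ (≡.trans (entry-lookup m v i) (≡.sym (entry-≤ x₀ v (ℕ.m∸n≤m m (toℕ i))))))) ⟩
        S.∑ (suc m) (λ i → coefficient m i *ᶜ a (m ℕ.∸ i)) ∎ᶜ

  ifac : ℕ → Carrier
  ifac = P 0# 1#

  ifac-inverse : ∀ n → ι (n !) * ifac n ≈ 1#
  ifac-inverse n = trans (factorial-P 1# n) (1^n≈1 n)

  C-ifac : ∀ {n k} → k ℕ.≤ n → ι (n choose k) * ifac n ≈ ifac k * ifac (n ℕ.∸ k)
  C-ifac {n} {k} k≤n = begin-equality
    ι (n choose k) * ifac n  ≈⟨ solve 1 (λ x → x := x :* (:1 :* :1)) refl _ ⟩
    (ι (n choose k) * ifac n) * (1# * 1#)
      ≈⟨ *-congˡ (*-cong (ifac-inverse k) (ifac-inverse (n ℕ.∸ k))) ⟨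
    (ι (n choose k) * ifac n) * ((ι (k !) * ifac k) * (ι ((n ℕ.∸ k) !) * ifac (n ℕ.∸ k)))
      ≈⟨ solve 6 (λ c i f x g y → (c :* i) :* ((f :* x) :* (g :* y)) := ((c :* (f :* g)) :* i) :* (x :* y)) refl _ _ _ _ _ _ ⟩
    ((ι (n choose k) * (ι (k !) * ι ((n ℕ.∸ k) !))) * ifac n) * (ifac k * ifac (n ℕ.∸ k))
      ≈⟨ *-congʳ (*-congʳ (trans (*-congˡ (sym (×1-homo-* (k !) _))) (sym (×1-homo-* (n choose k) _)))) ⟩
    (ι ((n choose k) ℕ.* (k ! ℕ.* (n ℕ.∸ k) !)) * ifac n) * (ifac k * ifac (n ℕ.∸ k))
      ≡⟨ ≡.cong (λ x → (ι x * ifac n) * (ifac k * ifac (n ℕ.∸ k))) (C-factorial k≤n) ⟩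
    (ι (n !) * ifac n) * (ifac k * ifac (n ℕ.∸ k))  ≈⟨ trans (*-congʳ (ifac-inverse n)) (*-identityˡ _) ⟩
    ifac k * ifac (n ℕ.∸ k)  ∎

  γ̂ : ℕ → Carrier
  γ̂ j = ι (γ j) * ifac j

  γ̂-nonneg : ∀ j → 0# ≤ γ̂ j
  γ̂-nonneg j = *-nonneg (ι-nonneg (γ j)) (P-nonneg ≤-refl 0≤1 j)

  -- The recurrence for a_n / n!, in which binomial coefficients disappear.
  IsNormalised : ℂ → ℕ → (ℕ → ℂ) → Set ℓ₁
  IsNormalised s m â = ∀ n → n ℕ.< m → Z s (suc n) *ᶜ â (suc n) ≈ᶜ S.conv (λ j → real (γ̂ (suc j))) â n

  ∑-cong-< : ∀ n {x y} → (∀ k → k ℕ.< n → x k ≈ᶜ y k) → S.∑ n x ≈ᶜ S.∑ n y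
  ∑-cong-< zero    x≈y = reflᶜ
  ∑-cong-< (suc n) x≈y = +ᶜ-cong (x≈y 0 (ℕ.s≤s ℕ.z≤n)) (∑-cong-< n (λ k k<n → x≈y (suc k) (ℕ.s≤s k<n)))

  normalise : ∀ {s m a} → IsSolution s m a → IsNormalised s m (λ k → a k *ᶜ real (ifac k))
  normalise {s} {m} {a} (_ , solution) n n<m =
    Z s (suc n) *ᶜ (a (suc n) *ᶜ real (ifac (suc n)))  ≈ᶜ⟨ *ᶜ-assoc _ _ _ ⟨
    (Z s (suc n) *ᶜ a (suc n)) *ᶜ real (ifac (suc n))  ≈ᶜ⟨ *ᶜ-congʳ (solution n n<m) ⟩
    S.∑ (suc n) (λ i → c′ i *ᶜ nat (γ (suc i)) *ᶜ a (n ℕ.∸ i)) *ᶜ real (ifac (suc n))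
      ≈ᶜ⟨ *ᶜ-comm _ _ ⟩
    real (ifac (suc n)) *ᶜ S.∑ (suc n) (λ i → c′ i *ᶜ nat (γ (suc i)) *ᶜ a (n ℕ.∸ i))
      ≈ᶜ⟨ S.∑-scale (suc n) (real (ifac (suc n))) (λ i → c′ i *ᶜ nat (γ (suc i)) *ᶜ a (n ℕ.∸ i)) ⟨
    S.∑ (suc n) (λ i → real (ifac (suc n)) *ᶜ (c′ i *ᶜ nat (γ (suc i)) *ᶜ a (n ℕ.∸ i)))
      ≈ᶜ⟨ ∑-cong-< (suc n) term ⟩
    S.∑ (suc n) (λ i → real (γ̂ (suc i)) *ᶜ (a (n ℕ.∸ i) *ᶜ real (ifac (n ℕ.∸ i))))
      ≈ᶜ⟨ S.conv-as-∑ n (λ j → real (γ̂ (suc j))) (λ k → a k *ᶜ real (ifac k)) ⟨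
    S.conv (λ j → real (γ̂ (suc j))) (λ k → a k *ᶜ real (ifac k)) n ∎ᶜ
    where
    c′ : ℕ → ℂ
    c′ i = nat (suc n choose suc i)
    term : ∀ i → i ℕ.< suc n → real (ifac (suc n)) *ᶜ (c′ i *ᶜ nat (γ (suc i)) *ᶜ a (n ℕ.∸ i))
      ≈ᶜ real (γ̂ (suc i)) *ᶜ (a (n ℕ.∸ i) *ᶜ real (ifac (n ℕ.∸ i)))
    term i i≤n =
      real (ifac (suc n)) *ᶜ (c′ i *ᶜ nat (γ (suc i)) *ᶜ a (n ℕ.∸ i))
        ≈ᶜ⟨ CS.solve 4 (λ f c g a → f CS.:* (c CS.:* g CS.:* a) CS.:= (c CS.:* f) CS.:* (g CS.:* a)) reflᶜ (real (ifac (suc n))) (c′ i) (nat (γ (suc i))) (a (n ℕ.∸ i)) ⟩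
      (c′ i *ᶜ real (ifac (suc n))) *ᶜ (nat (γ (suc i)) *ᶜ a (n ℕ.∸ i))
        ≈ᶜ⟨ *ᶜ-congʳ (transᶜ (symᶜ (real-* _ _)) (transᶜ (real-cong (C-ifac i≤n)) (real-* _ _))) ⟩
      (real (ifac (suc i)) *ᶜ real (ifac (n ℕ.∸ i))) *ᶜ (nat (γ (suc i)) *ᶜ a (n ℕ.∸ i))
        ≈ᶜ⟨ CS.solve 4 (λ f c g a → (f CS.:* c) CS.:* (g CS.:* a) CS.:= (g CS.:* f) CS.:* (a CS.:* c)) reflᶜ (real (ifac (suc i))) (real (ifac (n ℕ.∸ i))) (nat (γ (suc i))) (a (n ℕ.∸ i)) ⟩
      (nat (γ (suc i)) *ᶜ real (ifac (suc i))) *ᶜ (a (n ℕ.∸ i) *ᶜ real (ifac (n ℕ.∸ i)))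
        ≈ᶜ⟨ *ᶜ-congʳ (real-* (ι (γ (suc i))) (ifac (suc i))) ⟨
      real (γ̂ (suc i)) *ᶜ (a (n ℕ.∸ i) *ᶜ real (ifac (n ℕ.∸ i))) ∎ᶜ

-- Bounds for the coefficients and for the first moments.

module Estimates {c ℓ₁ ℓ₂} (ℛ : CompleteOrderedField c ℓ₁ ℓ₂)
  (exp : Analysis.ℂ ℛ → Analysis.ℂ ℛ) (isExp : Analysis.IsExp ℛ exp)
  (d : ℕ) (A : Subset (suc (suc d))) (L : CompleteOrderedField.Carrier ℛ)
  (exp-L : IsLog ℛ exp (suc (suc d)) L)
  (0<f : 0 ℕ.< Digits.f A)
  (α : Analysis.ℂ ℛ → Analysis.ℂ ℛ)
  (isAlpha : Moments.IsAlpha ℛ (base-power ℛ exp L) A α)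
  where

  open Recurrence ℛ exp isExp d A L exp-L public
  open DigitBounds A using (γ≤; f<b)

  Λ : Carrier
  Λ = ι f * inv d

  0<Λ : 0# < Λ
  0<Λ = *-pos (≡.subst (λ n → 0# < ι n) (ℕ.suc-pred f {{ℕ.>-nonZero 0<f}}) (0<ι-suc (ℕ.pred f))) (0<inv d)

  0≤Λ : 0# ≤ Λ
  0≤Λ = <⇒≤ 0<Λ

  Λ≤1 : Λ ≤ 1#
  Λ≤1 = ≤-trans (*-monoˡ-≤ (<⇒≤ (0<inv d)) (ι-mono (ℕ.s≤s⁻¹ f<b))) (≤-reflexive (inv-inverse d))

  Λt≈f : Λ * t ≈ ι f
  Λt≈f = trans (solve 3 (λ f r t → (f :* r) :* t := f :* (t :* r)) refl (ι f) (inv d) t)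
    (trans (*-congˡ (inv-inverse d)) (*-identityʳ _))

  ι-^ : ∀ m n → ι (m ℕ.^ n) ≈ ι m ^ n
  ι-^ m zero    = +-identityʳ 1#
  ι-^ m (suc n) = trans (×1-homo-* m (m ℕ.^ n)) (*-congˡ (ι-^ m n))

  -- For the largest digit f = Λ t. The others are at most f - 1 = Λ t - 1 ≤ Λ (t - 1) = Λ d,
  -- because Λ ≤ 1.
  γ̂≤ : ∀ j → γ̂ j ≤ Λ ^ j * ε j
  γ̂≤ j = begin
    ι (γ j) * ifac j  ≤⟨ *-monoˡ-≤ (P-nonneg ≤-refl 0≤1 j) (ι-mono (γ≤ j 0<f)) ⟩
    ι (f ℕ.^ j ℕ.+ b ℕ.* ℕ.pred f ℕ.^ j) * ifac j
      ≈⟨ *-congʳ (trans (×-homo-+ 1# (f ℕ.^ j) (b ℕ.* ℕ.pred f ℕ.^ j)) (+-congˡ (×1-homo-* b (ℕ.pred f ℕ.^ j)))) ⟩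
    (ι (f ℕ.^ j) + β * ι (ℕ.pred f ℕ.^ j)) * ifac j
      ≈⟨ solve 4 (λ x b y i → (x :+ b :* y) :* i := x :* i :+ b :* (y :* i)) refl _ β _ _ ⟩
    ι (f ℕ.^ j) * ifac j + β * (ι (ℕ.pred f ℕ.^ j) * ifac j)
      ≈⟨ +-cong (power f) (*-congˡ (power (ℕ.pred f))) ⟩
    P 0# (ι f) j + β * P 0# (ι (ℕ.pred f)) j
      ≤⟨ +-mono-≤ (≤-reflexive (P-cong refl (sym Λt≈f) j)) (*-monoʳ-≤ 0≤β (P-mono ≤-refl (ι-nonneg (ℕ.pred f)) pred≤ j)) ⟩
    P 0# (Λ * t) j + β * P 0# (Λ * ι d) j
      ≈⟨ +-cong (P-0-dilate Λ t j) (*-congˡ (P-0-dilate Λ (ι d) j)) ⟩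
    Λ ^ j * P 0# t j + β * (Λ ^ j * P 0# (ι d) j)
      ≈⟨ solve 4 (λ l x b y → l :* x :+ b :* (l :* y) := l :* (x :+ b :* y)) refl _ _ β _ ⟩
    Λ ^ j * ε j  ∎
    where
    power : ∀ n → ι (n ℕ.^ j) * ifac j ≈ P 0# (ι n) j
    power n = trans (*-congʳ (ι-^ n j)) (trans (sym (P-0-dilate (ι n) 1# j)) (P-cong refl (*-identityʳ _) j))
    pred≤ : ι (ℕ.pred f) ≤ Λ * ι d
    pred≤ = begin
      ι (ℕ.pred f)  ≈⟨ solve 1 (λ x → x := (:1 :+ x) :- :1) refl _ ⟩
      ι (suc (ℕ.pred f)) - 1#  ≡⟨ ≡.cong (λ n → ι n - 1#) (ℕ.suc-pred f {{ℕ.>-nonZero 0<f}}) ⟩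
      ι f - 1#  ≈⟨ +-congʳ Λt≈f ⟨
      Λ * t - 1#  ≈⟨ solve 2 (λ l d → l :* (:1 :+ d) :- :1 := l :* d :+ (l :- :1)) refl Λ (ι d) ⟩
      Λ * ι d + (Λ - 1#)  ≤⟨ +-monoʳ-≤ _ (≤-trans (+-monoˡ-≤ (- 1#) Λ≤1) (≤-reflexive (-‿inverseʳ 1#))) ⟩
      Λ * ι d + 0#  ≈⟨ +-identityʳ _ ⟩
      Λ * ι d  ∎

  β^p^ : ∀ n → β ^ n * p ^ n ≈ 1#
  β^p^ zero    = *-identityˡ 1#
  β^p^ (suc n) = trans (solve 4 (λ b p x y → (b :* x) :* (p :* y) := (b :* p) :* (x :* y)) refl β p _ _)
    (trans (*-cong βp≈1 (β^p^ n)) (*-identityˡ 1#))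

  φ-neg-ι : ∀ n → φ (- ι n) ≈ p ^ n
  φ-neg-ι n = begin-equality
    φ (- ι n)  ≈⟨ *-identityʳ _ ⟨
    φ (- ι n) * 1#  ≈⟨ *-congˡ (β^p^ n) ⟨
    φ (- ι n) * (β ^ n * p ^ n)  ≈⟨ *-assoc _ _ _ ⟨
    (φ (- ι n) * β ^ n) * p ^ n  ≈⟨ *-congʳ (trans (*-congˡ (sym (φ-ι n))) (φ-neg (ι n))) ⟩
    1# * p ^ n  ≈⟨ *-identityˡ _ ⟩
    p ^ n  ∎

  0≤p : 0# ≤ p
  0≤p = <⇒≤ (0<inv (suc d))

  1≤β^ : ∀ n → 1# ≤ β ^ n
  1≤β^ = 1≤^ 1≤β

  0≤β^ : ∀ n → 0# ≤ β ^ n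
  0≤β^ n = ≤-trans 0≤1 (1≤β^ n)

  -- The bounds on Re s control |b^s| from both sides; the bound on (Im s)² enters the Pochhammer
  -- estimate.
  record Box (r : ℕ) (s : ℂ) : Set ℓ₂ where
    field
      -r≤re : - ι r ≤ re s
      re≤r  : re s ≤ ι r
      im≤r  : im s * im s ≤ ι r * ι r

    φ--re≤ : φ (- re s) ≤ β ^ r
    φ--re≤ = ≤-trans (φ-mono (≤-trans (neg-mono-≤ -r≤re) (≤-reflexive (solve 1 (λ x → :- :- x := x) refl (ι r)))))
      (≤-reflexive (φ-ι r))

    -- The lower bound b^(-r) ≤ |b^s| as a product; it makes absolute errors relative to |b^s|.
    1≤β^rφ : 1# ≤ β ^ r * φ (re s)
    1≤β^rφ = begin
      1#  ≈⟨ φ-neg (re s) ⟨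
      φ (- re s) * φ (re s)  ≤⟨ *-monoˡ-≤ (<⇒≤ (0<φ (re s))) φ--re≤ ⟩
      β ^ r * φ (re s)  ∎

  -- The zeros of α cancel the poles of the first K moments.
  module Initial (r K : ℕ) where

    κ₀ τp W′ ξ C₀ : Carrier
    κ₀ = β ^ r * ι N
    τp = β * inv d
    W′ = ∑ (suc K) (γ̂ ∘ suc)
    ξ = 1# + β ^ r * W′
    C₀ = ξ ^ K * e (κ₀ * τp)

    0≤κ₀ : 0# ≤ κ₀
    0≤κ₀ = *-nonneg (0≤β^ r) (ι-nonneg N)

    0≤W′ : 0# ≤ W′
    0≤W′ = ∑-nonneg (suc K) (γ̂-nonneg ∘ suc)

    1≤ξ : 1# ≤ ξ
    1≤ξ = x≤x+y (*-nonneg (0≤β^ r) 0≤W′)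

    0≤ξ = ≤-trans 0≤1 1≤ξ

    ξ^-mono : ∀ {m n} → m ℕ.≤ n → ξ ^ m ≤ ξ ^ n
    ξ^-mono {n = n} ℕ.z≤n = 1≤^ 1≤ξ n
    ξ^-mono (ℕ.s≤s m≤n)   = *-monoʳ-≤ 0≤ξ (ξ^-mono m≤n)

    Ē : ℕ → Carrier
    Ē k = 1# + κ₀ * p ^ k

    1≤Ē : ∀ k → 1# ≤ Ē k
    1≤Ē k = x≤x+y (*-nonneg 0≤κ₀ (^-nonneg 0≤p k))

    0≤∏Ē : ∀ n → 0# ≤ ∏ n Ē
    0≤∏Ē n = ∏-nonneg n (λ k → ≤-trans 0≤1 (1≤Ē k))

    ∏Ē≤ : ∀ n → ∏ n Ē ≤ e (κ₀ * τp)
    ∏Ē≤ = ∏-geometric 0≤κ₀ 0≤p (*-pos (0<ι-suc (suc d)) (0<inv d)) (begin-equality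
      (1# - p) * (β * inv d)  ≈⟨ solve 3 (λ q b r → q :* (b :* r) := (b :* q) :* r) refl (1# - p) β (inv d) ⟩
      (β * q) * inv d  ≈⟨ *-congʳ βq≈t ⟩
      t * inv d  ≈⟨ inv-inverse d ⟩
      1#  ∎)

    0≤C₀ : 0# ≤ C₀
    0≤C₀ = *-nonneg (^-nonneg 0≤ξ K) (<⇒≤ (0<e _))

    module _ (s : ℂ) (box : Box r s) where
      open Box box

      D F : ℕ → ℂ
      D k = bpow (-ᶜ s -ᶜ nat k)
      F k = 1ᶜ -ᶜ D k *ᶜ nat N

      ∣D∣≤ : ∀ k → ∣ D k ∣≤ (β ^ r * p ^ k)
      ∣D∣≤ k = ∣∣-mono (begin
        φ (- re s - ι k)  ≈⟨ φ-+ _ _ ⟩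
        φ (- re s) * φ (- ι k)  ≤⟨ *-mono-≤ (0≤β^ r) (<⇒≤ (0<φ _)) φ--re≤ (≤-reflexive (φ-neg-ι k)) ⟩
        β ^ r * p ^ k  ∎) (∣bpow∣ (-ᶜ s -ᶜ nat k))

      ∣F∣≤ : ∀ k → ∣ F k ∣≤ Ē k
      ∣F∣≤ k = ∣∣-mono
        (≤-reflexive (+-congˡ (solve 3 (λ b p n → (b :* p) :* n := (b :* n) :* p) refl (β ^ r) (p ^ k) (ι N))))
        (∣∣-- ∣1∣≤1 (∣∣-* (∣D∣≤ k) (∣∣-real (ι-nonneg N))))

      -- 1 - b^(-s-k) N = b^(-s-k) (b^(s+k) - N) turns a factor of α into the divisor of the
      -- recurrence.
      F-Z : ∀ k v → F k *ᶜ v ≈ᶜ D k *ᶜ (Z s k *ᶜ v)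
      F-Z k v =
        (1ᶜ -ᶜ D k *ᶜ nat N) *ᶜ v  ≈ᶜ⟨ *ᶜ-congʳ (+ᶜ-congʳ (bpow-inverse s k)) ⟨
        (D k *ᶜ bpow (s +ᶜ nat k) -ᶜ D k *ᶜ nat N) *ᶜ v
          ≈ᶜ⟨ CS.solve 4 (λ d b n v → (d CS.:* b CS.:- d CS.:* n) CS.:* v CS.:= d CS.:* ((b CS.:- n) CS.:* v)) reflᶜ (D k) (bpow (s +ᶜ nat k)) (nat N) v ⟩
        D k *ᶜ (Z s k *ᶜ v)  ∎ᶜ

      extend : ∀ {v C} n₀ {n} → n₀ ℕ.≤ n → ∣ S.∏ n₀ F *ᶜ v ∣≤ (C * ∏ n₀ Ē) → ∣ S.∏ n F *ᶜ v ∣≤ (C * ∏ n Ē)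
      extend {v} {C} n₀ n₀≤n bound with ℕ.m≤n⇒∃[o]m+o≡n n₀≤n
      ... | o , ≡.refl = ∣∣-mono
        (≤-reflexive (begin-equality
          (C * ∏ n₀ Ē) * ∏ o (λ k → Ē (n₀ ℕ.+ k))  ≈⟨ *-assoc _ _ _ ⟩
          C * (∏ n₀ Ē * ∏ o (λ k → Ē (n₀ ℕ.+ k)))  ≈⟨ *-congˡ (∏-split n₀ o Ē) ⟨
          C * ∏ (n₀ ℕ.+ o) Ē  ∎))
        (∣∣-resp-≈ (
          (S.∏ n₀ F *ᶜ v) *ᶜ S.∏ o (λ k → F (n₀ ℕ.+ k))
            ≈ᶜ⟨ CS.solve 3 (λ x v y → (x CS.:* v) CS.:* y CS.:= (x CS.:* y) CS.:* v) reflᶜ (S.∏ n₀ F) v (S.∏ o (λ k → F (n₀ ℕ.+ k))) ⟩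
          (S.∏ n₀ F *ᶜ S.∏ o (λ k → F (n₀ ℕ.+ k))) *ᶜ v  ≈ᶜ⟨ *ᶜ-congʳ (S.∏-split n₀ o F) ⟨
          S.∏ (n₀ ℕ.+ o) F *ᶜ v ∎ᶜ)
          (∣∣-* bound (∣∣-∏ o (λ k _ → ∣F∣≤ (n₀ ℕ.+ k)))))

      module _ {m a} (solution : IsSolution s m a) where

        private
          â : ℕ → ℂ
          â k = a k *ᶜ real (ifac k)

          first : ∣ S.∏ 1 F *ᶜ â 0 ∣≤ (1# * ∏ 1 Ē)
          first = ∣∣-mono (≤-trans (1≤Ē 0) (≤-reflexive (solve 1 (λ x → x := :1 :* (x :* :1)) refl (Ē 0))))
            (∣∣-resp-≈ (symᶜ (
              (F 0 *ᶜ 1ᶜ) *ᶜ (a 0 *ᶜ 1ᶜ)  ≈ᶜ⟨ CS.solve 2 (λ f a → (f CS.:* CS.:1) CS.:* (a CS.:* CS.:1) CS.:= f CS.:* a) reflᶜ (F 0) (a 0) ⟩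
              F 0 *ᶜ a 0  ≈ᶜ⟨ F-Z 0 (a 0) ⟩
              D 0 *ᶜ (Z s 0 *ᶜ a 0)  ≈ᶜ⟨ *ᶜ-congˡ (transᶜ (proj₁ solution) bpow-0) ⟩
              D 0 *ᶜ bpow (s +ᶜ nat 0)  ≈ᶜ⟨ bpow-inverse s 0 ⟩
              1ᶜ  ∎ᶜ)) ∣1∣≤1)
            where
            bpow-0 : bpow s ≈ᶜ bpow (s +ᶜ nat 0)
            bpow-0 = exp-cong (CS.solve 2 (λ s l → s CS.:* l CS.:= (s CS.:+ CS.:0) CS.:* l) reflᶜ s (real L))

          -- The factor F (suc k) makes the recurrence applicable, and the earlier factors pass into
          -- the convolution by linearity. The step costs at most ξ.
          next : ∀ k → k ℕ.< m → k ℕ.< K → (∀ j → j ℕ.≤ k → ∣ S.∏ (suc k) F *ᶜ â j ∣≤ (ξ ^ k * ∏ (suc k) Ē)) →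
            ∣ S.∏ (suc (suc k)) F *ᶜ â (suc k) ∣≤ (ξ ^ suc k * ∏ (suc (suc k)) Ē)
          next k k<m k<K IH = ∣∣-mono bound (∣∣-resp-≈ (symᶜ (
              S.∏ (suc (suc k)) F *ᶜ â (suc k)  ≈ᶜ⟨ *ᶜ-congʳ (S.∏-last (suc k) F) ⟩
              (S.∏ (suc k) F *ᶜ F (suc k)) *ᶜ â (suc k)  ≈ᶜ⟨ *ᶜ-assoc _ _ _ ⟩
              S.∏ (suc k) F *ᶜ (F (suc k) *ᶜ â (suc k))  ≈ᶜ⟨ *ᶜ-congˡ (transᶜ (F-Z (suc k) (â (suc k))) (*ᶜ-congˡ (normalise solution k k<m))) ⟩
              S.∏ (suc k) F *ᶜ (D (suc k) *ᶜ S.conv g â k)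
                ≈ᶜ⟨ CS.solve 3 (λ x d c → x CS.:* (d CS.:* c) CS.:= d CS.:* (x CS.:* c)) reflᶜ (S.∏ (suc k) F) (D (suc k)) (S.conv g â k) ⟩
              D (suc k) *ᶜ (S.∏ (suc k) F *ᶜ S.conv g â k)  ≈ᶜ⟨ *ᶜ-congˡ (S.conv-scaleʳ k (S.∏ (suc k) F) g â) ⟨
              D (suc k) *ᶜ S.conv g (λ j → S.∏ (suc k) F *ᶜ â j) k ∎ᶜ))
            (∣∣-* (∣D∣≤ (suc k)) (∣∣-conv k {s = λ _ → ξ ^ k * ∏ (suc k) Ē} (λ j _ → ∣∣-real (γ̂-nonneg (suc j))) IH)))
            where
            g : ℕ → ℂ
            g j = real (γ̂ (suc j))
            C = ξ ^ k * ∏ (suc k) Ē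
            0≤C = *-nonneg (^-nonneg 0≤ξ k) (0≤∏Ē (suc k))
            bound : (β ^ r * p ^ suc k) * conv (γ̂ ∘ suc) (λ _ → C) k ≤ ξ ^ suc k * ∏ (suc (suc k)) Ē
            bound = begin
              (β ^ r * p ^ suc k) * conv (γ̂ ∘ suc) (λ _ → C) k
                ≤⟨ *-mono-≤ (0≤β^ r) (conv-nonneg k (γ̂-nonneg ∘ suc) (λ _ → 0≤C))
                     (≤-trans (*-monoʳ-≤ (0≤β^ r) (^≤1 0≤p (inv≤1 (suc d)) (suc k))) (≤-reflexive (*-identityʳ _)))
                     (≤-reflexive (conv-as-∑ k (γ̂ ∘ suc) (λ _ → C))) ⟩
              β ^ r * ∑ (suc k) (λ j → γ̂ (suc j) * C)
                ≈⟨ *-congˡ (trans (∑-cong (suc k) (λ j → *-comm (γ̂ (suc j)) C)) (∑-scale (suc k) C (γ̂ ∘ suc))) ⟩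
              β ^ r * (C * ∑ (suc k) (γ̂ ∘ suc))
                ≤⟨ *-monoʳ-≤ (0≤β^ r) (*-monoʳ-≤ 0≤C (∑-mono-length (γ̂-nonneg ∘ suc) (ℕ.m≤n⇒m≤1+n k<K))) ⟩
              β ^ r * (C * W′)  ≈⟨ solve 3 (λ b c w → b :* (c :* w) := (b :* w) :* c) refl (β ^ r) C W′ ⟩
              (β ^ r * W′) * C  ≤⟨ *-monoˡ-≤ 0≤C (x≤y+x 0≤1) ⟩
              ξ * C  ≈⟨ *-assoc _ _ _ ⟨
              ξ ^ suc k * ∏ (suc k) Ē
                ≤⟨ *-monoʳ-≤ (^-nonneg 0≤ξ (suc k)) (∏-mono-length Ē 1≤Ē (ℕ.n≤1+n (suc k))) ⟩
              ξ ^ suc k * ∏ (suc (suc k)) Ē  ∎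

          -- The first j + 1 factors of α cancel all poles of u_j, whence j < n. Further factors
          -- enlarge the bound only by `Ē`, so by `∏Ē≤` it survives the limit n → ∞.
          regularised : ∀ k → k ℕ.≤ m → k ℕ.≤ K → ∀ j → j ℕ.≤ k → ∀ n → j ℕ.< n →
            ∣ S.∏ n F *ᶜ â j ∣≤ (ξ ^ k * ∏ n Ē)
          regularised zero k≤m k≤K .zero ℕ.z≤n n 0<n = extend 1 0<n first
          regularised (suc k) k<m k<K j j≤1+k n j<n = [ old , new ]′ (ℕ.m≤n⇒m<n∨m≡n j≤1+k)
            where
            IH = regularised k (ℕ.<⇒≤ k<m) (ℕ.<⇒≤ k<K)
            old : j ℕ.< suc k → ∣ S.∏ n F *ᶜ â j ∣≤ (ξ ^ suc k * ∏ n Ē)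
            old j<1+k = ∣∣-mono (*-monoˡ-≤ (0≤∏Ē n) (ξ^-mono (ℕ.n≤1+n k))) (IH j (ℕ.s≤s⁻¹ j<1+k) n j<n)
            new : j ≡ suc k → ∣ S.∏ n F *ᶜ â j ∣≤ (ξ ^ suc k * ∏ n Ē)
            new ≡.refl = extend (suc (suc k)) j<n (next k k<m k<K (λ j j≤k → IH j j≤k (suc k) (ℕ.s≤s j≤k)))

        initial-bound : ∀ k → k ℕ.≤ m → k ℕ.≤ K → ∣ α s *ᶜ â k ∣≤ C₀
        initial-bound k k≤m k≤K = Lim-∣∣ {x = λ n → S.∏ n F *ᶜ â k} (suc k) 0≤C₀
          (Lim-* {x = λ n → S.∏ n F} {y = λ _ → â k} (⟶⇒Lim (isAlpha s)) (Lim-const (â k)))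
          (λ n k<n → ∣∣-mono (*-mono-≤ (^-nonneg 0≤ξ K) (0≤∏Ē n) (ξ^-mono k≤K) (∏Ē≤ n))
                       (regularised k k≤m k≤K k ℕ.≤-refl n k<n))

-- The induction at regular points of a rectangle.

module UniformBound {c ℓ₁ ℓ₂} (ℛ : CompleteOrderedField c ℓ₁ ℓ₂)
  (exp : Analysis.ℂ ℛ → Analysis.ℂ ℛ) (isExp : Analysis.IsExp ℛ exp)
  (d : ℕ) (A : Subset (suc (suc d))) (L : CompleteOrderedField.Carrier ℛ)
  (exp-L : IsLog ℛ exp (suc (suc d)) L)
  (0<f : 0 ℕ.< Digits.f A)
  (α : Analysis.ℂ ℛ → Analysis.ℂ ℛ)
  (isAlpha : Moments.IsAlpha ℛ (base-power ℛ exp L) A α)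
  (r : ℕ)
  where

  open Estimates ℛ exp isExp d A L exp-L 0<f α isAlpha public

  Δ : Carrier
  Δ = ι r * ι r

  0≤Δ : 0# ≤ Δ
  0≤Δ = *-nonneg (ι-nonneg r) (ι-nonneg r)

  -- Each factor satisfies |z + l| / (1 + y + l) ≤ (y + l + Δ) / (y + l + 1 + Δ), and these
  -- quotients telescope. The weight y + i + Δ on the left is the source of the factor 1 / m.
  pochhammer-ρ : ∀ i y 0≤y z → re z ≈ y → im z * im z ≤ Δ → 1# + Δ ≤ y →
    ∣ real (ρ y 0≤y i * (y + ι i + Δ)) *ᶜ S.∏ i (λ l → z +ᶜ nat l) ∣≤ (y + Δ)
  pochhammer-ρ zero y 0≤y z re≈ im≤ Δ≤y = ∣∣-resp-≈ (symᶜ (*ᶜ-identityʳ _))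
    (∣∣-resp-≈ (real-cong (solve 2 (λ y x → y :+ x := :1 :* (y :+ :0 :+ x)) refl y Δ)) (∣∣-real (+-nonneg 0≤y 0≤Δ)))
  pochhammer-ρ (suc i) y 0≤y z re≈ im≤ Δ≤y = ∣∣-mono (≤-reflexive gc≈)
    (∣∣-resp-≈ (symᶜ regroup) (∣∣-* κz≤ (pochhammer-ρ i (1# + y) _ (z +ᶜ 1ᶜ)
      (trans (+-congʳ re≈) (+-comm y 1#))
      (≤-trans (≤-reflexive (*-cong (+-identityʳ _) (+-identityʳ _))) im≤)
      (≤-trans Δ≤y (x≤y+x 0≤1)))))
    where
    0<1+y′ = 0<1+y 0≤y
    κ = reciprocal (1# + y) 0<1+y′
    c′ = 1# + y + Δ
    0<c : 0# < c′
    0<c = +-pos-nonneg 0<1+y′ 0≤Δ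
    g = (y + Δ) * reciprocal c′ 0<c
    0≤g : 0# ≤ g
    0≤g = *-nonneg (+-nonneg 0≤y 0≤Δ) (<⇒≤ (0<reciprocal c′ 0<c))
    gc≈ : g * (1# + y + Δ) ≈ y + Δ
    gc≈ = trans (solve 3 (λ x r c → (x :* r) :* c := x :* (c :* r)) refl (y + Δ) (reciprocal c′ 0<c) c′)
      (trans (*-congˡ (reciprocal-inverse c′ 0<c)) (*-identityʳ _))
    ρ′ = ρ (1# + y) (<⇒≤ 0<1+y′) i

    regroup : real (ρ y 0≤y (suc i) * (y + ι (suc i) + Δ)) *ᶜ S.∏ (suc i) (λ l → z +ᶜ nat l)
      ≈ᶜ (real κ *ᶜ z) *ᶜ (real (ρ′ * (1# + y + ι i + Δ)) *ᶜ S.∏ i (λ l → (z +ᶜ 1ᶜ) +ᶜ nat l))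
    regroup =
      real ((κ * ρ′) * (y + ι (suc i) + Δ)) *ᶜ ((z +ᶜ nat 0) *ᶜ S.∏ i (λ l → z +ᶜ nat (suc l)))
        ≈ᶜ⟨ *ᶜ-cong
              (transᶜ (real-cong (solve 5 (λ k r y i x → (k :* r) :* (y :+ (:1 :+ i) :+ x) := k :* (r :* (:1 :+ y :+ i :+ x))) refl κ ρ′ y (ι i) Δ)) (real-* κ _))
              (*ᶜ-congˡ (S.∏-cong i (λ l → transᶜ (+ᶜ-congˡ (real-+ 1# (ι l))) (symᶜ (+ᶜ-assoc z 1ᶜ (nat l)))))) ⟩
      (real κ *ᶜ real (ρ′ * (1# + y + ι i + Δ))) *ᶜ ((z +ᶜ nat 0) *ᶜ S.∏ i (λ l → (z +ᶜ 1ᶜ) +ᶜ nat l))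
        ≈ᶜ⟨ CS.solve 4 (λ k r z p → (k CS.:* r) CS.:* ((z CS.:+ CS.:0) CS.:* p) CS.:= (k CS.:* z) CS.:* (r CS.:* p)) reflᶜ
              (real κ) (real (ρ′ * (1# + y + ι i + Δ))) z (S.∏ i (λ l → (z +ᶜ 1ᶜ) +ᶜ nat l)) ⟩
      (real κ *ᶜ z) *ᶜ (real (ρ′ * (1# + y + ι i + Δ)) *ᶜ S.∏ i (λ l → (z +ᶜ 1ᶜ) +ᶜ nat l)) ∎ᶜ

    -- |z|² ≤ y² + Δ, and ((1 + y) (y + Δ))² - c² (y² + Δ) = Δ (c (y - 1 - Δ) + Δ).
    z≤ : ∣ z ∣≤ ((1# + y) * g)
    z≤ = *-nonneg (<⇒≤ 0<1+y′) 0≤g , *-cancelˡ-≤ (*-pos 0<c 0<c) (begin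
      (c′ * c′) * normSq z  ≤⟨ *-monoʳ-≤ (x*x-nonneg c′) (+-mono-≤ (≤-reflexive (*-cong re≈ re≈)) im≤) ⟩
      (c′ * c′) * (y * y + Δ)
        ≤⟨ 0≤d⇒x≤y (*-nonneg 0≤Δ (+-nonneg (*-nonneg (<⇒≤ 0<c) (x≤y⇒0≤y-x Δ≤y)) 0≤Δ))
             (solve 2 (λ y x → ((:1 :+ y :+ x) :* (:1 :+ y :+ x)) :* (y :* y :+ x) :+ x :* ((:1 :+ y :+ x) :* (y :- (:1 :+ x)) :+ x)
               := ((:1 :+ y) :* (y :+ x)) :* ((:1 :+ y) :* (y :+ x))) refl y Δ) ⟩
      ((1# + y) * (y + Δ)) * ((1# + y) * (y + Δ))  ≈⟨ *-cong (*-congˡ gc≈) (*-congˡ gc≈) ⟨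
      ((1# + y) * (g * c′)) * ((1# + y) * (g * c′))
        ≈⟨ solve 3 (λ y g c → (y :* (g :* c)) :* (y :* (g :* c)) := (c :* c) :* ((y :* g) :* (y :* g))) refl (1# + y) g c′ ⟩
      (c′ * c′) * (((1# + y) * g) * ((1# + y) * g)) ∎)

    κz≤ : ∣ real κ *ᶜ z ∣≤ g
    κz≤ = ∣∣-mono
      (≤-reflexive (trans (solve 3 (λ k y g → k :* (y :* g) := (y :* k) :* g) refl κ (1# + y) g)
        (trans (*-congʳ (reciprocal-inverse (1# + y) 0<1+y′)) (*-identityˡ g))))
      (∣∣-* (∣∣-real (<⇒≤ (0<reciprocal (1# + y) 0<1+y′))) z≤)

  -- K is so large that β^K absorbs the poles and s + K is far to the right of
  -- the imaginary axis, for every s in the box.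
  K : ℕ
  K = 2 ℕ.* N ℕ.* b ℕ.^ r ℕ.+ (r ℕ.+ (1 ℕ.+ r ℕ.* r))

  1≤K : 1 ℕ.≤ K
  1≤K = ℕ.≤-trans (ℕ.s≤s ℕ.z≤n) (ℕ.≤-trans (ℕ.m≤n+m (1 ℕ.+ r ℕ.* r) r) (ℕ.m≤n+m _ (2 ℕ.* N ℕ.* b ℕ.^ r)))

  ι≤β^ : ∀ n → ι n ≤ β ^ n
  ι≤β^ n = begin
    ι n  ≤⟨ x≤y+x 0≤1 ⟩
    1# + ι n  ≈⟨ +-congˡ (*-identityʳ _) ⟨
    1# + ι n * 1#  ≤⟨ bernoulli 0≤1 n ⟩
    (1# + 1#) ^ n  ≤⟨ ^-mono-≤ (<⇒≤ 0<2) (+-monoʳ-≤ 1# (x≤x+y (ι-nonneg d))) n ⟩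
    β ^ n  ∎

  -- b^K ≥ K, and the first summand of K is 2 N b^r.
  2Nβ^r≤β^K : 2# * (ι N * β ^ r) ≤ β ^ K
  2Nβ^r≤β^K = begin
    2# * (ι N * β ^ r)  ≈⟨ *-assoc _ _ _ ⟨
    2# * ι N * β ^ r
      ≈⟨ *-cong (trans (*-congʳ (solve 0 (:1 :+ :1 := :1 :+ (:1 :+ :0)) refl)) (sym (×1-homo-* 2 N))) (sym (ι-^ b r)) ⟩
    ι (2 ℕ.* N) * ι (b ℕ.^ r)  ≈⟨ ×1-homo-* (2 ℕ.* N) (b ℕ.^ r) ⟨
    ι (2 ℕ.* N ℕ.* b ℕ.^ r)  ≤⟨ ι-mono (ℕ.m≤m+n (2 ℕ.* N ℕ.* b ℕ.^ r) (r ℕ.+ (1 ℕ.+ r ℕ.* r))) ⟩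
    ι K  ≤⟨ ι≤β^ K ⟩
    β ^ K  ∎

  1≤ιK : 1# ≤ ι K
  1≤ιK = ≤-trans (≤-reflexive (sym (+-identityʳ 1#))) (ι-mono 1≤K)

  open Initial r K using (C₀; 0≤C₀; initial-bound)

  R : ℕ
  R = suc (r ℕ.+ K)

  WK κ D₀ Pk M₂ M : Carrier
  WK = W K R
  κ = 2# * (β ^ r * WK + ι N * β ^ r)

  0≤WK : 0# ≤ WK
  0≤WK = *-nonneg (+-nonneg (^-nonneg (<⇒≤ 0<2) K) (*-nonneg 0≤β (<⇒≤ (0<reciprocal _ (P-0-pos 0<h K)))))
    (*-nonneg (P-nonneg ≤-refl (+-nonneg (ι-nonneg (suc d)) (<⇒≤ 0<h)) K) (^-nonneg (<⇒≤ 0<τ) R))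

  0≤κ : 0# ≤ κ
  0≤κ = *-nonneg (<⇒≤ 0<2) (+-nonneg (*-nonneg (0≤β^ r) 0≤WK) (*-nonneg (ι-nonneg N) (0≤β^ r)))

  Ω : ℕ → Carrier
  Ω j = 1# + κ * θ ^ j

  1≤Ω : ∀ j → 1# ≤ Ω j
  1≤Ω j = x≤x+y (*-nonneg 0≤κ (^-nonneg 0≤θ j))

  0≤∏Ω : ∀ n → 0# ≤ ∏ n Ω
  0≤∏Ω n = ∏-nonneg n (λ k → ≤-trans 0≤1 (1≤Ω k))

  -- Since Λ ≤ 1, the values Λ^k / k! decrease; K! / Λ^K compensates for the smallest one up to K.
  D₀ = C₀ * reciprocal (P 0# Λ K) (P-0-pos 0<Λ K)

  0≤D₀ : 0# ≤ D₀
  0≤D₀ = *-nonneg 0≤C₀ (<⇒≤ (0<reciprocal _ (P-0-pos 0<Λ K)))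

  -- `Pk` bounds the first K Pochhammer factors through |s| ≤ 2 r; `M₂` turns (y + Δ) / (y + i + Δ)
  -- into a multiple of 1 / m; the remaining factor in `M` bounds the moments.
  Pk = ∏ K (λ k → ι r + ι r + ι k)
  M₂ = ι K * (ι r + ι K + Δ)
  M = Pk * (M₂ * (D₀ * e (κ * τ)))

  0<1/ : ∀ n .{{_ : NonZero n}} → 0# < 1/ n
  0<1/ (suc n) = 0<inv n

  module _ (s : ℂ) (box : Box r s) where

    open Box box

    y : Carrier
    y = re s + ι K

    1+Δ≤y : 1# + Δ ≤ y
    1+Δ≤y = begin
      1# + Δ  ≈⟨ solve 2 (λ x r → :1 :+ x := :- r :+ (r :+ (:1 :+ x))) refl Δ (ι r) ⟩
      - ι r + (ι r + (1# + Δ))  ≈⟨ +-congˡ (trans (×-homo-+ 1# r (1 ℕ.+ r ℕ.* r)) (+-congˡ (+-congˡ (×1-homo-* r r)))) ⟨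
      - ι r + ι (r ℕ.+ (1 ℕ.+ r ℕ.* r))  ≤⟨ +-mono-≤ -r≤re (ι-mono (ℕ.m≤n+m (r ℕ.+ (1 ℕ.+ r ℕ.* r)) (2 ℕ.* N ℕ.* b ℕ.^ r))) ⟩
      re s + ι K  ∎

    1≤y : 1# ≤ y
    1≤y = ≤-trans (x≤x+y 0≤Δ) 1+Δ≤y

    0≤y : 0# ≤ y
    0≤y = ≤-trans 0≤1 1≤y

    y≤ : y ≤ ι r + ι K
    y≤ = +-monoˡ-≤ (ι K) re≤r

    1+y≤R : 1# + y ≤ ι R
    1+y≤R = +-monoʳ-≤ 1# (≤-trans y≤ (≤-reflexive (sym (×-homo-+ 1# r K))))

    g : ℕ → Carrier
    g = gauge K y 0≤y

    0≤g : ∀ k → 0# ≤ g k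
    0≤g = gauge-nonneg K y 0≤y

    -- The constant grows with k, so that step k may lose the factor `Ω k`; the whole product
    -- remains bounded.
    H : ℕ → Carrier
    H k = (D₀ * ∏ (suc k) Ω) * (Λ ^ k * g k)

    module _ {m a} (solution : IsSolution s m a) where

      Â : ℕ → ℂ
      Â k = α s *ᶜ (a k *ᶜ real (ifac k))

      Â-recurrence : ∀ n → n ℕ.< m → Z s (suc n) *ᶜ Â (suc n) ≈ᶜ S.conv (λ j → real (γ̂ (suc j))) Â n
      Â-recurrence n n<m =
        Z s (suc n) *ᶜ (α s *ᶜ â (suc n))  ≈ᶜ⟨ CS.solve 3 (λ z a u → z CS.:* (a CS.:* u) CS.:= a CS.:* (z CS.:* u)) reflᶜ (Z s (suc n)) (α s) (â (suc n)) ⟩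
        α s *ᶜ (Z s (suc n) *ᶜ â (suc n))  ≈ᶜ⟨ *ᶜ-congˡ (normalise solution n n<m) ⟩
        α s *ᶜ S.conv γ̂ᶜ â n  ≈ᶜ⟨ S.conv-scaleʳ n (α s) γ̂ᶜ â ⟨
        S.conv γ̂ᶜ Â n  ∎ᶜ
        where
        â γ̂ᶜ : ℕ → ℂ
        â k = a k *ᶜ real (ifac k)
        γ̂ᶜ j = real (γ̂ (suc j))

      below-K : ∀ k → k ℕ.≤ m → k ℕ.< K → ∣ Â k ∣≤ H k
      below-K k k≤m k<K = ∣∣-mono (begin
        C₀  ≈⟨ *-identityʳ _ ⟨
        C₀ * 1#  ≈⟨ *-congˡ (reciprocal-inverse _ (P-0-pos 0<Λ K)) ⟨
        C₀ * (P 0# Λ K * Rc)  ≈⟨ solve 3 (λ c p r → c :* (p :* r) := (c :* r) :* p) refl C₀ (P 0# Λ K) Rc ⟩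
        D₀ * P 0# Λ K  ≤⟨ *-mono-≤ (*-nonneg 0≤D₀ (0≤∏Ω (suc k))) (P-nonneg ≤-refl 0≤Λ K) D₀≤ PΛ≤ ⟩
        (D₀ * ∏ (suc k) Ω) * P 0# Λ k
          ≈⟨ *-congˡ (trans (P-cong refl (sym (*-identityʳ Λ)) k) (trans (P-0-dilate Λ 1# k) (*-congˡ (reflexive (≡.sym (glue-< (P 0# 1#) (ρ y 0≤y) k<K)))))) ⟩
        H k  ∎) (initial-bound s box solution k k≤m (ℕ.<⇒≤ k<K))
        where
        Rc = reciprocal (P 0# Λ K) (P-0-pos 0<Λ K)
        D₀≤ : D₀ ≤ D₀ * ∏ (suc k) Ω
        D₀≤ = ≤-trans (≤-reflexive (sym (*-identityʳ D₀))) (*-monoʳ-≤ 0≤D₀ (∏-mono-length {0} {suc k} Ω 1≤Ω ℕ.z≤n))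
        PΛ≤ : P 0# Λ K ≤ P 0# Λ k
        PΛ≤ = begin
          P 0# Λ K  ≡⟨ ≡.cong (P 0# Λ) (ℕ.m∸n+n≡m (ℕ.<⇒≤ k<K)) ⟨
          P 0# Λ (K ℕ.∸ k ℕ.+ k)  ≤⟨ P-0-split 0≤Λ (K ℕ.∸ k) k ⟩
          P 0# Λ (K ℕ.∸ k) * P 0# Λ k  ≤⟨ *-monoˡ-≤ (P-nonneg ≤-refl 0≤Λ k) (P-0-≤1 0≤Λ Λ≤1 (K ℕ.∸ k)) ⟩
          1# * P 0# Λ k  ≈⟨ *-identityˡ _ ⟩
          P 0# Λ k  ∎

      module Step (i : ℕ) where

        m′ : ℕ
        m′ = K ℕ.+ i

        Fm ϑ ζ : Carrier
        Fm = φ (re s) * β ^ m′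
        ϑ = θ ^ m′
        ζ = Fm - ι N

        0≤Fm : 0# ≤ Fm
        0≤Fm = *-nonneg (<⇒≤ (0<φ (re s))) (0≤β^ m′)

        0≤ϑ = ^-nonneg 0≤θ m′

        β^iφy≈Fm : β ^ i * φ y ≈ Fm
        β^iφy≈Fm = begin-equality
          β ^ i * φ (re s + ι K)  ≈⟨ *-congˡ (trans (φ-+ _ _) (*-congˡ (φ-ι K))) ⟩
          β ^ i * (φ (re s) * β ^ K)  ≈⟨ solve 3 (λ a b c → a :* (b :* c) := b :* (c :* a)) refl (β ^ i) (φ (re s)) (β ^ K) ⟩
          φ (re s) * (β ^ K * β ^ i)  ≈⟨ *-congˡ (^-homo-* β K i) ⟨
          Fm  ∎

        -- From b^r |b^s| ≥ 1 and b^K ≥ 2 N b^r. It follows that ζ = |b^(s+m)| - N is at least half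
        -- of |b^(s+m)|.
        2N≤Fm : ι N + ι N ≤ Fm
        2N≤Fm = begin
          ι N + ι N  ≈⟨ solve 1 (λ n → n :+ n := ((:1 :+ :1) :* n) :* :1) refl (ι N) ⟩
          (2# * ι N) * 1#  ≤⟨ *-monoʳ-≤ (*-nonneg (<⇒≤ 0<2) (ι-nonneg N)) 1≤β^rφ ⟩
          (2# * ι N) * (β ^ r * φ (re s))  ≈⟨ solve 4 (λ t n b f → (t :* n) :* (b :* f) := f :* (t :* (n :* b))) refl 2# (ι N) (β ^ r) (φ (re s)) ⟩
          φ (re s) * (2# * (ι N * β ^ r))  ≤⟨ *-monoʳ-≤ (<⇒≤ (0<φ (re s))) 2Nβ^r≤β^K ⟩
          φ (re s) * β ^ K  ≤⟨ *-monoʳ-≤ (<⇒≤ (0<φ (re s))) (≤-trans (≤-reflexive (sym (*-identityʳ _))) (≤-trans (*-monoʳ-≤ (0≤β^ K) (1≤β^ i)) (≤-reflexive (sym (^-homo-* β K i))))) ⟩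
          Fm  ∎

        0<ζ : 0# < ζ
        0<ζ = *-cancel-pos 0<2 (<-respʳ-≈
          (solve 2 (λ f n → f :+ (f :- (n :+ n)) := (:1 :+ :1) :* (f :- n)) refl Fm (ι N))
          (+-pos-nonneg (*-pos (0<φ (re s)) (^-pos (0<ι-suc (suc d)) m′)) (x≤y⇒0≤y-x 2N≤Fm)))

        -- Relative to Fm both perturbations are of order θ^m, and κ was chosen
        -- to be twice their sum.
        step≤ : β ^ i * φ y + WK * (β * θ) ^ m′ ≤ ζ * Ω m′
        step≤ = begin
          β ^ i * φ y + WK * (β * θ) ^ m′  ≤⟨ +-mono-≤ (≤-reflexive β^iφy≈Fm) W≤ ⟩
          Fm + (β ^ r * WK) * (Fm * ϑ)  ≈⟨ solve 2 (λ f w → f :+ w := (f :+ w) :+ :0) refl Fm _ ⟩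
          Fm + (β ^ r * WK) * (Fm * ϑ) + 0#
            -- Two nonnegative terms fill the gap: Fm ≥ 2 N pays, with the factor 2 in κ, for the
            -- divisor Fm - N in place of Fm, and N itself is at most N b^r Fm ϑ.
            ≤⟨ +-monoʳ-≤ _ (+-nonneg (*-nonneg (*-nonneg 0≤κ₁ 0≤ϑ) (x≤y⇒0≤y-x 2N≤Fm)) (x≤y⇒0≤y-x N≤)) ⟩
          Fm + (β ^ r * WK) * (Fm * ϑ) + ((κ₁ * ϑ) * (Fm - (ι N + ι N)) + ((ι N * β ^ r) * (Fm * ϑ) - ι N))
            ≈⟨ solve 5 (λ f w x n c → f :+ w :* (f :* x) :+ (((w :+ c) :* x) :* (f :- (n :+ n)) :+ (c :* (f :* x) :- n))
                 := (f :- n) :* (:1 :+ ((:1 :+ :1) :* (w :+ c)) :* x)) refl Fm (β ^ r * WK) ϑ (ι N) (ι N * β ^ r) ⟩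
          ζ * Ω m′  ∎
          where
          κ₁ = β ^ r * WK + ι N * β ^ r
          0≤κ₁ = +-nonneg (*-nonneg (0≤β^ r) 0≤WK) (*-nonneg (ι-nonneg N) (0≤β^ r))
          βθ^≈ : (β * θ) ^ m′ ≈ β ^ m′ * ϑ
          βθ^≈ = ^-distrib-* β θ m′
          βθ^≤ : (β * θ) ^ m′ ≤ β ^ r * (Fm * ϑ)
          βθ^≤ = begin
            (β * θ) ^ m′  ≈⟨ trans βθ^≈ (sym (*-identityˡ _)) ⟩
            1# * (β ^ m′ * ϑ)  ≤⟨ *-monoˡ-≤ (*-nonneg (0≤β^ m′) 0≤ϑ) 1≤β^rφ ⟩
            (β ^ r * φ (re s)) * (β ^ m′ * ϑ)  ≈⟨ solve 4 (λ a b c d → (a :* b) :* (c :* d) := a :* ((b :* c) :* d)) refl (β ^ r) (φ (re s)) (β ^ m′) ϑ ⟩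
            β ^ r * (Fm * ϑ)  ∎
          W≤ : WK * (β * θ) ^ m′ ≤ (β ^ r * WK) * (Fm * ϑ)
          W≤ = ≤-trans (*-monoʳ-≤ 0≤WK βθ^≤) (≤-reflexive (solve 3 (λ w b x → w :* (b :* x) := (b :* w) :* x) refl WK (β ^ r) (Fm * ϑ)))
          N≤ : ι N ≤ (ι N * β ^ r) * (Fm * ϑ)
          N≤ = begin
            ι N  ≈⟨ *-identityʳ _ ⟨
            ι N * 1#  ≤⟨ *-monoʳ-≤ (ι-nonneg N) (≤-trans (1≤^ 1≤βθ m′) βθ^≤) ⟩
            ι N * (β ^ r * (Fm * ϑ))  ≈⟨ *-assoc _ _ _ ⟨
            (ι N * β ^ r) * (Fm * ϑ)  ∎

        ζ≤Z : ζ * ζ ≤ normSq (Z s m′)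
        ζ≤Z = circle-distance 0≤Fm (trans (normSq-bpow (s +ᶜ nat m′)) (*-cong φ≈ φ≈)) (ι-nonneg N)
          where
          φ≈ : φ (re s + ι m′) ≈ Fm
          φ≈ = trans (φ-+ _ _) (*-congˡ (φ-ι m′))

        -- The products of `Ω` increase, so all earlier bounds share the constant Q. The convolution
        -- costs ζ * Ω m′, and division by |Z| ≥ ζ leaves Q * Ω m′, the constant of `H m′`.
        step : ∀ n → suc n ≡ m′ → n ℕ.< m → (∀ k → k ℕ.≤ n → ∣ Â k ∣≤ H k) → ∣ Â m′ ∣≤ H m′
        step n 1+n≡m′ n<m IH = ∣∣-cancel 0<ζ ζ≤Z
          (≡.subst (λ k → ∣ Z s k *ᶜ Â k ∣≤ (Q * (Λ ^ m′ * conv ε g m′))) 1+n≡m′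
            (∣∣-resp-≈ (symᶜ (Â-recurrence n n<m)) (∣∣-mono sum≤
              (∣∣-conv n {s = λ k → Q * (Λ ^ k * g k)} (λ j _ → ∣∣-real (γ̂-nonneg (suc j)))
                (λ k k≤n → ∣∣-mono (*-monoˡ-≤ (0≤Λg k) (*-monoʳ-≤ 0≤D₀ (∏-mono-length Ω 1≤Ω
                  (ℕ.≤-trans (ℕ.s≤s k≤n) (ℕ.≤-reflexive 1+n≡m′))))) (IH k k≤n))))))
          Q≤
          (*-nonneg (*-nonneg 0≤D₀ (0≤∏Ω (suc m′))) (0≤Λg m′))
          where
          Q : Carrier
          Q = D₀ * ∏ m′ Ω
          0≤Q = *-nonneg 0≤D₀ (0≤∏Ω m′)
          0≤Λg : ∀ k → 0# ≤ Λ ^ k * g k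
          0≤Λg k = *-nonneg (^-nonneg 0≤Λ k) (0≤g k)
          sum≤ : conv (γ̂ ∘ suc) (λ k → Q * (Λ ^ k * g k)) n ≤ Q * (Λ ^ m′ * conv ε g m′)
          sum≤ = begin
            conv (γ̂ ∘ suc) (λ k → Q * (Λ ^ k * g k)) n  ≈⟨ conv-scaleʳ n Q (γ̂ ∘ suc) (λ k → Λ ^ k * g k) ⟩
            -- The recurrence starts at j = 1. The nonnegative term j = 0 is added because the
            -- supersolution estimate concerns the full convolution.
            Q * conv (γ̂ ∘ suc) (λ k → Λ ^ k * g k) n  ≤⟨ *-monoʳ-≤ 0≤Q (x≤y+x (*-nonneg (γ̂-nonneg 0) (0≤Λg (suc n)))) ⟩
            Q * conv γ̂ (λ k → Λ ^ k * g k) (suc n)  ≡⟨ ≡.cong (λ k → Q * conv γ̂ (λ k → Λ ^ k * g k) k) 1+n≡m′ ⟩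
            Q * conv γ̂ (λ k → Λ ^ k * g k) m′  ≤⟨ *-monoʳ-≤ 0≤Q (conv-monoˡ m′ γ̂≤ 0≤Λg) ⟩
            Q * conv (λ k → Λ ^ k * ε k) (λ k → Λ ^ k * g k) m′  ≈⟨ *-congˡ (conv-dilate m′ Λ ε g) ⟩
            Q * (Λ ^ m′ * conv ε g m′)  ∎
          ρi = ρ y 0≤y i
          0≤ρi = <⇒≤ (0<ρ y 0≤y i)
          Q≤ : Q * (Λ ^ m′ * conv ε g m′) ≤ ζ * H m′
          Q≤ = begin
            Q * (Λ ^ m′ * conv ε g m′)
              ≤⟨ *-monoʳ-≤ 0≤Q (*-monoʳ-≤ (^-nonneg 0≤Λ m′) (≤-trans
                   (gauge-supersolution K y 0≤y R (φ y) 1+y≤R (T≤φ y 0≤y) i) (*-monoˡ-≤ 0≤ρi step≤))) ⟩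
            Q * (Λ ^ m′ * ((ζ * Ω m′) * ρi))
              ≈⟨ solve 6 (λ d p l z x r → (d :* p) :* (l :* ((z :* x) :* r)) := z :* ((d :* (p :* x)) :* (l :* r))) refl D₀ (∏ m′ Ω) (Λ ^ m′) ζ (Ω m′) ρi ⟩
            ζ * ((D₀ * (∏ m′ Ω * Ω m′)) * (Λ ^ m′ * ρi))
              ≈⟨ *-congˡ (*-cong (*-congˡ (∏-last m′ Ω)) (*-congˡ (reflexive (glue-+ K i (P 0# 1#) (ρ y 0≤y))))) ⟨
            ζ * H m′  ∎

      Â-bound : ∀ n → n ℕ.≤ m → ∀ k → k ℕ.≤ n → ∣ Â k ∣≤ H k
      Â-bound zero n≤m .zero ℕ.z≤n = below-K 0 ℕ.z≤n 1≤K
      Â-bound (suc n) n<m k k≤1+n = [ (λ k<1+n → IH k (ℕ.s≤s⁻¹ k<1+n)) , last ]′ (ℕ.m≤n⇒m<n∨m≡n k≤1+n)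
        where
        IH = Â-bound n (ℕ.<⇒≤ n<m)
        large : K ℕ.≤ suc n → ∣ Â (suc n) ∣≤ H (suc n)
        large K≤1+n = ≡.subst (λ k → ∣ Â k ∣≤ H k) (ℕ.m+[n∸m]≡n K≤1+n)
          (Step.step (suc n ℕ.∸ K) n (≡.sym (ℕ.m+[n∸m]≡n K≤1+n)) n<m IH)
        last : k ≡ suc n → ∣ Â k ∣≤ H k
        last ≡.refl = [ below-K (suc n) n<m , large ]′ (ℕ.<-≤-connex (suc n) K)

      -- `ρ` cancels: the Pochhammer factors from K on are bounded by a multiple of 1 / (m ρ), the
      -- moment by a multiple of Λ^m ρ.
      modulus-bound-from-K : ∀ i .{{_ : NonZero (K ℕ.+ i)}} → K ℕ.+ i ℕ.≤ m →
        ∣ S.∏ (K ℕ.+ i) (λ k → s +ᶜ nat k) *ᶜ Â (K ℕ.+ i) ∣≤ (M * Λ ^ (K ℕ.+ i) * 1/ (K ℕ.+ i))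
      modulus-bound-from-K i m′≤m = ∣∣-mono (≤-reflexive M≈)
        (∣∣-resp-≈ (transᶜ (symᶜ (*ᶜ-assoc _ _ _)) (*ᶜ-congʳ (symᶜ split)))
          (∣∣-* head≤ (∣∣-* tail≤v Â≤)))
        where
        m′ : ℕ
        m′ = K ℕ.+ i
        ρi η ζ v ν : Carrier
        ρi = ρ y 0≤y i
        0<ρi = 0<ρ y 0≤y i
        ν = 1/ m′
        0≤ν = <⇒≤ (0<1/ m′)
        η = (D₀ * e (κ * τ)) * Λ ^ m′
        ζ = ρi * (y + ι i + Δ)
        v = M₂ * ν * reciprocal ρi 0<ρi
        tail : ℂ
        tail = S.∏ i (λ l → (s +ᶜ nat K) +ᶜ nat l)

        0≤M₂ : 0# ≤ M₂
        0≤M₂ = *-nonneg (ι-nonneg K) (+-nonneg (+-nonneg (ι-nonneg r) (ι-nonneg K)) 0≤Δ)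

        M≈ : Pk * (v * (η * ρi)) ≈ M * Λ ^ m′ * ν
        M≈ = begin-equality
          Pk * ((M₂ * ν * Rc) * (((D₀ * E′) * Λ ^ m′) * ρi))
            ≈⟨ solve 8 (λ P M n R D E l r → P :* ((M :* n :* R) :* (((D :* E) :* l) :* r)) := (P :* (M :* (D :* E)) :* l :* n) :* (r :* R)) refl
                 Pk M₂ ν Rc D₀ E′ (Λ ^ m′) ρi ⟩
          (M * Λ ^ m′ * ν) * (ρi * Rc)  ≈⟨ trans (*-congˡ (reciprocal-inverse ρi 0<ρi)) (*-identityʳ _) ⟩
          M * Λ ^ m′ * ν  ∎
          where
          Rc = reciprocal ρi 0<ρi
          E′ = e (κ * τ)

        split : S.∏ m′ (λ k → s +ᶜ nat k) ≈ᶜ S.∏ K (λ k → s +ᶜ nat k) *ᶜ tail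
        split = transᶜ (S.∏-split K i (λ k → s +ᶜ nat k)) (*ᶜ-congˡ (S.∏-cong i (λ l →
          transᶜ (+ᶜ-congˡ (transᶜ (real-cong (×-homo-+ 1# K l)) (real-+ (ι K) (ι l)))) (symᶜ (+ᶜ-assoc s (nat K) (nat l))))))

        ∣s∣≤ : ∣ s ∣≤ (ι r + ι r)
        ∣s∣≤ = +-nonneg (ι-nonneg r) (ι-nonneg r) , (begin
          re s * re s + im s * im s  ≤⟨ +-mono-≤ re²≤ im≤r ⟩
          Δ + Δ  ≤⟨ x≤x+y (+-nonneg 0≤Δ 0≤Δ) ⟩
          Δ + Δ + (Δ + Δ)  ≈⟨ solve 1 (λ r → r :* r :+ r :* r :+ (r :* r :+ r :* r) := (r :+ r) :* (r :+ r)) refl (ι r) ⟩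
          (ι r + ι r) * (ι r + ι r)  ∎)
          where
          re²≤ : re s * re s ≤ Δ
          re²≤ = 0≤d⇒x≤y (*-nonneg (x≤y⇒0≤y-x re≤r) (x≤y⇒0≤y-x -r≤re))
            (solve 2 (λ x r → x :* x :+ (r :- x) :* (x :- :- r) := r :* r) refl (re s) (ι r))

        head≤ : ∣ S.∏ K (λ k → s +ᶜ nat k) ∣≤ Pk
        head≤ = ∣∣-∏ K (λ k _ → ∣∣-+ ∣s∣≤ (∣∣-real (ι-nonneg k)))

        0<ζ : 0# < ζ
        0<ζ = *-pos 0<ρi (+-pos-nonneg (+-pos-nonneg (<-≤-trans 0<1 1≤y) (ι-nonneg i)) 0≤Δ)

        tail≤v : ∣ tail ∣≤ v
        tail≤v = ∣∣-cancel {z = real ζ} 0<ζ (x≤x+y (*-nonneg ≤-refl ≤-refl))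
          (pochhammer-ρ i y 0≤y (s +ᶜ nat K) refl (≤-trans (≤-reflexive (*-cong (+-identityʳ _) (+-identityʳ _))) im≤r) 1+Δ≤y)
          y+Δ≤ζv (*-nonneg (*-nonneg 0≤M₂ 0≤ν) (<⇒≤ (0<reciprocal ρi 0<ρi)))
          where
          m≤ : ι m′ ≤ (y + ι i + Δ) * ι K
          m≤ = begin
            ι m′  ≈⟨ ×-homo-+ 1# K i ⟩
            ι K + ι i  ≈⟨ +-cong (*-identityˡ _) (*-identityʳ _) ⟨
            1# * ι K + ι i * 1#  ≤⟨ +-mono-≤ (*-monoˡ-≤ (ι-nonneg K) (≤-trans 1≤y (x≤x+y 0≤Δ))) (*-monoʳ-≤ (ι-nonneg i) 1≤ιK) ⟩
            (y + Δ) * ι K + ι i * ι K  ≈⟨ solve 4 (λ y x i k → (y :+ x) :* k :+ i :* k := (y :+ i :+ x) :* k) refl y Δ (ι i) (ι K) ⟩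
            (y + ι i + Δ) * ι K  ∎
          y+Δ≤ζv : y + Δ ≤ ζ * v
          y+Δ≤ζv = begin
            y + Δ  ≤⟨ +-monoˡ-≤ Δ y≤ ⟩
            Y  ≈⟨ *-identityʳ _ ⟨
            Y * 1#  ≈⟨ *-congˡ (1/-inverse m′) ⟨
            Y * (ι m′ * ν)  ≤⟨ *-monoʳ-≤ 0≤Y (*-monoˡ-≤ 0≤ν m≤) ⟩
            Y * (((y + ι i + Δ) * ι K) * ν)  ≈⟨ trans (sym (*-identityʳ _)) (*-congˡ (sym (reciprocal-inverse ρi 0<ρi))) ⟩
            (Y * (((y + ι i + Δ) * ι K) * ν)) * (ρi * reciprocal ρi 0<ρi)
              ≈⟨ solve 6 (λ Y w k n r R → (Y :* ((w :* k) :* n)) :* (r :* R) := (r :* w) :* ((k :* Y) :* n :* R)) refl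
                   Y (y + ι i + Δ) (ι K) ν ρi (reciprocal ρi 0<ρi) ⟩
            ζ * v  ∎
            where
            Y = ι r + ι K + Δ
            0≤Y = +-nonneg (+-nonneg (ι-nonneg r) (ι-nonneg K)) 0≤Δ

        Â≤ : ∣ Â m′ ∣≤ (η * ρi)
        Â≤ = ∣∣-mono (begin
          (D₀ * ∏ (suc m′) Ω) * (Λ ^ m′ * g m′)
            ≤⟨ *-mono-≤ (*-nonneg 0≤D₀ (<⇒≤ (0<e (κ * τ)))) (*-nonneg (^-nonneg 0≤Λ m′) (0≤g m′))
                 (*-monoʳ-≤ 0≤D₀ (∏-geometric 0≤κ 0≤θ 0<τ 1-θ (suc m′)))
                 (≤-reflexive (*-congˡ (reflexive (glue-+ K i (P 0# 1#) (ρ y 0≤y))))) ⟩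
          (D₀ * e (κ * τ)) * (Λ ^ m′ * ρi)  ≈⟨ *-assoc _ _ _ ⟨
          η * ρi  ∎) (Â-bound m ℕ.≤-refl m′ m′≤m)

      modulus-bound : ∀ n .{{_ : NonZero n}} → K ℕ.≤ n → n ℕ.≤ m →
        ∣ S.∏ n (λ k → s +ᶜ nat k) *ᶜ Â n ∣≤ (M * Λ ^ n * 1/ n)
      modulus-bound n K≤n = shifted n (ℕ.m≤n⇒∃[o]m+o≡n K≤n)
        where
        shifted : ∀ n .{{_ : NonZero n}} → ∃[ i ] K ℕ.+ i ≡ n → n ℕ.≤ m →
          ∣ S.∏ n (λ k → s +ᶜ nat k) *ᶜ Â n ∣≤ (M * Λ ^ n * 1/ n)
        shifted n (i , ≡.refl) = modulus-bound-from-K i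

-- Passage to the limit along positive increments, and boundedness of compact sets.

module Perturbation {c ℓ₁ ℓ₂} (ℛ : CompleteOrderedField c ℓ₁ ℓ₂) where

  open Limits ℛ
  open Gauge ℛ using (inv-antitone)

  -- The bound is a pair of negations. This stability is what admits regular points that exist only
  -- up to double negation.
  ∣∣-stable : ∀ {z r} → ¬ ¬ ∣ z ∣≤ r → ∣ z ∣≤ r
  ∣∣-stable nn = (λ lt → nn (λ (p , _) → p lt)) , (λ lt → nn (λ (_ , p) → p lt))

  inv-small : ∀ {δ} → 0# < δ → ∃[ j ] inv j ≤ δ
  inv-small {δ} 0<δ = j , *-cancelˡ-≤ (0<ι-suc j) (begin
    ι (suc j) * inv j  ≈⟨ inv-inverse j ⟩
    1#  ≈⟨ reciprocal-inverse δ 0<δ ⟨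
    δ * reciprocal δ 0<δ  ≤⟨ *-monoʳ-≤ (<⇒≤ 0<δ) (≤-trans (<⇒≤ (proj₂ (archimedean _))) (ι-mono (ℕ.n≤1+n j))) ⟩
    δ * ι (suc j)  ≈⟨ *-comm _ _ ⟩
    ι (suc j) * δ  ∎)
    where j = proj₁ (archimedean (reciprocal δ 0<δ))

  -- Continuity with a rate, along s + h with h > 0 real, the only direction in which s is
  -- approached. The form C h composes under products without a choice of δ.
  LipschitzAt : (ℂ → ℂ) → ℂ → Set _
  LipschitzAt g s = ∃[ C ] 0# ≤ C × (∃[ j ] ∀ h → 0# < h → h < inv j → ∣ g (s +ᶜ real h) -ᶜ g s ∣≤ (C * h))

  lipschitz-const : ∀ z s → LipschitzAt (λ _ → z) s
  lipschitz-const z s = 0# , ≤-refl , 0 , λ h _ _ →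
    ∣∣-resp-≈ (CS.solve 1 (λ z → CS.:0 CS.:= z CS.:- z) reflᶜ z) (∣∣-mono (≤-reflexive (sym (zeroˡ h))) ∣0∣≤0)

  lipschitz-shift : ∀ z s → LipschitzAt (_+ᶜ z) s
  lipschitz-shift z s = 1# , 0≤1 , 0 , λ h 0<h _ →
    ∣∣-resp-≈ (CS.solve 3 (λ s h z → h CS.:= (s CS.:+ h CS.:+ z) CS.:- (s CS.:+ z)) reflᶜ s (real h) z)
      (∣∣-mono (≤-reflexive (sym (*-identityˡ h))) (∣∣-real (<⇒≤ 0<h)))

  lipschitz-* : ∀ {g g′ s} → LipschitzAt g s → LipschitzAt g′ s → LipschitzAt (λ z → g z *ᶜ g′ z) s
  lipschitz-* {g} {g′} {s} (C , 0≤C , j , lip) (C′ , 0≤C′ , j′ , lip′) =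
    C * C′ + C * B′ + B * C′ , +-nonneg (+-nonneg (*-nonneg 0≤C 0≤C′) (*-nonneg 0≤C 0≤B′)) (*-nonneg 0≤B 0≤C′) ,
    j ℕ.+ j′ , λ h 0<h h<inv →
      let x = lip h 0<h (<-≤-trans h<inv (≤-trans (≤-reflexive (reflexive (≡.cong inv (ℕ.+-comm j j′)))) (inv-antitone j′ j)))
          x′ = lip′ h 0<h (<-≤-trans h<inv (inv-antitone j j′)) in
      ∣∣-mono (bound h (<⇒≤ 0<h) (<⇒≤ (<-≤-trans h<inv (inv≤1 (j ℕ.+ j′))))) $
      ∣∣-resp-≈ (CS.solve 4 (λ x y l l′ → (x CS.:- l) CS.:* (y CS.:- l′) CS.:+ (x CS.:- l) CS.:* l′ CS.:+ l CS.:* (y CS.:- l′)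
          CS.:= x CS.:* y CS.:- l CS.:* l′) reflᶜ (g (s +ᶜ real h)) (g′ (s +ᶜ real h)) (g s) (g′ s))
        (∣∣-+ (∣∣-+ (∣∣-* x x′) (∣∣-* x (∣∣-bound (g′ s)))) (∣∣-* (∣∣-bound (g s)) x′))
    where
    B B′ : Carrier
    B = 1# + normSq (g s)
    B′ = 1# + normSq (g′ s)
    0≤B = proj₁ (∣∣-bound (g s))
    0≤B′ = proj₁ (∣∣-bound (g′ s))
    bound : ∀ h → 0# ≤ h → h ≤ 1# → (C * h) * (C′ * h) + (C * h) * B′ + B * (C′ * h) ≤ (C * C′ + C * B′ + B * C′) * h
    bound h 0≤h h≤1 = begin
      (C * h) * (C′ * h) + (C * h) * B′ + B * (C′ * h)
        ≈⟨ solve 5 (λ c d i p q → (c :* i) :* (d :* i) :+ (c :* i) :* p :+ q :* (d :* i)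
             := ((c :* d) :* i :+ c :* p :+ q :* d) :* i) refl C C′ h B′ B ⟩
      ((C * C′) * h + C * B′ + B * C′) * h
        ≤⟨ *-monoˡ-≤ 0≤h (+-monoˡ-≤ _ (+-monoˡ-≤ _ (≤-trans (*-monoʳ-≤ (*-nonneg 0≤C 0≤C′) h≤1) (≤-reflexive (*-identityʳ _))))) ⟩
      (C * C′ + C * B′ + B * C′) * h ∎

  lipschitz-∏ : ∀ n (g : ℕ → ℂ → ℂ) {s} → (∀ k → LipschitzAt (g k) s) → LipschitzAt (λ z → S.∏ n (λ k → g k z)) s
  lipschitz-∏ zero    g {s} lip = lipschitz-const 1ᶜ s
  lipschitz-∏ (suc n) g lip = lipschitz-* {g 0} {λ z → S.∏ n (λ k → g (suc k) z)} (lip 0) (lipschitz-∏ n (g ∘ suc) (lip ∘ suc))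

  -- The definition of the derivative at ε = 1, with 1 + |g'|² as a bound for |g'|.
  differentiable⇒lipschitz : ∀ {g s g′} → HasDerivative g s g′ → LipschitzAt g s
  differentiable⇒lipschitz {g} {s} {g′} derivative = 1# + (1# + normSq g′) , +-nonneg 0≤1 (proj₁ (∣∣-bound g′)) , j , bound
    where
    δ = proj₁ (derivative 1# 0<1)
    0<δ = proj₁ (proj₂ (derivative 1# 0<1))
    near = proj₂ (proj₂ (derivative 1# 0<1))
    j = proj₁ (inv-small 0<δ)
    bound : ∀ h → 0# < h → h < inv j → ∣ g (s +ᶜ real h) -ᶜ g s ∣≤ ((1# + (1# + normSq g′)) * h)
    bound h 0<h h<inv = ∣∣-mono (≤-reflexive (solve 2 (λ h n → h :+ (:1 :+ n) :* h := (:1 :+ (:1 :+ n)) :* h) refl h (normSq g′)))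
      (∣∣-resp-≈ (CS.solve 3 (λ x y z → (x CS.:- y CS.:- z) CS.:+ z CS.:= x CS.:- y) reflᶜ (g w) (g s) (g′ *ᶜ (w -ᶜ s)))
        (∣∣-+ {z = g w -ᶜ g s -ᶜ g′ *ᶜ (w -ᶜ s)} {w = g′ *ᶜ (w -ᶜ s)} (<⇒≤ 0<h , le) (∣∣-* (∣∣-bound g′) (∣∣-resp-≈ h≈ (∣∣-real (<⇒≤ 0<h))))))
      where
      w : ℂ
      w = s +ᶜ real h
      h≈ : real h ≈ᶜ w -ᶜ s
      h≈ = CS.solve 2 (λ s h → h CS.:= s CS.:+ h CS.:- s) reflᶜ s (real h)
      normSq≈ : normSq (w -ᶜ s) ≈ h * h
      normSq≈ = trans (normSq-cong (CS.solve 2 (λ s h → s CS.:+ h CS.:- s CS.:= h) reflᶜ s (real h)))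
        (solve 1 (λ h → h :* h :+ :0 :* :0 := h :* h) refl h)
      le : normSq (g w -ᶜ g s -ᶜ g′ *ᶜ (w -ᶜ s)) ≤ h * h
      le = ≤-trans (near w (0<δ , <-respˡ-≈ (sym normSq≈) (square-mono-< (<⇒≤ 0<h) (<-≤-trans h<inv (proj₂ (inv-small 0<δ))))))
        (≤-reflexive (trans (*-congˡ normSq≈) (solve 1 (λ h → :1 :* :1 :* (h :* h) := h :* h) refl h)))

  -- |g s| ≤ r + C h for arbitrarily small h. The instance n = 0 of the hypothesis serves to extract
  -- `0 ≤ r`.
  lipschitz-bound : ∀ {g s r} → LipschitzAt g s →
    (∀ n → ¬ ¬ (∃[ h ] 0# < h × h < inv n × ∣ g (s +ᶜ real h) ∣≤ r)) → ∣ g s ∣≤ r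
  lipschitz-bound {g} {s} {r} (C , 0≤C , j , lip) near = ∣∣-stable λ ¬bound → near 0 λ (_ , _ , _ , 0≤r , _) →
    ¬bound (∣∣-limit C 0≤r 0≤C λ n → ∣∣-stable λ ¬bound′ → near (j ℕ.+ n) λ (h , 0<h , h<inv , gh≤) →
      ¬bound′ (∣∣-mono (+-monoʳ-≤ r (*-monoʳ-≤ 0≤C (≤-trans (<⇒≤ h<inv) (inv-antitone j n))))
        (∣∣-resp-≈ (CS.solve 2 (λ x y → x CS.:- (x CS.:- y) CS.:= y) reflᶜ (g (s +ᶜ real h)) (g s))
          (∣∣-- gh≤ (lip h 0<h (<-≤-trans h<inv
            (≤-trans (≤-reflexive (reflexive (≡.cong inv (ℕ.+-comm j n)))) (inv-antitone n j))))))))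

  finite-bound : ∀ n (x : Fin n → ℂ) → ∃[ r ] ∀ i → ∣ x i ∣≤ ι r
  finite-bound zero    x = 0 , λ ()
  finite-bound (suc n) x =
    let r , xs≤ = finite-bound n (x ∘ Fin.suc)
        r₀ , x₀≤ = archimedean (1# + normSq (x Fin.zero)) in
    r₀ ℕ.+ r , λ where
      Fin.zero    → ∣∣-mono (≤-trans (<⇒≤ x₀≤) (ι-mono (ℕ.m≤m+n r₀ r))) (∣∣-bound (x Fin.zero))
      (Fin.suc i) → ∣∣-mono (ι-mono (ℕ.m≤n+m r r₀)) (xs≤ i)

  -- A finite 1-net is bounded by some r, and every point lies within 1 of it.
  compact-bound : ∀ {p} {Q : Pred ℂ p} → IsCompact Q → ∃[ r ] ∀ s → Q s → ∣ s ∣≤ ι r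
  compact-bound compact =
    let n , x , _ , net = IsCompact.totallyBounded compact 1# 0<1
        r , x≤ = finite-bound n x in
    suc r , λ s s∈Q → let i , near = net s s∈Q in
      ∣∣-resp-≈ (CS.solve 2 (λ s x → s CS.:- x CS.:+ x CS.:= s) reflᶜ s (x i)) (∣∣-+ (<⇒∣∣≤ near) (x≤ i))

-- Density of the regular points.

module RegularPoints {c ℓ₁ ℓ₂} (ℛ : CompleteOrderedField c ℓ₁ ℓ₂)
  (exp : Analysis.ℂ ℛ → Analysis.ℂ ℛ) (isExp : Analysis.IsExp ℛ exp)
  (d : ℕ) (A : Subset (suc (suc d))) (L : CompleteOrderedField.Carrier ℛ)
  (exp-L : IsLog ℛ exp (suc (suc d)) L)
  where

  open Recurrence ℛ exp isExp d A L exp-L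

  -- The negation of 0 < L is L ≤ 0 by definition, and it would give b = e L ≤ 1.
  ¬¬0<L : ¬ ¬ (0# < L)
  ¬¬0<L L≤0 = <-irrefl refl (begin-strict
    1#  <⟨ 1<β ⟩
    β  ≈⟨ e-L ⟨
    e L  ≤⟨ e-mono L≤0 ⟩
    e 0#  ≈⟨ e-0 ⟩
    1#  ∎)

  φ-mono-< : 0# < L → ∀ {x y} → x < y → φ x < φ y
  φ-mono-< 0<L x<y = e-mono-< (<-respˡ-≈ (*-comm _ _) (<-respʳ-≈ (*-comm _ _) (*-monoʳ-< 0<L x<y)))

  -- b^z lies on the circle of radius φ (Re z), whose distance from N is |φ (Re z) - N|.
  off-circle : ∀ z → φ (re z) < ι N ⊎ ι N < φ (re z) → Nonzero (bpow z -ᶜ nat N)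
  off-circle z apart = <-≤-trans (0<square apart) (circle-distance (<⇒≤ (0<φ (re z))) (normSq-bpow z) (ι-nonneg N))
    where
    0<square : ∀ {x y} → x < y ⊎ y < x → 0# < (x - y) * (x - y)
    0<square {x} {y} (inj₁ x<y) = <-respʳ-≈ (solve 2 (λ x y → (y :- x) :* (y :- x) := (x :- y) :* (x :- y)) refl x y)
      (*-pos (x<y⇒0<y-x x<y) (x<y⇒0<y-x x<y))
    0<square (inj₂ y<x) = *-pos (x<y⇒0<y-x y<x) (x<y⇒0<y-x y<x)

  midpoint : Carrier → Carrier → Carrier
  midpoint l r = l + (r - l) * inv 1

  l<midpoint : ∀ {l r} → l < r → l < midpoint l r
  l<midpoint l<r = 0<d⇒x<y (*-pos (x<y⇒0<y-x l<r) (0<inv 1)) refl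

  midpoint<r : ∀ {l r} → l < r → midpoint l r < r
  midpoint<r {l} {r} l<r = 0<d⇒x<y (*-pos (x<y⇒0<y-x l<r) (0<inv 1)) (begin-equality
    l + (r - l) * inv 1 + (r - l) * inv 1  ≈⟨ solve 3 (λ l r i → l :+ (r :- l) :* i :+ (r :- l) :* i := l :+ (r :- l) :* (i :+ i)) refl l r (inv 1) ⟩
    l + (r - l) * (inv 1 + inv 1)  ≈⟨ +-congˡ (*-congˡ h+h≈1) ⟩
    l + (r - l) * 1#  ≈⟨ solve 2 (λ l r → l :+ (r :- l) :* :1 := r) refl l r ⟩
    r  ∎)

  -- |b^(s+h+j)| is strictly increasing in h, so a half of every interval
  -- avoids the circle of radius N.
  regular-interval : 0# < L → ∀ s m l r → l < r → ¬ ¬ (∃[ l′ ] ∃[ r′ ] l ≤ l′ × l′ < r′ × r′ ≤ r ×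
    (∀ h → l′ < h → h < r′ → ∀ j → j ℕ.< m → Nonzero (bpow (s +ᶜ real h +ᶜ nat j) -ᶜ nat N)))
  regular-interval 0<L s zero l r l<r k = k (l , r , ≤-refl , l<r , ≤-refl , λ _ _ _ _ ())
  regular-interval 0<L s (suc m) l r l<r k = regular-interval 0<L s m l r l<r halve
    where
    radius : Carrier → Carrier
    radius h = φ (re s + h + ι m)
    radius-< : ∀ {x y} → x < y → radius x < radius y
    radius-< x<y = φ-mono-< 0<L (+-monoˡ-< (ι m) (+-monoʳ-< (re s) x<y))
    halve : ¬ (∃[ l′ ] ∃[ r′ ] l ≤ l′ × l′ < r′ × r′ ≤ r ×
      (∀ h → l′ < h → h < r′ → ∀ j → j ℕ.< m → Nonzero (bpow (s +ᶜ real h +ᶜ nat j) -ᶜ nat N)))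
    -- `≤-by-cases` concludes a negation. The goal is absurdity, obtained as the negation of ℕ
    -- applied to m; any inhabited type would serve.
    halve (l′ , r′ , l≤l′ , l′<r′ , r′≤r , regular) = ≤-by-cases (radius mid) (ι N)
      (λ below _ → k (left below)) (λ above _ → k (right above)) m
      where
      mid = midpoint l′ r′
      l′<mid = l<midpoint l′<r′
      mid<r′ = midpoint<r l′<r′
      extend : ∀ {h} → l′ < h → h < r′ → radius h < ι N ⊎ ι N < radius h →
        ∀ j → j ℕ.< suc m → Nonzero (bpow (s +ᶜ real h +ᶜ nat j) -ᶜ nat N)
      extend {h} l′<h h<r′ apart j j≤m = [ regular h l′<h h<r′ j , (λ where ≡.refl → off-circle (s +ᶜ real h +ᶜ nat m) apart) ]′ (ℕ.m≤n⇒m<n∨m≡n (ℕ.s≤s⁻¹ j≤m))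
      left : radius mid < ι N → _
      left below = l′ , mid , l≤l′ , l′<mid , ≤-trans (<⇒≤ mid<r′) r′≤r ,
        λ h l′<h h<mid → extend l′<h (<-trans h<mid mid<r′) (inj₁ (<-trans (radius-< h<mid) below))
      right : ι N ≤ radius mid → _
      right above = mid , r′ , ≤-trans l≤l′ (<⇒≤ l′<mid) , mid<r′ , r′≤r ,
        λ h mid<h h<r′ → extend (<-trans l′<mid mid<h) h<r′ (inj₂ (≤-<-trans above (radius-< mid<h)))

  regular-dense : ∀ s m n → ¬ ¬ (∃[ h ] 0# < h × h < inv n × Regular m (s +ᶜ real h))
  regular-dense s m n k = ¬¬0<L λ 0<L → regular-interval 0<L s (suc m) 0# (inv n) (0<inv n)
    λ (l , r , 0≤l , l<r , r≤inv , regular) →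
      k (midpoint l r , ≤-<-trans 0≤l (l<midpoint l<r) , <-≤-trans (midpoint<r l<r) r≤inv ,
         λ j j≤m → regular (midpoint l r) (l<midpoint l<r) (midpoint<r l<r) j (ℕ.s≤s j≤m))

-- From rectangles and regular points to compact sets.

module Assembly {c ℓ₁ ℓ₂ p} (ℛ : CompleteOrderedField c ℓ₁ ℓ₂)
  (exp : Analysis.ℂ ℛ → Analysis.ℂ ℛ) (isExp : Analysis.IsExp ℛ exp)
  (d : ℕ) (A : Subset (suc (suc d)))
  (A≠0 : ∃[ a ] a ∈ A × toℕ a ≢ 0)
  (L : CompleteOrderedField.Carrier ℛ)
  (exp-L : IsLog ℛ exp (suc (suc d)) L)
  (α : Analysis.ℂ ℛ → Analysis.ℂ ℛ)
  (isAlpha : Moments.IsAlpha ℛ (base-power ℛ exp L) A α)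
  (αu : ℕ → Analysis.ℂ ℛ → Analysis.ℂ ℛ) (entire : ∀ m → Analysis.Entire ℛ (αu m))
  (αu≈ : ∀ m s (reg : Moments.Regular ℛ (base-power ℛ exp L) A m s) →
    Analysis._≈_ ℛ (αu m s) (Analysis._*_ ℛ (α s) (Moments.u ℛ (base-power ℛ exp L) A m s reg)))
  (Q : Pred (Analysis.ℂ ℛ) p) (compact : Analysis.IsCompact ℛ Q)
  where

  private
    module PT = Perturbation ℛ
    r₀ : ℕ
    r₀ = proj₁ (PT.compact-bound compact)

  -- One more than the radius of Q, so that the points s + h with h ≤ 1 stay in the same rectangle.
  open UniformBound ℛ exp isExp d A L exp-L (DigitBounds.0<f A A≠0) α isAlpha (suc r₀) public
  open RegularPoints ℛ exp isExp d A L exp-L using (regular-dense)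

  disc⇒Box : ∀ {r s} → ∣ s ∣≤ ι r → Box r s
  disc⇒Box {r} {s} s≤ = record
    { -r≤re = ≤-trans (neg-mono-≤ (re≤ {z = -ᶜ s} (∣∣-neg s≤))) (≤-reflexive (solve 1 (λ x → :- :- x := x) refl (re s)))
    ; re≤r  = re≤ s≤
    ; im≤r  = ≤-trans (x≤y+x (x*x-nonneg (re s))) (proj₂ s≤) }

  value : ∀ m .{{_ : NonZero m}} → ℂ → ℂ
  value m s = S.∏ m (λ k → s +ᶜ nat k) *ᶜ real (1/ (m !) {{m !≢0}}) *ᶜ αu m s

  ifac≈ : ∀ m → ifac m ≈ 1/ (m !) {{m !≢0}}
  ifac≈ m = begin-equality
    ifac m  ≈⟨ *-identityʳ _ ⟨
    ifac m * 1#  ≈⟨ *-congˡ (1/-inverse (m !) {{m !≢0}}) ⟨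
    ifac m * (ι (m !) * 1/ (m !) {{m !≢0}})  ≈⟨ solve 3 (λ f i r → f :* (i :* r) := (i :* f) :* r) refl (ifac m) (ι (m !)) _ ⟩
    (ι (m !) * ifac m) * 1/ (m !) {{m !≢0}}  ≈⟨ trans (*-congʳ (ifac-inverse m)) (*-identityˡ _) ⟩
    1/ (m !) {{m !≢0}}  ∎

  regular-bound : ∀ m .{{_ : NonZero m}} → K ℕ.≤ m → ∀ s → ∣ s ∣≤ ι (suc r₀) → Regular m s →
    ∣ value m s ∣≤ (M * Λ ^ m * 1/ m)
  regular-bound m K≤m s s≤ reg = ∣∣-resp-≈ (symᶜ value≈)
    (modulus-bound s (disc⇒Box s≤) {m} {entry (uTable m s reg)} (table-solution m s reg) m K≤m ℕ.≤-refl)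
    where
    poch : ℂ
    poch = S.∏ m (λ k → s +ᶜ nat k)
    value≈ : value m s ≈ᶜ poch *ᶜ (α s *ᶜ (entry (uTable m s reg) m *ᶜ real (ifac m)))
    value≈ =
      poch *ᶜ real (1/ (m !) {{m !≢0}}) *ᶜ αu m s
        ≈ᶜ⟨ *ᶜ-cong (*ᶜ-congˡ (real-cong (sym (ifac≈ m)))) (αu≈ m s reg) ⟩
      poch *ᶜ real (ifac m) *ᶜ (α s *ᶜ u m s reg)
        ≈ᶜ⟨ CS.solve 4 (λ p f a u → p CS.:* f CS.:* (a CS.:* u) CS.:= p CS.:* (a CS.:* (u CS.:* f))) reflᶜ poch (real (ifac m)) (α s) (u m s reg) ⟩
      poch *ᶜ (α s *ᶜ (u m s reg *ᶜ real (ifac m)))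
        ≈ᶜ⟨ *ᶜ-congˡ (*ᶜ-congˡ (*ᶜ-congʳ (≡⇒≈ᶜ (entry-head m (uTable m s reg))))) ⟨
      poch *ᶜ (α s *ᶜ (entry (uTable m s reg) m *ᶜ real (ifac m))) ∎ᶜ

  -- At a pole of u_m only continuity ties the value to the recurrence, and it comes from `αu m`
  -- being entire.
  value-lipschitz : ∀ m .{{_ : NonZero m}} s → PT.LipschitzAt (value m) s
  value-lipschitz m s = PT.lipschitz-*
    {λ z → S.∏ m (λ k → z +ᶜ nat k) *ᶜ real (1/ (m !) {{m !≢0}})} {αu m} {s}
    (PT.lipschitz-* {λ z → S.∏ m (λ k → z +ᶜ nat k)} {λ _ → real (1/ (m !) {{m !≢0}})} {s}
      (PT.lipschitz-∏ m (λ k z → z +ᶜ nat k) {s} (λ k → PT.lipschitz-shift (nat k) s))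
      (PT.lipschitz-const (real (1/ (m !) {{m !≢0}})) s))
    (PT.differentiable⇒lipschitz {αu m} {s} (proj₂ (entire m s)))

  -- At poles of u_m the bound is inherited from nearby regular points.
  bound : ∀ s → Q s → ∀ m .{{_ : NonZero m}} → K ℕ.≤ m → ∣ value m s ∣≤ (M * Λ ^ m * 1/ m)
  bound s s∈Q m K≤m = PT.lipschitz-bound {value m} {s} (value-lipschitz m s) λ n ¬near →
    regular-dense s m n λ (h , 0<h , h<inv , reg) → ¬near (h , 0<h , h<inv , near h 0<h (<⇒≤ (<-≤-trans h<inv (inv≤1 n))) reg)
    where
    near : ∀ h → 0# < h → h ≤ 1# → Regular m (s +ᶜ real h) → ∣ value m (s +ᶜ real h) ∣≤ (M * Λ ^ m * 1/ m)
    near h 0<h h≤1 = regular-bound m K≤m (s +ᶜ real h)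
      (∣∣-mono (≤-trans (+-monoʳ-≤ (ι r₀) h≤1) (≤-reflexive (+-comm (ι r₀) 1#)))
        (∣∣-+ (proj₂ (PT.compact-bound compact) s s∈Q) (∣∣-real (<⇒≤ 0<h))))

theorem2p3 : ∀ {c ℓ₁ ℓ₂ p} (ℛ : CompleteOrderedField c ℓ₁ ℓ₂) →
    let open Analysis ℛ in
    (exp : ℂ → ℂ) → IsExp exp →
    (b : ℕ) .{{_ : NonTrivial b}} (A : Subset b) →
    (∃[ a ] a ∈ A × toℕ a ≢ 0) →
    (log-b : ℝ) → exp (real log-b) ≈ nat b →
    let open Moments ℛ (λ s → exp (s * real log-b)) A in
    (α : ℂ → ℂ) → IsAlpha α →
    (αu : ℕ → ℂ → ℂ) → (∀ m → Entire (αu m)) →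
    (∀ m s (reg : Regular m s) → αu m s ≈ α s * u m s reg) →
    (Q : Pred ℂ p) → IsCompact Q →
    ∃[ M ] ∃[ m₀ ] 1 ℕ.≤ m₀ ×
    (∀ s → Q s → ∀ m .{{_ : NonZero m}} → m₀ ℕ.≤ m →
    ∣ pochhammer s m * real (ℝ.1/ (m !) {{m !≢0}}) * αu m s ∣≤ (M ℝ.* Λ ℝ.^ m ℝ.* ℝ.1/ m))
-- For b = 1 the only digit is 0, against the assumption of a non-zero digit.
theorem2p3 ℛ exp isExp (suc zero) A (Fin.zero , _ , 0≢0) = ⊥-elim (0≢0 ≡.refl)
theorem2p3 ℛ exp isExp (suc (suc d)) A A≠0 log-b exp-L α isAlpha αu entire αu≈ Q compact =
  M , K , 1≤K , bound
  where
  open Assembly ℛ exp isExp d A A≠0 log-b exp-L α isAlpha αu entire αu≈ Q compact
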